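{- Let $r\ge 2$ and let $\mathbf{a}=(a_1,\dots,a_r)$ be an $r$-tuple of positive integers which are pairwise coprime. For each integer $n\ge 2$ let $\mathbf{X}^{(n)}=(X^{(n)}_1,\dots,X^{(n)}_r)$, where the $X^{(n)}_j$ are independent random variables uniformly distributed in $\{1,\dots,n\}$. Then: (a) $$\lim_{n\to\infty}\mathbf{P}\big(\mathbf{X}^{(n)}\in\mathcal{PC}_{\mathbf{a}}\big)=T_r\,\frac{\Psi_{r-2}(|\mathbf{a}|)}{\Psi_{r-1}(|\mathbf{a}|)}.$$ (b) $$\lim_{n\to\infty}\mathbf{P}\big(\mathbf{X}^{(n)}\in\mathcal{C}_{\mathbf{a}}\big)=\frac{1}{\zeta(r)}\,\frac{\varphi(|\mathbf{a}|)}{\varphi_r(|\mathbf{a}|)}\,|\mathbf{a}|^{r-1}.$$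
   Context: $|\mathbf{a}|=a_1a_2\cdots a_r$. For $\mathbf{a}=(a_1,\dots,a_r)$, $\mathcal{PC}_{\mathbf{a}}$ is the set of $r$-tuples $\mathbf{x}=(x_1,\dots,x_r)$ of positive integers such that $\gcd(x_i,x_j)=1$ for all $i\neq j$ (pairwise coprime) and $\gcd(a_i,x_i)=1$ for all $i=1,\dots,r$. $\mathcal{C}_{\mathbf{a}}$ is the set of $r$-tuples $\mathbf{x}$ of positive integers such that $\gcd(x_1,\dots,x_r)=1$ (mutually coprime) and $\gcd(a_i,x_i)=1$ for all $i=1,\dots,r$. $T_r=\prod_p\big((1-\frac1p)^r+\frac rp(1-\frac1p)^{r-1}\big)$, the product being over all primes $p$. $\zeta$ is the Riemann zeta function. For each integer $s$, $\Psi_s(1)=1$ and $\Psi_s(a)=a\prod_{p\mid a}(1+\frac sp)$ for integers $a>1$ (product over primes $p$ dividing $a$). The Jordan totient function is $\varphi_r(1)=1$, $\varphi_r(a)=a^r\prod_{p\mid a}(1-\frac1{p^r})$ for $a>1$; $\varphi=\varphi_1$ is Euler's function. -}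

module Defs where

import Algebra.Definitions.RawSemiring
open import Data.Empty using (⊥-elim)
open import Data.Fin.Base using (Fin; zero; suc; toℕ)
import Data.Fin.Properties as Fin
open import Data.Integer.Base as ℤ using (ℤ; +_; -[1+_])
import Data.Integer.Properties as ℤ
open import Data.List.Base as List using (List; []; _∷_; _∷ʳ_; upTo; filter; foldr)
import Data.List.Properties as List
open import Data.Nat.Base as ℕ using (ℕ; zero; suc; _≤_; _<_; z≤n; s≤s)
open import Data.Nat.Coprimality using (1-coprimeTo) renaming (sym to coprime-sym)
open import Data.Nat.Divisibility using (_∣?_)
open import Data.Nat.GCD using (gcd)
open import Data.Nat.Primality using (prime?)
import Data.Nat.Properties as ℕ
open import Data.Product.Base using (∃-syntax; _×_; _,_; proj₁; proj₂)
open import Data.Rational.Base as ℚ using (ℚ; 0ℚ; 1ℚ; ½; _+_; _*_; _-_; -_; ∣_∣; mkℚ; *≤*)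
import Data.Rational.Properties as ℚ
open import Data.Rational.Solver using (module +-*-Solver)
open import Data.Sum.Base using (_⊎_; inj₁; inj₂)
open import Data.Unit.Base using (tt)
open import Data.Vec.Base as Vec using (Vec; lookup; tabulate)
import Data.Vec.Functional as VecF
import Data.Vec.Properties as Vec
open import Function.Base using (_∘_)
open import Level using (0ℓ)
open import Relation.Binary.PropositionalEquality
  using (_≡_; _≢_; refl; sym; trans; cong; cong₂; subst; subst₂)
open import Relation.Nullary using (Dec; yes; no)
open import Relation.Nullary.Decidable using (_×-dec_; _→-dec_; ¬?)
open import Relation.Unary using (Pred; Decidable; _⊆_; _≐_; _∪_; _∩_; ∁; U; ∅)

open Algebra.Definitions.RawSemiring ℚ.+-*-rawSemiring public using (_^_)

open +-*-Solver using (solve; _:=_; _:+_; _:*_; :-_; _:-_; con)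

fromℕ : ℕ → ℚ
fromℕ n = + n ℚ./ 1

-- Total inverse, with 0 ⁻¹ = 0 by convention.  The convention is harmless:
-- the only numbers inverted below are positive integers, terms of a sequence
-- that is eventually bounded away from 0, and values at a ≥ 1 of Ψ_{r-1} and
-- φ_r (r ≥ 2), which are positive.
infix 8 _⁻¹
_⁻¹ : ℚ → ℚ
x ⁻¹ with x ℚ.≟ 0ℚ
... | yes _   = 0ℚ
... | no  x≢0 = ℚ.1/_ x {{ℚ.≢-nonZero x≢0}}

infixl 7 _÷₀_
_÷₀_ : ℚ → ℚ → ℚ
x ÷₀ y = x * y ⁻¹

sumOver prodOver : List ℕ → (ℕ → ℚ) → ℚ
sumOver  ks f = foldr _+_ 0ℚ (List.map f ks)
prodOver ks f = foldr _*_ 1ℚ (List.map f ks)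

infix 8 sumOver prodOver
syntax sumOver  ks (λ k → e) = ∑[ k ← ks ] e
syntax prodOver ks (λ k → e) = ∏[ k ← ks ] e

module ℚ-Lemmas where
  half : ℚ → ℚ
  half ε = ½ * ε

  w : ℕ → ℚ
  w n = fromℕ (suc n) ⁻¹

  abstract
    *-mono : ∀ {a b c d} → 0ℚ ℚ.≤ a → a ℚ.≤ b → 0ℚ ℚ.≤ c → c ℚ.≤ d → a * c ℚ.≤ b * d
    *-mono {a} {b} {c} {d} 0≤a a≤b 0≤c c≤d = ℚ.≤-trans
      (ℚ.*-monoˡ-≤-nonNeg a {{ℚ.nonNegative 0≤a}} c≤d)
      (ℚ.*-monoʳ-≤-nonNeg d {{ℚ.nonNegative (ℚ.≤-trans 0≤c c≤d)}} a≤b)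

    0≤* : ∀ {a b} → 0ℚ ℚ.≤ a → 0ℚ ℚ.≤ b → 0ℚ ℚ.≤ a * b
    0≤* {a} {b} 0≤a 0≤b = subst (ℚ._≤ a * b) (ℚ.*-zeroʳ a)
      (ℚ.*-monoˡ-≤-nonNeg a {{ℚ.nonNegative 0≤a}} 0≤b)

    0<* : ∀ {a b} → 0ℚ ℚ.< a → 0ℚ ℚ.< b → 0ℚ ℚ.< a * b
    0<* {a} {b} 0<a 0<b = subst (ℚ._< a * b) (ℚ.*-zeroʳ a)
      (ℚ.*-monoʳ-<-pos a {{ℚ.positive 0<a}} 0<b)

    0≤+ : ∀ {a b} → 0ℚ ℚ.≤ a → 0ℚ ℚ.≤ b → 0ℚ ℚ.≤ a + b
    0≤+ = ℚ.+-mono-≤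

    0≤1 : 0ℚ ℚ.≤ 1ℚ
    0≤1 = ℚ.nonNegative⁻¹ 1ℚ

    0<1 : 0ℚ ℚ.< 1ℚ
    0<1 = ℚ.positive⁻¹ 1ℚ

    x-y≥0 : ∀ {x y} → y ℚ.≤ x → 0ℚ ℚ.≤ x - y
    x-y≥0 {x} {y} y≤x = subst (ℚ._≤ x - y) (ℚ.+-inverseʳ y) (ℚ.+-monoˡ-≤ (- y) y≤x)

    x≤x+y : ∀ x {y} → 0ℚ ℚ.≤ y → x ℚ.≤ x + y
    x≤x+y x {y} 0≤y = subst (ℚ._≤ x + y) (ℚ.+-identityʳ x) (ℚ.+-monoʳ-≤ x 0≤y)

    x≤y+z⇒x-y≤z : ∀ {x y z} → x ℚ.≤ y + z → x - y ℚ.≤ z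
    x≤y+z⇒x-y≤z {x} {y} {z} p = subst (x - y ℚ.≤_)
      (solve 2 (λ y z → (y :+ z) :- y := z) refl y z) (ℚ.+-monoˡ-≤ (- y) p)

    x-y≤z⇒x≤y+z : ∀ {x y z} → x - y ℚ.≤ z → x ℚ.≤ y + z
    x-y≤z⇒x≤y+z {x} {y} {z} p = subst (ℚ._≤ y + z)
      (solve 2 (λ x y → y :+ (x :- y) := x) refl x y) (ℚ.+-monoʳ-≤ y p)

    ∣x-y∣-sym : ∀ x y → ∣ x - y ∣ ≡ ∣ y - x ∣
    ∣x-y∣-sym x y = trans (sym (ℚ.∣-p∣≡∣p∣ (x - y)))
      (cong ∣_∣ (solve 2 (λ x y → :- (x :- y) := y :- x) refl x y))

    triangle : ∀ x y z → ∣ x - z ∣ ℚ.≤ ∣ x - y ∣ + ∣ y - z ∣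
    triangle x y z = subst (λ t → ∣ t ∣ ℚ.≤ ∣ x - y ∣ + ∣ y - z ∣)
      (solve 3 (λ x y z → (x :- y) :+ (y :- z) := x :- z) refl x y z)
      (ℚ.∣p+q∣≤∣p∣+∣q∣ (x - y) (y - z))

    ∣x∣≤ : ∀ {x c} → x ℚ.≤ c → - x ℚ.≤ c → ∣ x ∣ ℚ.≤ c
    ∣x∣≤ {x} {c} p q with ℚ.∣p∣≡p∨∣p∣≡-p x
    ... | inj₁ e = subst (ℚ._≤ c) (sym e) p
    ... | inj₂ e = subst (ℚ._≤ c) (sym e) q

    ∣x∣≤∣y∣+∣x-y∣ : ∀ x y → ∣ x ∣ ℚ.≤ ∣ y ∣ + ∣ x - y ∣
    ∣x∣≤∣y∣+∣x-y∣ x y = subst (λ t → ∣ t ∣ ℚ.≤ ∣ y ∣ + ∣ x - y ∣)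
      (solve 2 (λ x y → y :+ (x :- y) := x) refl x y)
      (ℚ.∣p+q∣≤∣p∣+∣q∣ y (x - y))

    ∣∣x∣-∣y∣∣≤∣x-y∣ : ∀ x y → ∣ ∣ x ∣ - ∣ y ∣ ∣ ℚ.≤ ∣ x - y ∣
    ∣∣x∣-∣y∣∣≤∣x-y∣ x y = ∣x∣≤
      (x≤y+z⇒x-y≤z (∣x∣≤∣y∣+∣x-y∣ x y))
      (subst₂ ℚ._≤_ (solve 2 (λ u v → v :- u := :- (u :- v)) refl ∣ x ∣ ∣ y ∣)
        (∣x-y∣-sym y x) (x≤y+z⇒x-y≤z (∣x∣≤∣y∣+∣x-y∣ y x)))

    half-pos : ∀ {ε} → 0ℚ ℚ.< ε → 0ℚ ℚ.< half ε
    half-pos = 0<* (ℚ.positive⁻¹ ½)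

    half+half : ∀ ε → half ε + half ε ≡ ε
    half+half ε = trans (sym (ℚ.*-distribʳ-+ ε ½ ½)) (ℚ.*-identityˡ ε)

    ⁻¹-inverse : ∀ x → x ≢ 0ℚ → x * x ⁻¹ ≡ 1ℚ
    ⁻¹-inverse x x≢0 with x ℚ.≟ 0ℚ
    ... | yes x≡0 = ⊥-elim (x≢0 x≡0)
    ... | no  x≢0 = ℚ.*-inverseʳ x {{ℚ.≢-nonZero x≢0}}

    pos⇒≢0 : ∀ {x} → 0ℚ ℚ.< x → x ≢ 0ℚ
    pos⇒≢0 0<x x≡0 = ℚ.<⇒≢ 0<x (sym x≡0)

    ⁻¹-pos : ∀ {x} → 0ℚ ℚ.< x → 0ℚ ℚ.< x ⁻¹
    ⁻¹-pos {x} 0<x with x ℚ.≟ 0ℚ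
    ... | yes x≡0 = ⊥-elim (pos⇒≢0 0<x x≡0)
    ... | no  x≢0 = ℚ.positive⁻¹ _ {{ℚ.1/pos⇒pos x {{ℚ.positive 0<x}}}}

    ⁻¹-unique : ∀ x y → x ≢ 0ℚ → x * y ≡ 1ℚ → x ⁻¹ ≡ y
    ⁻¹-unique x y x≢0 xy≡1 =
      trans (sym (ℚ.*-identityʳ (x ⁻¹)))
      (trans (cong (x ⁻¹ *_) (sym xy≡1))
      (trans (solve 3 (λ x y z → z :* (x :* y) := (x :* z) :* y) refl x y (x ⁻¹))
      (trans (cong (_* y) (⁻¹-inverse x x≢0)) (ℚ.*-identityˡ y))))

    ⁻¹-anti : ∀ x y → 0ℚ ℚ.< x → x ℚ.≤ y → y ⁻¹ ℚ.≤ x ⁻¹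
    ⁻¹-anti x y 0<x x≤y = subst₂ ℚ._≤_
      (trans (solve 3 (λ x u v → x :* (u :* v) := (x :* u) :* v) refl x (x ⁻¹) (y ⁻¹))
        (trans (cong (_* y ⁻¹) (⁻¹-inverse x (pos⇒≢0 0<x))) (ℚ.*-identityˡ (y ⁻¹))))
      (trans (solve 3 (λ y u v → y :* (u :* v) := (y :* v) :* u) refl y (x ⁻¹) (y ⁻¹))
        (trans (cong (_* x ⁻¹) (⁻¹-inverse y (pos⇒≢0 0<y))) (ℚ.*-identityˡ (x ⁻¹))))
      (ℚ.*-monoʳ-≤-nonNeg (x ⁻¹ * y ⁻¹)
        {{ℚ.nonNegative (0≤* (ℚ.<⇒≤ (⁻¹-pos 0<x)) (ℚ.<⇒≤ (⁻¹-pos 0<y)))}} x≤y)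
      where
      0<y : 0ℚ ℚ.< y
      0<y = ℚ.<-≤-trans 0<x x≤y

    fromℕ-mkℚ : ∀ n → fromℕ n ≡ mkℚ (+ n) 0 (coprime-sym (1-coprimeTo n))
    fromℕ-mkℚ n = ℚ.normalize-coprime (coprime-sym (1-coprimeTo n))

    fromℕ-suc : ∀ n → fromℕ (suc n) ≡ 1ℚ + fromℕ n
    fromℕ-suc n rewrite fromℕ-mkℚ n =
      cong (ℚ._/ 1) {x = + suc n} (cong (ℤ.suc) (sym (ℤ.*-identityʳ (+ n))))

    fromℕ-nonNeg : ∀ n → 0ℚ ℚ.≤ fromℕ n
    fromℕ-nonNeg n = ℚ.nonNegative⁻¹ _ {{ℚ.normalize-nonNeg n 1}}

    1≤fromℕ-suc : ∀ n → 1ℚ ℚ.≤ fromℕ (suc n)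
    1≤fromℕ-suc n = subst (1ℚ ℚ.≤_) (sym (fromℕ-suc n)) (x≤x+y 1ℚ (fromℕ-nonNeg n))

    0<fromℕ-suc : ∀ n → 0ℚ ℚ.< fromℕ (suc n)
    0<fromℕ-suc n = ℚ.<-≤-trans 0<1 (1≤fromℕ-suc n)

    x≤fromℕ : ∀ x → x ℚ.≤ fromℕ ℤ.∣ ℚ.↥ x ∣
    x≤fromℕ x@(mkℚ n d _) rewrite fromℕ-mkℚ ℤ.∣ n ∣ = *≤* (lem n)
      where
      lem : ∀ n → n ℤ.* + 1 ℤ.≤ + ℤ.∣ n ∣ ℤ.* + suc d
      lem (+ k) = subst₂ ℤ._≤_ (sym (ℤ.*-identityʳ (+ k))) (ℤ.pos-* k (suc d))
        (ℤ.+≤+ (ℕ.m≤m*n k (suc d)))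
      lem -[1+ k ] = ℤ.≤-trans (subst (ℤ._≤ + 0) (sym (ℤ.*-identityʳ -[1+ k ])) ℤ.-≤+)
        (subst (+ 0 ℤ.≤_) (ℤ.pos-* (suc k) (suc d)) (ℤ.+≤+ z≤n))

    0≤w : ∀ n → 0ℚ ℚ.≤ w n
    0≤w n = ℚ.<⇒≤ (⁻¹-pos (0<fromℕ-suc n))

    w≤1 : ∀ n → w n ℚ.≤ 1ℚ
    w≤1 n = ⁻¹-anti 1ℚ (fromℕ (suc n)) 0<1 (1≤fromℕ-suc n)

    fw : ∀ n → fromℕ (suc n) * w n ≡ 1ℚ
    fw n = ⁻¹-inverse (fromℕ (suc n)) (pos⇒≢0 (0<fromℕ-suc n))

    archimedean : ∀ {E ε} → 0ℚ ℚ.≤ E → 0ℚ ℚ.< ε → ∃[ N ] E * w N ℚ.≤ ε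
    archimedean {E} {ε} 0≤E 0<ε = N , subst₂ ℚ._≤_ eq₁ eq₂
        (ℚ.*-monoʳ-≤-nonNeg (ε * w N) {{ℚ.nonNegative (0≤* (ℚ.<⇒≤ 0<ε) (0≤w N))}} q≤)
      where
      q : ℚ
      q = E * ε ⁻¹
      N : ℕ
      N = ℤ.∣ ℚ.↥ q ∣
      q≤ : q ℚ.≤ fromℕ (suc N)
      q≤ = ℚ.≤-trans (x≤fromℕ q) (subst (fromℕ N ℚ.≤_)
        (trans (ℚ.+-comm (fromℕ N) 1ℚ) (sym (fromℕ-suc N))) (x≤x+y (fromℕ N) 0≤1))
      eq₁ : q * (ε * w N) ≡ E * w N
      eq₁ = trans (solve 4 (λ E i e w → (E :* i) :* (e :* w) := (e :* i) :* (E :* w)) refl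
                    E (ε ⁻¹) ε (w N))
        (trans (cong (_* (E * w N)) (⁻¹-inverse ε (pos⇒≢0 0<ε))) (ℚ.*-identityˡ (E * w N)))
      eq₂ : fromℕ (suc N) * (ε * w N) ≡ ε
      eq₂ = trans (solve 3 (λ f e w → f :* (e :* w) := (f :* w) :* e) refl (fromℕ (suc N)) ε (w N))
        (trans (cong (_* ε) (fw N)) (ℚ.*-identityˡ ε))

    w-step : ∀ n → w n - w (suc n) ≡ w n * w (suc n)
    w-step n = trans
      (cong₂ _-_ (trans (sym (ℚ.*-identityˡ (w n))) (cong (_* w n) (sym (fw (suc n)))))
                 (trans (sym (ℚ.*-identityˡ (w (suc n)))) (cong (_* w (suc n)) (sym (fw n)))))
      (trans (cong (λ t → t * w (suc n) * w n - fromℕ (suc n) * w n * w (suc n)) (fromℕ-suc (suc n)))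
      (solve 3 (λ f u v → (con 1ℚ :+ f) :* v :* u :- f :* u :* v := u :* v) refl
        (fromℕ (suc n)) (w n) (w (suc n))))

    w²≤ : ∀ n → w n * w n ℚ.≤ (w n - w (suc n)) + (w n - w (suc n))
    w²≤ n = subst (w n * w n ℚ.≤_)
      (trans (ℚ.*-distribˡ-+ (w n) v v) (cong₂ _+_ (sym (w-step n)) (sym (w-step n))))
      (ℚ.*-monoˡ-≤-nonNeg (w n) {{ℚ.nonNegative (0≤w n)}} w≤2v)
      where
      v : ℚ
      v = w (suc n)
      w≤2v : w n ℚ.≤ v + v
      w≤2v = x-y≤z⇒x≤y+z (subst (ℚ._≤ v) (sym (w-step n))
        (subst (w n * v ℚ.≤_) (ℚ.*-identityˡ v)
          (ℚ.*-monoʳ-≤-nonNeg v {{ℚ.nonNegative (0≤w (suc n))}} (w≤1 n))))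

open ℚ-Lemmas

-- Real numbers are Cauchy sequences of rationals; the equality of reals is
-- _≃_.  The proof of the Cauchy property carries a modulus of convergence.
IsCauchy : (ℕ → ℚ) → Set
IsCauchy s = ∀ ε → 0ℚ ℚ.< ε →
  ∃[ N ] ∀ m n → N ≤ m → N ≤ n → ∣ s m - s n ∣ ℚ.≤ ε

record ℝ : Set where
  constructor mkℝ
  field
    seq    : ℕ → ℚ
    cauchy : IsCauchy seq
open ℝ public

infix 4 _≃_ _≤ᴿ_
_≃_ _≤ᴿ_ : ℝ → ℝ → Set
x ≃ y  = ∀ ε → 0ℚ ℚ.< ε → ∃[ N ] ∀ n → N ≤ n → ∣ seq x n - seq y n ∣ ℚ.≤ ε
x ≤ᴿ y = ∀ ε → 0ℚ ℚ.< ε → ∃[ N ] ∀ n → N ≤ n → seq x n ℚ.≤ seq y n + ε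

Positiveᴿ : ℝ → Set
Positiveᴿ x = ∃[ δ ] 0ℚ ℚ.< δ × ∃[ N ] ∀ n → N ≤ n → δ ℚ.≤ seq x n

module Cauchy-Lemmas where
  abstract
    cauchy-+ : ∀ {s t} → IsCauchy s → IsCauchy t → IsCauchy (λ n → s n + t n)
    cauchy-+ {s} {t} cs ct ε 0<ε with cs (half ε) (half-pos 0<ε) | ct (half ε) (half-pos 0<ε)
    ... | M , hM | N , hN = M ℕ.⊔ N , λ m n p q →
      subst₂ ℚ._≤_
        (cong ∣_∣ (solve 4 (λ a b c d → (a :- b) :+ (c :- d) := (a :+ c) :- (b :+ d)) refl
          (s m) (s n) (t m) (t n)))
        (half+half ε)
        (ℚ.≤-trans (ℚ.∣p+q∣≤∣p∣+∣q∣ (s m - s n) (t m - t n))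
          (ℚ.+-mono-≤ (hM m n (ℕ.m⊔n≤o⇒m≤o M N p) (ℕ.m⊔n≤o⇒m≤o M N q))
                      (hN m n (ℕ.m⊔n≤o⇒n≤o M N p) (ℕ.m⊔n≤o⇒n≤o M N q))))

    cauchy-neg : ∀ {s} → IsCauchy s → IsCauchy (λ n → - s n)
    cauchy-neg {s} cs ε 0<ε with cs ε 0<ε
    ... | N , h = N , λ m n p q → subst (ℚ._≤ ε)
      (trans (∣x-y∣-sym (s m) (s n))
        (cong ∣_∣ (solve 2 (λ a b → b :- a := (:- a) :- (:- b)) refl (s m) (s n))))
      (h m n p q)

    cauchy-abs : ∀ {s} → IsCauchy s → IsCauchy (λ n → ∣ s n ∣)
    cauchy-abs {s} cs ε 0<ε with cs ε 0<ε
    ... | N , h = N , λ m n p q → ℚ.≤-trans (∣∣x∣-∣y∣∣≤∣x-y∣ (s m) (s n)) (h m n p q)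

    bounded : ∀ {s} → IsCauchy s →
      ∃[ B ] 0ℚ ℚ.< B × ∃[ N ] ∀ n → N ≤ n → ∣ s n ∣ ℚ.≤ B
    bounded {s} cs with cs 1ℚ 0<1
    ... | N , h = ∣ s N ∣ + 1ℚ , ℚ.+-mono-≤-< (ℚ.0≤∣p∣ (s N)) 0<1 , N , λ n p →
      ℚ.≤-trans (∣x∣≤∣y∣+∣x-y∣ (s n) (s N)) (ℚ.+-monoʳ-≤ ∣ s N ∣ (h n N p ℕ.≤-refl))

    cancel : ∀ {B} → 0ℚ ℚ.< B → ∀ x → B * (x * B ⁻¹) ≡ x
    cancel {B} 0<B x = trans (solve 3 (λ b x i → b :* (x :* i) := x :* (b :* i)) refl B x (B ⁻¹))
      (trans (cong (x *_) (⁻¹-inverse B (pos⇒≢0 0<B))) (ℚ.*-identityʳ x))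

    ∣ac-bd∣≤ : ∀ a b c d {B C e f} → ∣ a ∣ ℚ.≤ B → ∣ d ∣ ℚ.≤ C → ∣ a - b ∣ ℚ.≤ e → ∣ c - d ∣ ℚ.≤ f →
      ∣ a * c - b * d ∣ ℚ.≤ B * f + C * e
    ∣ac-bd∣≤ a b c d {B} {C} {e} {f} a≤B d≤C ab cd = subst (λ t → ∣ t ∣ ℚ.≤ B * f + C * e)
      (solve 4 (λ a b c d → a :* (c :- d) :+ d :* (a :- b) := a :* c :- b :* d) refl a b c d)
      (ℚ.≤-trans (ℚ.∣p+q∣≤∣p∣+∣q∣ (a * (c - d)) (d * (a - b)))
        (ℚ.+-mono-≤
          (subst (ℚ._≤ B * f) (sym (ℚ.∣p*q∣≡∣p∣*∣q∣ a (c - d))) (*-mono (ℚ.0≤∣p∣ a) a≤B (ℚ.0≤∣p∣ (c - d)) cd))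
          (subst (ℚ._≤ C * e) (sym (ℚ.∣p*q∣≡∣p∣*∣q∣ d (a - b))) (*-mono (ℚ.0≤∣p∣ d) d≤C (ℚ.0≤∣p∣ (a - b)) ab))))

    cauchy-* : ∀ {s t} → IsCauchy s → IsCauchy t → IsCauchy (λ n → s n * t n)
    cauchy-* {s} {t} cs ct ε 0<ε = K , prf
      where
      bs : ∃[ B ] 0ℚ ℚ.< B × ∃[ N ] ∀ n → N ≤ n → ∣ s n ∣ ℚ.≤ B
      bs = bounded {s} cs
      bt : ∃[ B ] 0ℚ ℚ.< B × ∃[ N ] ∀ n → N ≤ n → ∣ t n ∣ ℚ.≤ B
      bt = bounded {t} ct
      B C : ℚ
      B = proj₁ bs
      C = proj₁ bt
      0<B : 0ℚ ℚ.< B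
      0<B = proj₁ (proj₂ bs)
      0<C : 0ℚ ℚ.< C
      0<C = proj₁ (proj₂ bt)
      m₃ : ∃[ N ] ∀ m n → N ≤ m → N ≤ n → ∣ s m - s n ∣ ℚ.≤ half ε * C ⁻¹
      m₃ = cs (half ε * C ⁻¹) (0<* {half ε} {C ⁻¹} (half-pos 0<ε) (⁻¹-pos 0<C))
      m₄ : ∃[ N ] ∀ m n → N ≤ m → N ≤ n → ∣ t m - t n ∣ ℚ.≤ half ε * B ⁻¹
      m₄ = ct (half ε * B ⁻¹) (0<* {half ε} {B ⁻¹} (half-pos 0<ε) (⁻¹-pos 0<B))
      N₁ N₂ N₃ N₄ K : ℕ
      N₁ = proj₁ (proj₂ (proj₂ bs))
      N₂ = proj₁ (proj₂ (proj₂ bt))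
      N₃ = proj₁ m₃
      N₄ = proj₁ m₄
      K = (N₁ ℕ.⊔ N₂) ℕ.⊔ (N₃ ℕ.⊔ N₄)
      prf : ∀ m n → K ≤ m → K ≤ n → ∣ s m * t m - s n * t n ∣ ℚ.≤ ε
      prf m n p q = ℚ.≤-trans
        (∣ac-bd∣≤ (s m) (s n) (t m) (t n)
          (proj₂ (proj₂ (proj₂ bs)) m (ℕ.m⊔n≤o⇒m≤o N₁ N₂ (ℕ.m⊔n≤o⇒m≤o (N₁ ℕ.⊔ N₂) (N₃ ℕ.⊔ N₄) p)))
          (proj₂ (proj₂ (proj₂ bt)) n (ℕ.m⊔n≤o⇒n≤o N₁ N₂ (ℕ.m⊔n≤o⇒m≤o (N₁ ℕ.⊔ N₂) (N₃ ℕ.⊔ N₄) q)))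
          (proj₂ m₃ m n (ℕ.m⊔n≤o⇒m≤o N₃ N₄ (ℕ.m⊔n≤o⇒n≤o (N₁ ℕ.⊔ N₂) (N₃ ℕ.⊔ N₄) p))
                        (ℕ.m⊔n≤o⇒m≤o N₃ N₄ (ℕ.m⊔n≤o⇒n≤o (N₁ ℕ.⊔ N₂) (N₃ ℕ.⊔ N₄) q)))
          (proj₂ m₄ m n (ℕ.m⊔n≤o⇒n≤o N₃ N₄ (ℕ.m⊔n≤o⇒n≤o (N₁ ℕ.⊔ N₂) (N₃ ℕ.⊔ N₄) p))
                        (ℕ.m⊔n≤o⇒n≤o N₃ N₄ (ℕ.m⊔n≤o⇒n≤o (N₁ ℕ.⊔ N₂) (N₃ ℕ.⊔ N₄) q))))
        (subst (B * (half ε * B ⁻¹) + C * (half ε * C ⁻¹) ℚ.≤_) (half+half ε)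
          (ℚ.≤-reflexive (cong₂ _+_ (cancel 0<B (half ε)) (cancel 0<C (half ε)))))

    ∣a⁻¹-b⁻¹∣≤ : ∀ {δ} a b {e} → 0ℚ ℚ.< δ → δ ℚ.≤ a → δ ℚ.≤ b → ∣ a - b ∣ ℚ.≤ e →
      ∣ a ⁻¹ - b ⁻¹ ∣ ℚ.≤ e * (δ ⁻¹ * δ ⁻¹)
    ∣a⁻¹-b⁻¹∣≤ {δ} a b {e} 0<δ δ≤a δ≤b ab = subst (ℚ._≤ e * (δ ⁻¹ * δ ⁻¹)) eq
        (*-mono {∣ b - a ∣} {e} {a ⁻¹ * b ⁻¹} {δ ⁻¹ * δ ⁻¹}
                (ℚ.0≤∣p∣ (b - a)) (subst (ℚ._≤ e) (∣x-y∣-sym a b) ab)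
                (0≤* {a ⁻¹} {b ⁻¹} 0≤a⁻¹ 0≤b⁻¹)
                (*-mono {a ⁻¹} {δ ⁻¹} {b ⁻¹} {δ ⁻¹} 0≤a⁻¹ (⁻¹-anti δ a 0<δ δ≤a) 0≤b⁻¹ (⁻¹-anti δ b 0<δ δ≤b)))
      where
      0<a : 0ℚ ℚ.< a
      0<a = ℚ.<-≤-trans 0<δ δ≤a
      0<b : 0ℚ ℚ.< b
      0<b = ℚ.<-≤-trans 0<δ δ≤b
      0≤a⁻¹ : 0ℚ ℚ.≤ a ⁻¹
      0≤a⁻¹ = ℚ.<⇒≤ (⁻¹-pos 0<a)
      0≤b⁻¹ : 0ℚ ℚ.≤ b ⁻¹
      0≤b⁻¹ = ℚ.<⇒≤ (⁻¹-pos 0<b)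
      difference : ∀ i j → a * i ≡ 1ℚ → b * j ≡ 1ℚ → (b - a) * (i * j) ≡ i - j
      difference i j ai bj = trans
        (solve 4 (λ a b i j → (b :- a) :* (i :* j) := (b :* j) :* i :- (a :* i) :* j) refl a b i j)
        (trans (cong₂ (λ u v → u * i - v * j) bj ai)
          (solve 2 (λ i j → con 1ℚ :* i :- con 1ℚ :* j := i :- j) refl i j))
      absorb : ∀ d i j → 0ℚ ℚ.≤ i → 0ℚ ℚ.≤ j → ∣ d ∣ * (i * j) ≡ ∣ d * (i * j) ∣
      absorb d i j 0≤i 0≤j = trans
        (cong (∣ d ∣ *_) (sym (ℚ.0≤p⇒∣p∣≡p {i * j} (0≤* {i} {j} 0≤i 0≤j))))
        (sym (ℚ.∣p*q∣≡∣p∣*∣q∣ d (i * j)))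
      eq : ∣ b - a ∣ * (a ⁻¹ * b ⁻¹) ≡ ∣ a ⁻¹ - b ⁻¹ ∣
      eq = trans (absorb (b - a) (a ⁻¹) (b ⁻¹) 0≤a⁻¹ 0≤b⁻¹)
        (cong ∣_∣ (difference (a ⁻¹) (b ⁻¹) (⁻¹-inverse a (pos⇒≢0 0<a)) (⁻¹-inverse b (pos⇒≢0 0<b))))

    cancel² : ∀ {δ} → 0ℚ ℚ.< δ → ∀ x → δ * (δ * x) * (δ ⁻¹ * δ ⁻¹) ≡ x
    cancel² {δ} 0<δ x = trans
      (solve 3 (λ d x i → d :* (d :* x) :* (i :* i) := (d :* i) :* ((d :* i) :* x)) refl δ x (δ ⁻¹))
      (lem (δ * δ ⁻¹) (⁻¹-inverse δ (pos⇒≢0 0<δ)))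
      where
      lem : ∀ t → t ≡ 1ℚ → t * (t * x) ≡ x
      lem t refl = trans (ℚ.*-identityˡ (1ℚ * x)) (ℚ.*-identityˡ x)

    cauchy-⁻¹ : ∀ {s} → IsCauchy s → ∀ {δ} → 0ℚ ℚ.< δ → ∀ {M} → (∀ n → M ≤ n → δ ℚ.≤ s n) →
      IsCauchy (λ n → s n ⁻¹)
    cauchy-⁻¹ {s} cs {δ} 0<δ {M} hM ε 0<ε = M ℕ.⊔ proj₁ c , λ m n p q →
        subst (∣ s m ⁻¹ - s n ⁻¹ ∣ ℚ.≤_) (cancel² 0<δ ε)
          (∣a⁻¹-b⁻¹∣≤ (s m) (s n) 0<δ
            (hM m (ℕ.m⊔n≤o⇒m≤o M (proj₁ c) p)) (hM n (ℕ.m⊔n≤o⇒m≤o M (proj₁ c) q))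
            (proj₂ c m n (ℕ.m⊔n≤o⇒n≤o M (proj₁ c) p) (ℕ.m⊔n≤o⇒n≤o M (proj₁ c) q)))
      where
      c : ∃[ N ] ∀ m n → N ≤ m → N ≤ n → ∣ s m - s n ∣ ℚ.≤ δ * (δ * ε)
      c = cs (δ * (δ * ε)) (0<* 0<δ (0<* 0<δ 0<ε))

open Cauchy-Lemmas

ι : ℚ → ℝ
ι q = mkℝ (λ _ → q) (λ ε 0<ε → 0 , λ m n _ _ →
  subst (ℚ._≤ ε) (sym (cong ∣_∣ (ℚ.+-inverseʳ q))) (ℚ.<⇒≤ 0<ε))

infixl 6 _+ᴿ_ _-ᴿ_
infixl 7 _*ᴿ_
_+ᴿ_ _*ᴿ_ _-ᴿ_ : ℝ → ℝ → ℝ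
x +ᴿ y = mkℝ (λ n → seq x n + seq y n) (cauchy-+ {seq x} {seq y} (cauchy x) (cauchy y))
x *ᴿ y = mkℝ (λ n → seq x n * seq y n) (cauchy-* {seq x} {seq y} (cauchy x) (cauchy y))
x -ᴿ y = mkℝ (λ n → seq x n - seq y n)
  (cauchy-+ {seq x} {λ n → - seq y n} (cauchy x) (cauchy-neg {seq y} (cauchy y)))

∣_∣ᴿ : ℝ → ℝ
∣ x ∣ᴿ = mkℝ (λ n → ∣ seq x n ∣) (cauchy-abs {seq x} (cauchy x))

recip : (x : ℝ) → Positiveᴿ x → ℝ
recip x (δ , 0<δ , N , h) = mkℝ (λ n → seq x n ⁻¹) (cauchy-⁻¹ {seq x} (cauchy x) 0<δ h)

sumᴿ prodᴿ : ∀ {n} → (Fin n → ℝ) → ℝ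
sumᴿ  = VecF.foldr _+ᴿ_ (ι 0ℚ)
prodᴿ = VecF.foldr _*ᴿ_ (ι 1ℚ)

Tendsto : (ℕ → ℝ) → ℝ → Set
Tendsto s L = ∀ ε → 0ℚ ℚ.< ε → ∃[ N ] ∀ n → N ≤ n → ∣ s n -ᴿ L ∣ᴿ ≤ᴿ ι ε

primesUpTo : ℕ → List ℕ
primesUpTo n = filter prime? (upTo (suc n))

eulerFactor : ℕ → ℕ → ℚ
eulerFactor r p =
  (1ℚ - fromℕ p ⁻¹) ^ r + fromℕ r * fromℕ p ⁻¹ * (1ℚ - fromℕ p ⁻¹) ^ (r ℕ.∸ 1)

module Series-Lemmas where
  ζ-seq : ℕ → ℕ → ℚ
  ζ-seq r n = ∑[ k ← upTo n ] ((fromℕ (suc k) ^ r) ⁻¹)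

  T-seq : ℕ → ℕ → ℚ
  T-seq r n = ∏[ p ← primesUpTo n ] eulerFactor r p

  abstract
    -- A sequence whose n-th increment is O(1/(n+1)²) is Cauchy.
    cauchy-steps : ∀ {s C} → 0ℚ ℚ.≤ C → (∀ n → ∣ s (suc n) - s n ∣ ℚ.≤ C * (w n * w n)) → IsCauchy s
    cauchy-steps {s} {C} 0≤C h ε 0<ε = N , λ m n p q →
        ℚ.≤-trans (triangle (s m) (s N) (s n))
          (subst (∣ s m - s N ∣ + ∣ s N - s n ∣ ℚ.≤_) (half+half ε)
            (ℚ.+-mono-≤ (near m p) (subst (ℚ._≤ half ε) (∣x-y∣-sym (s n) (s N)) (near n q))))
      where
      D : ℚ
      D = C + C
      0≤D : 0ℚ ℚ.≤ D
      0≤D = 0≤+ {C} {C} 0≤C 0≤C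
      step : ∀ n → ∣ s (suc n) - s n ∣ ℚ.≤ D * (w n - w (suc n))
      step n = ℚ.≤-trans (h n) (subst (C * (w n * w n) ℚ.≤_)
        (solve 2 (λ c x → c :* (x :+ x) := (c :+ c) :* x) refl C (w n - w (suc n)))
        (ℚ.*-monoˡ-≤-nonNeg C {{ℚ.nonNegative 0≤C}} (w²≤ n)))
      far : ∀ k n → ∣ s (k ℕ.+ n) - s n ∣ ℚ.≤ D * (w n - w (k ℕ.+ n))
      far zero n = ℚ.≤-reflexive (trans (cong ∣_∣ (ℚ.+-inverseʳ (s n)))
        (sym (trans (cong (D *_) (ℚ.+-inverseʳ (w n))) (ℚ.*-zeroʳ D))))
      far (suc k) n = ℚ.≤-trans (triangle (s (suc k ℕ.+ n)) (s (k ℕ.+ n)) (s n))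
        (subst (∣ s (suc k ℕ.+ n) - s (k ℕ.+ n) ∣ + ∣ s (k ℕ.+ n) - s n ∣ ℚ.≤_)
          (solve 4 (λ d a b c → d :* (b :- c) :+ d :* (a :- b) := d :* (a :- c)) refl
            D (w n) (w (k ℕ.+ n)) (w (suc k ℕ.+ n)))
          (ℚ.+-mono-≤ (step (k ℕ.+ n)) (far k n)))
      arch : ∃[ N ] D * w N ℚ.≤ half ε
      arch = archimedean {D} {half ε} 0≤D (half-pos 0<ε)
      N : ℕ
      N = proj₁ arch
      near : ∀ m → N ≤ m → ∣ s m - s N ∣ ℚ.≤ half ε
      near m N≤m = ℚ.≤-trans
        (subst (λ t → ∣ s t - s N ∣ ℚ.≤ D * (w N - w t)) (ℕ.m∸n+n≡m N≤m) (far (m ℕ.∸ N) N))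
        (ℚ.≤-trans (ℚ.*-monoˡ-≤-nonNeg D {{ℚ.nonNegative 0≤D}}
                     (x≤y+z⇒x-y≤z (subst (w N ℚ.≤_) (ℚ.+-comm (w N) (w m)) (x≤x+y (w N) (0≤w m)))))
                   (proj₂ arch))

    prodOver-∷ʳ : ∀ ks k f → prodOver (ks ∷ʳ k) f ≡ prodOver ks f * f k
    prodOver-∷ʳ []       k f = trans (ℚ.*-identityʳ (f k)) (sym (ℚ.*-identityˡ (f k)))
    prodOver-∷ʳ (j ∷ ks) k f =
      trans (cong (f j *_) (prodOver-∷ʳ ks k f)) (sym (ℚ.*-assoc (f j) _ (f k)))

    sumOver-∷ʳ : ∀ ks k f → sumOver (ks ∷ʳ k) f ≡ sumOver ks f + f k
    sumOver-∷ʳ []       k f = trans (ℚ.+-identityʳ (f k)) (sym (ℚ.+-identityˡ (f k)))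
    sumOver-∷ʳ (j ∷ ks) k f =
      trans (cong (λ t → f j + t) (sumOver-∷ʳ ks k f)) (sym (ℚ.+-assoc (f j) _ (f k)))

    sumOver-nonNeg : ∀ ks {f} → (∀ k → 0ℚ ℚ.≤ f k) → 0ℚ ℚ.≤ sumOver ks f
    sumOver-nonNeg []       h = ℚ.≤-refl
    sumOver-nonNeg (k ∷ ks) h = 0≤+ (h k) (sumOver-nonNeg ks h)

    primesUpTo-suc : ∀ n → primesUpTo (suc n) ≡ primesUpTo n List.++ filter prime? (suc n ∷ [])
    primesUpTo-suc n = trans (cong (filter prime?) (sym (List.upTo-∷ʳ (suc n))))
      (List.filter-++ prime? (upTo (suc n)) (suc n ∷ []))

    prodOver-filter : ∀ ks k f → let ks′ = ks List.++ filter prime? (k ∷ []) in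
      prodOver ks′ f ≡ prodOver ks f ⊎ prodOver ks′ f ≡ prodOver ks f * f k
    prodOver-filter ks k f with prime? k
    ... | yes _ = inj₂ (prodOver-∷ʳ ks k f)
    ... | no  _ = inj₁ (cong (λ ks → prodOver ks f) (List.++-identityʳ ks))

    ^-nonNeg : ∀ {y} → 0ℚ ℚ.≤ y → ∀ s → 0ℚ ℚ.≤ y ^ s
    ^-nonNeg 0≤y zero    = 0≤1
    ^-nonNeg 0≤y (suc s) = 0≤* 0≤y (^-nonNeg 0≤y s)

  module _ {x : ℚ} (0≤x : 0ℚ ℚ.≤ x) (x≤1 : x ℚ.≤ 1ℚ) where
    y = 1ℚ - x

    abstract
      0≤y : 0ℚ ℚ.≤ y
      0≤y = x-y≥0 x≤1

      bernoulli : ∀ s → 1ℚ ℚ.≤ y ^ s + fromℕ s * x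
      bernoulli zero = x≤x+y 1ℚ (0≤* (fromℕ-nonNeg 0) 0≤x)
      bernoulli (suc s) = ℚ.≤-trans
        (x≤x+y 1ℚ (0≤* (fromℕ-nonNeg s) (0≤* 0≤x 0≤x)))
        (subst₂ ℚ._≤_
          (solve 2 (λ x f → (con 1ℚ :- x) :* con 1ℚ :+ (x :+ f :* (x :* x)) :=
                            con 1ℚ :+ f :* (x :* x)) refl x (fromℕ s))
          (trans (solve 3 (λ x f t → (con 1ℚ :- x) :* (t :+ f :* x) :+ (x :+ f :* (x :* x)) :=
                            (con 1ℚ :- x) :* t :+ (con 1ℚ :+ f) :* x) refl x (fromℕ s) (y ^ s))
                 (cong (λ t → y * y ^ s + t * x) (sym (fromℕ-suc s))))
          (ℚ.+-monoˡ-≤ (x + fromℕ s * (x * x))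
            (ℚ.*-monoˡ-≤-nonNeg y {{ℚ.nonNegative 0≤y}} (bernoulli s))))

      upper : ∀ s → y ^ s * (1ℚ + fromℕ s * x) ℚ.≤ 1ℚ
      upper zero = ℚ.≤-reflexive (trans (ℚ.*-identityˡ _)
        (trans (cong (λ t → 1ℚ + t) (ℚ.*-zeroˡ x)) (ℚ.+-identityʳ 1ℚ)))
      upper (suc s) = ℚ.≤-trans
        (subst (ℚ._≤ y ^ s * (1ℚ + fromℕ s * x))
          (trans (solve 3 (λ x f t → t :* (con 1ℚ :+ f :* x) :- t :* ((con 1ℚ :+ f) :* (x :* x)) :=
                     (con 1ℚ :- x) :* t :* (con 1ℚ :+ (con 1ℚ :+ f) :* x)) refl x (fromℕ s) (y ^ s))
            (cong (λ t → y * y ^ s * (1ℚ + t * x)) (sym (fromℕ-suc s))))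
          (x≤y+z⇒x-y≤z {A} {B} {A} (subst (A ℚ.≤_) (ℚ.+-comm A B)
            (x≤x+y A (0≤* (^-nonNeg 0≤y s)
              (0≤* (0≤+ 0≤1 (fromℕ-nonNeg s)) (0≤* 0≤x 0≤x)))))))
        (upper s)
        where
        A B : ℚ
        A = y ^ s * (1ℚ + fromℕ s * x)
        B = y ^ s * ((1ℚ + fromℕ s) * (x * x))

      lower : ∀ s → 1ℚ - y ^ s * (1ℚ + fromℕ s * x) ℚ.≤ fromℕ s * fromℕ s * (x * x)
      lower s = x≤y+z⇒x-y≤z {1ℚ} {y ^ s * (1ℚ + a)} {fromℕ s * fromℕ s * (x * x)} (subst₂ ℚ._≤_
        (solve 1 (λ a → con 1ℚ :* (con 1ℚ :+ a) :+ (a :* a :- (con 1ℚ :+ a) :* a) := con 1ℚ) refl a)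
        (solve 3 (λ t f x → (t :+ f :* x) :* (con 1ℚ :+ f :* x)
                              :+ ((f :* x) :* (f :* x) :- (con 1ℚ :+ f :* x) :* (f :* x)) :=
                            t :* (con 1ℚ :+ f :* x) :+ f :* f :* (x :* x)) refl
          (y ^ s) (fromℕ s) x)
        (ℚ.+-monoˡ-≤ (a * a - (1ℚ + a) * a)
          (ℚ.*-monoʳ-≤-nonNeg (1ℚ + a)
            {{ℚ.nonNegative (0≤+ 0≤1 (0≤* (fromℕ-nonNeg s) 0≤x))}} (bernoulli s))))
        where
        a : ℚ
        a = fromℕ s * x

      factor-eq : ∀ s → y ^ suc s + fromℕ (suc s) * x * y ^ s ≡ y ^ s * (1ℚ + fromℕ s * x)
      factor-eq s = trans (cong (λ t → y ^ suc s + t * x * y ^ s) (fromℕ-suc s))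
        (solve 3 (λ x f t → (con 1ℚ :- x) :* t :+ (con 1ℚ :+ f) :* x :* t :=
                            t :* (con 1ℚ :+ f :* x)) refl x (fromℕ s) (y ^ s))

      factor-bounds : ∀ r → let f = y ^ r + fromℕ r * x * y ^ (r ℕ.∸ 1) in
        0ℚ ℚ.≤ f × f ℚ.≤ 1ℚ × 1ℚ - f ℚ.≤ fromℕ (r ℕ.∸ 1) * fromℕ (r ℕ.∸ 1) * (x * x)
      factor-bounds zero = subst (λ f → 0ℚ ℚ.≤ f × f ℚ.≤ 1ℚ × 1ℚ - f ℚ.≤ 0ℚ * 0ℚ * (x * x))
        (sym (trans (cong (λ t → 1ℚ + t) (trans (cong (_* 1ℚ) (ℚ.*-zeroˡ x)) (ℚ.*-zeroˡ 1ℚ)))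
                    (ℚ.+-identityʳ 1ℚ)))
        (0≤1 , ℚ.≤-refl , ℚ.≤-reflexive (sym (ℚ.*-zeroˡ (x * x))))
      factor-bounds (suc s) = subst
        (λ f → 0ℚ ℚ.≤ f × f ℚ.≤ 1ℚ × 1ℚ - f ℚ.≤ fromℕ s * fromℕ s * (x * x))
        (sym (factor-eq s))
        ( 0≤* (^-nonNeg 0≤y s) (0≤+ 0≤1 (0≤* (fromℕ-nonNeg s) 0≤x))
        , upper s , lower s)

  abstract
    unit-step : ∀ {t t′ f c} → 0ℚ ℚ.≤ t × t ℚ.≤ 1ℚ → 0ℚ ℚ.≤ f × f ℚ.≤ 1ℚ × 1ℚ - f ℚ.≤ c →
      t′ ≡ t ⊎ t′ ≡ t * f → 0ℚ ℚ.≤ t′ × t′ ℚ.≤ 1ℚ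
    unit-step u _ (inj₁ refl) = u
    unit-step (0≤t , t≤1) (0≤f , f≤1 , _) (inj₂ refl) = 0≤* 0≤t 0≤f , *-mono 0≤t t≤1 0≤f f≤1

    close-step : ∀ {t t′ f c} → 0ℚ ℚ.≤ c → 0ℚ ℚ.≤ t × t ℚ.≤ 1ℚ →
      0ℚ ℚ.≤ f × f ℚ.≤ 1ℚ × 1ℚ - f ℚ.≤ c → t′ ≡ t ⊎ t′ ≡ t * f → ∣ t′ - t ∣ ℚ.≤ c
    close-step {t} {c = c} 0≤c _ _ (inj₁ refl) =
      subst (ℚ._≤ c) (sym (cong ∣_∣ (ℚ.+-inverseʳ t))) 0≤c
    close-step {t} {f = f} {c} 0≤c (0≤t , t≤1) (0≤f , f≤1 , 1-f≤) (inj₂ refl) = subst₂ ℚ._≤_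
      (trans (sym (ℚ.0≤p⇒∣p∣≡p (0≤* 0≤t (x-y≥0 f≤1))))
        (trans (cong ∣_∣ (solve 2 (λ t f → t :* (con 1ℚ :- f) := t :- t :* f) refl t f))
               (∣x-y∣-sym t (t * f))))
      (ℚ.*-identityˡ c)
      (*-mono 0≤t t≤1 (x-y≥0 f≤1) 1-f≤)

    T-cauchy : ∀ r → IsCauchy (T-seq r)
    T-cauchy r = cauchy-steps {T-seq r} 0≤C step
      where
      C : ℚ
      C = fromℕ (r ℕ.∸ 1) * fromℕ (r ℕ.∸ 1)
      0≤C : 0ℚ ℚ.≤ C
      0≤C = 0≤* (fromℕ-nonNeg (r ℕ.∸ 1)) (fromℕ-nonNeg (r ℕ.∸ 1))
      bounds : ∀ n → let f = eulerFactor r (suc n) in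
        0ℚ ℚ.≤ f × f ℚ.≤ 1ℚ × 1ℚ - f ℚ.≤ C * (w n * w n)
      bounds n = factor-bounds (0≤w n) (w≤1 n) r
      next : ∀ n → T-seq r (suc n) ≡ T-seq r n ⊎ T-seq r (suc n) ≡ T-seq r n * eulerFactor r (suc n)
      next n = subst
        (λ ks → prodOver ks (eulerFactor r) ≡ T-seq r n ⊎
                prodOver ks (eulerFactor r) ≡ T-seq r n * eulerFactor r (suc n))
        (sym (primesUpTo-suc n)) (prodOver-filter (primesUpTo n) (suc n) (eulerFactor r))
      unit : ∀ n → 0ℚ ℚ.≤ T-seq r n × T-seq r n ℚ.≤ 1ℚ
      unit zero    = 0≤1 , ℚ.≤-refl
      unit (suc n) = unit-step (unit n) (bounds n) (next n)
      step : ∀ n → ∣ T-seq r (suc n) - T-seq r n ∣ ℚ.≤ C * (w n * w n)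
      step n = close-step (0≤* 0≤C (0≤* (0≤w n) (0≤w n))) (unit n) (bounds n) (next n)

    ^-pos : ∀ {y} → 0ℚ ℚ.< y → ∀ s → 0ℚ ℚ.< y ^ s
    ^-pos 0<y zero    = 0<1
    ^-pos 0<y (suc s) = 0<* 0<y (^-pos 0<y s)

    ^-⁻¹ : ∀ n r → (fromℕ (suc n) ^ r) ⁻¹ ≡ w n ^ r
    ^-⁻¹ n r = ⁻¹-unique (fromℕ (suc n) ^ r) (w n ^ r) (pos⇒≢0 (^-pos (0<fromℕ-suc n) r)) (lem r)
      where
      lem : ∀ r → fromℕ (suc n) ^ r * w n ^ r ≡ 1ℚ
      lem zero    = refl
      lem (suc r) = trans
        (solve 4 (λ a b c d → (a :* b) :* (c :* d) := (a :* c) :* (b :* d)) refl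
          (fromℕ (suc n)) (fromℕ (suc n) ^ r) (w n) (w n ^ r))
        (cong₂ _*_ (fw n) (lem r))

    w^≤1 : ∀ n r → w n ^ r ℚ.≤ 1ℚ
    w^≤1 n zero    = ℚ.≤-refl
    w^≤1 n (suc r) = *-mono (0≤w n) (w≤1 n) (^-nonNeg (0≤w n) r) (w^≤1 n r)

    term-nonNeg : ∀ r k → 0ℚ ℚ.≤ (fromℕ (suc k) ^ r) ⁻¹
    term-nonNeg r k = ℚ.<⇒≤ (⁻¹-pos (^-pos (0<fromℕ-suc k) r))

    ζ-cauchy : ∀ r → 2 ≤ r → IsCauchy (ζ-seq r)
    ζ-cauchy r 2≤r = cauchy-steps {ζ-seq r} 0≤1 step
      where
      term≤ : ∀ n r → 2 ≤ r → (fromℕ (suc n) ^ r) ⁻¹ ℚ.≤ 1ℚ * (w n * w n)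
      term≤ n (suc (suc r)) (s≤s (s≤s _)) = subst₂ ℚ._≤_ (sym (^-⁻¹ n (suc (suc r))))
        (solve 1 (λ x → x :* (x :* con 1ℚ) := con 1ℚ :* (x :* x)) refl (w n))
        (ℚ.*-monoˡ-≤-nonNeg (w n) {{ℚ.nonNegative (0≤w n)}}
          (ℚ.*-monoˡ-≤-nonNeg (w n) {{ℚ.nonNegative (0≤w n)}} (w^≤1 n r)))
      step : ∀ n → ∣ ζ-seq r (suc n) - ζ-seq r n ∣ ℚ.≤ 1ℚ * (w n * w n)
      step n = subst (ℚ._≤ 1ℚ * (w n * w n))
        (trans (sym (ℚ.0≤p⇒∣p∣≡p (term-nonNeg r n))) (cong ∣_∣
          (trans (solve 2 (λ a b → b := (a :+ b) :- a) refl (ζ-seq r n) t)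
            (cong (_- ζ-seq r n)
              (trans (sym (sumOver-∷ʳ (upTo n) n term))
                     (cong (λ ks → sumOver ks term) (List.upTo-∷ʳ n)))))))
        (term≤ n r 2≤r)
        where
        term : ℕ → ℚ
        term k = (fromℕ (suc k) ^ r) ⁻¹
        t : ℚ
        t = term n

open Series-Lemmas

-- The Euler product over all primes, as the limit of its partial products
-- over the primes p ≤ n; likewise ζ r is the limit of ∑_{k ≤ n} 1/k^r (see
-- partials-tend below).
T : ℕ → ℝ
T r = mkℝ (λ n → ∏[ p ← primesUpTo n ] eulerFactor r p) (T-cauchy r)

ζ : (r : ℕ) → 2 ≤ r → ℝ
ζ r 2≤r = mkℝ (λ n → ∑[ k ← upTo n ] ((fromℕ (suc k) ^ r) ⁻¹)) (ζ-cauchy r 2≤r)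

partials-tend : ∀ x → Tendsto (λ n → ι (seq x n)) x
partials-tend x ε 0<ε with cauchy x ε 0<ε
... | N , h = N , λ n N≤n ε′ 0<ε′ → N , λ m N≤m →
  ℚ.≤-trans (h n m N≤n N≤m) (x≤x+y ε (ℚ.<⇒≤ 0<ε′))

ζ-positive : ∀ r (2≤r : 2 ≤ r) → Positiveᴿ (ζ r 2≤r)
ζ-positive r 2≤r = 1ℚ , 0<1 , 1 , h
  where
  h : ∀ n → 1 ≤ n → 1ℚ ℚ.≤ seq (ζ r 2≤r) n
  h (suc n) _ = subst (ℚ._≤ seq (ζ r 2≤r) (suc n))
    (trans (ℚ.+-identityʳ _) (trans (^-⁻¹ 0 r) (1^ r)))
    (ℚ.+-monoʳ-≤ ((fromℕ 1 ^ r) ⁻¹) (sumOver-nonNeg (List.applyUpTo suc n) (term-nonNeg r)))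
    where
    1^ : ∀ r → w 0 ^ r ≡ 1ℚ
    1^ zero    = refl
    1^ (suc r) = trans (ℚ.*-identityˡ _) (1^ r)

primeDivisors : ℕ → List ℕ
primeDivisors a = filter (λ p → prime? p ×-dec p ∣? a) (upTo (suc a))

-- For a = 1 the products in Ψ and jordan are empty.
Ψ : ℤ → ℕ → ℚ
Ψ s a = fromℕ a * ∏[ p ← primeDivisors a ] (1ℚ + (s ℚ./ 1) ÷₀ fromℕ p)

-- The Jordan totient φ_r is jordan r.
jordan : ℕ → ℕ → ℚ
jordan r a = fromℕ a ^ r * ∏[ p ← primeDivisors a ] (1ℚ - (fromℕ p ^ r) ⁻¹)

φ : ℕ → ℚ
φ = jordan 1

∏-entries : ∀ {r} → Vec ℕ r → ℕ
∏-entries = Vec.foldr′ ℕ._*_ 1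

-- gcd(x₁,…,x_r); the seed 0 is neutral for gcd.
gcd-entries : ∀ {r} → Vec ℕ r → ℕ
gcd-entries = Vec.foldr′ gcd 0

PairwiseCoprime : ∀ {r} → Vec ℕ r → Set
PairwiseCoprime x = ∀ i j → i ≢ j → gcd (lookup x i) (lookup x j) ≡ 1

PC : ∀ {r} → Vec ℕ r → Pred (Vec ℕ r) 0ℓ
PC a x = (∀ i → 0 < lookup x i) × PairwiseCoprime x × (∀ i → gcd (lookup a i) (lookup x i) ≡ 1)

C : ∀ {r} → Vec ℕ r → Pred (Vec ℕ r) 0ℓ
C a x = (∀ i → 0 < lookup x i) × gcd-entries x ≡ 1 × (∀ i → gcd (lookup a i) (lookup x i) ≡ 1)

PC? : ∀ {r} (a : Vec ℕ r) → Decidable (PC a)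
PC? a x =
  Fin.all? (λ i → 0 ℕ.<? lookup x i) ×-dec
  Fin.all? (λ i → Fin.all? λ j → ¬? (i Fin.≟ j) →-dec (gcd (lookup x i) (lookup x j) ℕ.≟ 1)) ×-dec
  Fin.all? (λ i → gcd (lookup a i) (lookup x i) ℕ.≟ 1)

C? : ∀ {r} (a : Vec ℕ r) → Decidable (C a)
C? a x =
  Fin.all? (λ i → 0 ℕ.<? lookup x i) ×-dec
  (gcd-entries x ℕ.≟ 1) ×-dec
  Fin.all? (λ i → gcd (lookup a i) (lookup x i) ℕ.≟ 1)

-- Events form an algebra of sets and ℙ is a countably additive probability
-- on it.  Closure of the events under countable unions is not demanded:
-- constructively it would exclude even a one-point space, since a real-valued
-- ℙ would decide every semi-decidable proposition.  Kolmogorov's axioms imply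
-- these, so dropping that closure only admits more spaces.
record ProbabilitySpace : Set₁ where
  field
    Ω       : Set
    IsEvent : Pred Ω 0ℓ → Set
    U-event : IsEvent U
    ∁-event : ∀ {A} → IsEvent A → IsEvent (∁ A)
    ∪-event : ∀ {A B} → IsEvent A → IsEvent B → IsEvent (A ∪ B)
    ∩-event : ∀ {A B} → IsEvent A → IsEvent B → IsEvent (A ∩ B)
    ≐-event : ∀ {A B} → A ≐ B → IsEvent A → IsEvent B

    ℙ       : (A : Pred Ω 0ℓ) → IsEvent A → ℝ
    ℙ-cong  : ∀ {A B} (eA : IsEvent A) (eB : IsEvent B) → A ≐ B → ℙ A eA ≃ ℙ B eB
    ℙ-nonNeg : ∀ {A} (eA : IsEvent A) → ι 0ℚ ≤ᴿ ℙ A eA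
    ℙ-U     : ℙ U U-event ≃ ι 1ℚ
    -- Follows from ℙ-⋃ by taking all but two of the sets empty.
    ℙ-∪     : ∀ {A B} (eA : IsEvent A) (eB : IsEvent B) → A ∩ B ⊆ ∅ →
              ℙ (A ∪ B) (∪-event eA eB) ≃ ℙ A eA +ᴿ ℙ B eB
    ℙ-⋃     : ∀ (A : ℕ → Pred Ω 0ℓ) (eA : ∀ i → IsEvent (A i)) →
              (∀ i j → i ≢ j → A i ∩ A j ⊆ ∅) →
              (e⋃ : IsEvent (λ ω → ∃[ i ] A i ω)) →
              Tendsto (λ n → sumᴿ {n} (λ i → ℙ (A (toℕ i)) (eA (toℕ i)))) (ℙ (λ ω → ∃[ i ] A i ω) e⋃)

open ProbabilitySpace

-- A random variable with values in {1,…,n}.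
record RandomVariable (𝒮 : ProbabilitySpace) (n : ℕ) : Set where
  field
    value      : Ω 𝒮 → ℕ
    1≤value    : ∀ ω → 1 ≤ value ω
    value≤n    : ∀ ω → value ω ≤ n
    measurable : ∀ k → IsEvent 𝒮 (λ ω → value ω ≡ k)

open RandomVariable

Uniform : ∀ {𝒮 n} → RandomVariable 𝒮 n → Set
Uniform {𝒮} {n} X = ∀ k → 1 ≤ k → k ≤ n →
  ℙ 𝒮 (λ ω → value X ω ≡ k) (measurable X k) ≃ ι (fromℕ n ⁻¹)

tuple : ∀ {𝒮 n r} → (Fin r → RandomVariable 𝒮 n) → Ω 𝒮 → Vec ℕ r
tuple X ω = tabulate (λ j → value (X j) ω)

module Event-Lemmas where
  abstract
    ∅-event : ∀ 𝒮 → IsEvent 𝒮 ∅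
    ∅-event 𝒮 = ≐-event 𝒮 ((λ ¬u → ¬u tt) , λ ()) (∁-event 𝒮 (U-event 𝒮))

    const-event : ∀ 𝒮 {P : Set} → Dec P → IsEvent 𝒮 (λ _ → P)
    const-event 𝒮 (yes p) = ≐-event 𝒮 ((λ _ → p) , λ _ → tt) (U-event 𝒮)
    const-event 𝒮 (no ¬p) = ≐-event 𝒮 ((λ ()) , λ p → ⊥-elim (¬p p)) (∅-event 𝒮)

    finite-⋃-event : ∀ 𝒮 (A : ℕ → Pred (Ω 𝒮) 0ℓ) → (∀ i → IsEvent 𝒮 (A i)) →
      ∀ n → IsEvent 𝒮 (λ ω → ∃[ i ] i < n × A i ω)
    finite-⋃-event 𝒮 A eA zero    = ≐-event 𝒮 ((λ ()) , λ ()) (∅-event 𝒮)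
    finite-⋃-event 𝒮 A eA (suc n) =
      ≐-event 𝒮 (to , from) (∪-event 𝒮 (finite-⋃-event 𝒮 A eA n) (eA n))
      where
      to : ∀ {ω} → ((λ ω → ∃[ i ] i < n × A i ω) ∪ A n) ω → ∃[ i ] i < suc n × A i ω
      to (inj₁ (i , i<n , a)) = i , ℕ.m<n⇒m<1+n i<n , a
      to (inj₂ a)             = n , ℕ.n<1+n n , a
      from : ∀ {ω} → ∃[ i ] i < suc n × A i ω → ((λ ω → ∃[ i ] i < n × A i ω) ∪ A n) ω
      from (i , s≤s i≤n , a) with ℕ.m≤n⇒m<n∨m≡n i≤n
      ... | inj₁ i<n  = inj₁ (i , i<n , a)
      ... | inj₂ refl = inj₂ a

open Event-Lemmas

∈-event : ∀ {𝒮 n r} (X : Fin r → RandomVariable 𝒮 n) {S : Pred (Vec ℕ r) 0ℓ} → Decidable S →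
  IsEvent 𝒮 (λ ω → S (tuple X ω))
∈-event {𝒮} {r = zero}  X S? = const-event 𝒮 (S? Vec.[])
∈-event {𝒮} {n} {suc r} X {S} S? = ≐-event 𝒮 (to , from)
  (finite-⋃-event 𝒮 _ (λ k → ∩-event 𝒮 (measurable (X zero) k)
                                        (∈-event (X ∘ suc) (λ x → S? (k Vec.∷ x)))) (suc n))
  where
  A : ℕ → Pred (Ω 𝒮) 0ℓ
  A k ω = value (X zero) ω ≡ k × S (k Vec.∷ tuple (X ∘ suc) ω)
  to : ∀ {ω} → ∃[ k ] k < suc n × A k ω → S (tuple X ω)
  to (k , _ , refl , s) = s
  from : ∀ {ω} → S (tuple X ω) → ∃[ k ] k < suc n × A k ω
  from {ω} s = value (X zero) ω , s≤s (value≤n (X zero) ω) , refl , s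

Prob : ∀ {𝒮 n r} (X : Fin r → RandomVariable 𝒮 n) {S : Pred (Vec ℕ r) 0ℓ} → Decidable S → ℝ
Prob {𝒮} X {S} S? = ℙ 𝒮 (λ ω → S (tuple X ω)) (∈-event X S?)

_≟ᵛ_ : ∀ {r} → (x y : Vec ℕ r) → Dec (x ≡ y)
_≟ᵛ_ = Vec.≡-dec ℕ._≟_

-- Mutual independence of discrete random variables: the joint mass function
-- is the product of the marginal ones.
Independent : ∀ {𝒮 n r} → (Fin r → RandomVariable 𝒮 n) → Set
Independent {𝒮} X = ∀ x → Prob X (_≟ᵛ x) ≃
  prodᴿ (λ j → ℙ 𝒮 (λ ω → value (X j) ω ≡ lookup x j) (measurable (X j) (lookup x j)))

{-# OPTIONS --safe #-}
-- Fix z ≥ |a| and sieve by the primes p ≤ z only.  For each such p the condition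
-- at p is a linear combination of divisibility indicators [ e₁ ∣ x₁, …, eᵣ ∣ xᵣ ]
-- with eᵢ ∈ {1, p}.  Such an indicator has mean 1/(e₁⋯eᵣ) over large boxes, and both
-- the indicators and their means multiply when the moduli are coprime; hence the
-- sifted set has a density, the product of the local densities, without any
-- appeal to the Chinese remainder theorem.  A tuple that survives the sieve but
-- lies outside the target set has two entries divisible by some d > z, and
-- these tuples have density O(∑_{d>z} 1/d²) = O(1/z).
--
-- The same calculus with weights k^{-r} on {1,…,n} in place of uniform ones sifts
-- ζ(r) down to its term k = 1, up to a tail of the series, which identifies
-- ∏_{p≤z} (1 - p^{-r}) with 1/ζ(r) in the limit.
module Submission where

open import Defs
open import Data.Empty using (⊥; ⊥-elim)
open import Data.Fin.Base using (Fin; zero; suc)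
import Data.Fin.Properties as Fin
open import Data.Integer.Base as ℤ using (+_)
open import Data.List.Base as List using (List; []; _∷_; upTo)
import Data.List.Properties as List
open import Data.Nat.Base as ℕ using (ℕ; zero; suc; _∸_; _≤_; _<_; z≤n; s≤s)
open import Data.Nat.GCD using (gcd; gcd[m,n]∣m; gcd[m,n]∣n; gcd-greatest; gcd[m,n]≡0⇒m≡0)
open import Data.Nat.ListAction using (product)
open import Data.Nat.Primality using (Prime; prime?; euclidsLemma; ¬prime[0]; ¬prime[1]; prime⇒nonZero)
open import Data.Nat.Primality.Factorisation using (PrimeFactorisation; factorise)
import Data.Nat.Properties as ℕ
open import Data.Product.Base using (∃-syntax; _×_; _,_; proj₁; proj₂)
open import Data.Rational.Base as ℚ using (ℚ; 0ℚ; 1ℚ)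
import Data.Rational.Properties as ℚ
open import Data.Rational.Solver using (module +-*-Solver)
open import Data.Sum.Base using (_⊎_; inj₁; inj₂; [_,_]′)
open import Data.Unit.Base using (tt)
open import Data.Vec.Base as Vec using (Vec; []; _∷_; lookup; replicate; zipWith)
import Data.Vec.Properties as Vec
open import Data.Vec.Relation.Unary.All using ([]; _∷_)
import Data.Vec.Relation.Unary.All.Properties as All
open import Function.Base using (_∘_; id)
open import Level using (0ℓ)
open import Relation.Binary.PropositionalEquality
  using (_≡_; _≢_; refl; sym; trans; cong; cong₂; subst; subst₂)
open import Relation.Nullary using (Dec; yes; no; ¬_)
open import Relation.Nullary.Decidable using (_×-dec_; decidable-stable)
open import Relation.Unary using (Pred; Decidable; _⊆_; _≐_; _∪_; _∩_; U; ∅)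

open +-*-Solver using (solve; _:=_; _:+_; _:*_; :-_; _:-_; con)

module Limits where
  open ℚ-Lemmas
  open Cauchy-Lemmas
  open import Data.Rational.Base using (_+_; _*_; _-_; -_; ∣_∣)

  record Lim (s : ℕ → ℚ) (L : ℚ) : Set where
    constructor lim
    field
      within : ∀ ε → 0ℚ ℚ.< ε → ∃[ N ] ∀ n → N ≤ n → ∣ s n - L ∣ ℚ.≤ ε

  open Lim public

  lim-cong : ∀ {s t L K} → (∀ n → s n ≡ t n) → L ≡ K → Lim s L → Lim t K
  lim-cong {s} {t} {L} s≗t refl h .within ε 0<ε with h .within ε 0<ε
  ... | N , hN = N , λ n N≤n → subst (λ q → ∣ q - L ∣ ℚ.≤ ε) (s≗t n) (hN n N≤n)

  lim-const : ∀ c → Lim (λ _ → c) c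
  lim-const c .within ε 0<ε = 0 , λ n _ →
    ℚ.≤-trans (ℚ.≤-reflexive (cong ∣_∣ (ℚ.+-inverseʳ c))) (ℚ.<⇒≤ 0<ε)

  lim-+ : ∀ {s t L K} → Lim s L → Lim t K → Lim (λ n → s n + t n) (L + K)
  lim-+ {s} {t} {L} {K} hs ht .within ε 0<ε with hs .within (half ε) (half-pos 0<ε) | ht .within (half ε) (half-pos 0<ε)
  ... | M , hM | N , hN = M ℕ.⊔ N , λ n p → begin
    ∣ (s n + t n) - (L + K) ∣   ≡⟨ cong ∣_∣ (solve 4 (λ a b c d → (a :+ b) :- (c :+ d) := (a :- c) :+ (b :- d)) refl (s n) (t n) L K) ⟩
    ∣ (s n - L) + (t n - K) ∣   ≤⟨ ℚ.∣p+q∣≤∣p∣+∣q∣ (s n - L) (t n - K) ⟩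
    ∣ s n - L ∣ + ∣ t n - K ∣   ≤⟨ ℚ.+-mono-≤ (hM n (ℕ.m⊔n≤o⇒m≤o M N p)) (hN n (ℕ.m⊔n≤o⇒n≤o M N p)) ⟩
    half ε + half ε             ≡⟨ half+half ε ⟩
    ε                           ∎
    where open ℚ.≤-Reasoning

  lim-bounded : ∀ {s L} → Lim s L → ∃[ N ] ∀ n → N ≤ n → ∣ s n ∣ ℚ.≤ ∣ L ∣ + 1ℚ
  lim-bounded {s} {L} h with h .within 1ℚ 0<1
  ... | N , hN = N , λ n p →
    ℚ.≤-trans (∣x∣≤∣y∣+∣x-y∣ (s n) L) (ℚ.+-monoʳ-≤ ∣ L ∣ (hN n p))

  0<∣x∣+1 : ∀ x → 0ℚ ℚ.< ∣ x ∣ + 1ℚ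
  0<∣x∣+1 x = ℚ.+-mono-≤-< (ℚ.0≤∣p∣ x) 0<1

  lim-* : ∀ {s t L K} → Lim s L → Lim t K → Lim (λ n → s n * t n) (L * K)
  lim-* {s} {t} {L} {K} hs ht .within ε 0<ε
    with lim-bounded hs
       | hs .within (half ε * (∣ K ∣ + 1ℚ) ⁻¹) (0<* (half-pos 0<ε) (⁻¹-pos (0<∣x∣+1 K)))
       | ht .within (half ε * (∣ L ∣ + 1ℚ) ⁻¹) (0<* (half-pos 0<ε) (⁻¹-pos (0<∣x∣+1 L)))
  ... | A , hA | M , hM | N , hN = (A ℕ.⊔ M) ℕ.⊔ N , λ n p → begin
    ∣ s n * t n - L * K ∣
      ≤⟨ ∣ac-bd∣≤ (s n) L (t n) K
           (hA n (ℕ.m⊔n≤o⇒m≤o A M (ℕ.m⊔n≤o⇒m≤o (A ℕ.⊔ M) N p)))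
           (x≤x+y ∣ K ∣ 0≤1)
           (hM n (ℕ.m⊔n≤o⇒n≤o A M (ℕ.m⊔n≤o⇒m≤o (A ℕ.⊔ M) N p)))
           (hN n (ℕ.m⊔n≤o⇒n≤o (A ℕ.⊔ M) N p)) ⟩
    (∣ L ∣ + 1ℚ) * (half ε * (∣ L ∣ + 1ℚ) ⁻¹) + (∣ K ∣ + 1ℚ) * (half ε * (∣ K ∣ + 1ℚ) ⁻¹)
      ≡⟨ cong₂ _+_ (cancel (0<∣x∣+1 L) (half ε)) (cancel (0<∣x∣+1 K) (half ε)) ⟩
    half ε + half ε
      ≡⟨ half+half ε ⟩
    ε ∎
    where open ℚ.≤-Reasoning

  lim-scale : ∀ c {s L} → Lim s L → Lim (λ n → c * s n) (c * L)
  lim-scale c = lim-* (lim-const c)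

  *-interchange : ∀ a b c d → (a * b) * (c * d) ≡ (a * c) * (b * d)
  *-interchange = solve 4 (λ a b c d → (a :* b) :* (c :* d) := (a :* c) :* (b :* d)) refl

  *-leftSwap : ∀ a b c → a * (b * c) ≡ b * (a * c)
  *-leftSwap = solve 3 (λ a b c → a :* (b :* c) := b :* (a :* c)) refl

  ∑ : ℕ → (ℕ → ℚ) → ℚ
  ∑ zero    f = 0ℚ
  ∑ (suc n) f = ∑ n f + f n

  ∑-cong : ∀ n {f g} → (∀ k → k < n → f k ≡ g k) → ∑ n f ≡ ∑ n g
  ∑-cong zero    h = refl
  ∑-cong (suc n) h = cong₂ _+_ (∑-cong n (λ k k<n → h k (ℕ.m<n⇒m<1+n k<n))) (h n ℕ.≤-refl)

  ∑-mono : ∀ n {f g} → (∀ k → k < n → f k ℚ.≤ g k) → ∑ n f ℚ.≤ ∑ n g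
  ∑-mono zero    h = ℚ.≤-refl
  ∑-mono (suc n) h = ℚ.+-mono-≤ (∑-mono n (λ k k<n → h k (ℕ.m<n⇒m<1+n k<n))) (h n ℕ.≤-refl)

  ∑-zero : ∀ n → ∑ n (λ _ → 0ℚ) ≡ 0ℚ
  ∑-zero zero    = refl
  ∑-zero (suc n) = trans (ℚ.+-identityʳ _) (∑-zero n)

  ∑-nonNeg : ∀ n {f} → (∀ k → k < n → 0ℚ ℚ.≤ f k) → 0ℚ ℚ.≤ ∑ n f
  ∑-nonNeg n h = ℚ.≤-trans (ℚ.≤-reflexive (sym (∑-zero n))) (∑-mono n h)

  ∑-+ : ∀ n f g → ∑ n (λ k → f k + g k) ≡ ∑ n f + ∑ n g
  ∑-+ zero    f g = refl
  ∑-+ (suc n) f g = trans (cong (λ t → t + (f n + g n)) (∑-+ n f g))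
    (solve 4 (λ a b c d → (a :+ b) :+ (c :+ d) := (a :+ c) :+ (b :+ d)) refl (∑ n f) (∑ n g) (f n) (g n))

  ∑-*ˡ : ∀ n c f → ∑ n (λ k → c * f k) ≡ c * ∑ n f
  ∑-*ˡ zero    c f = sym (ℚ.*-zeroʳ c)
  ∑-*ˡ (suc n) c f = trans (cong (λ t → t + c * f n) (∑-*ˡ n c f)) (sym (ℚ.*-distribˡ-+ c (∑ n f) (f n)))

  ∑-*ʳ : ∀ n c f → ∑ n (λ k → f k * c) ≡ ∑ n f * c
  ∑-*ʳ n c f = trans (∑-cong n (λ k _ → ℚ.*-comm (f k) c)) (trans (∑-*ˡ n c f) (ℚ.*-comm c (∑ n f)))

  ∑-one : ∀ n → ∑ n (λ _ → 1ℚ) ≡ fromℕ n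
  ∑-one zero    = refl
  ∑-one (suc n) = trans (cong (λ t → t + 1ℚ) (∑-one n))
    (trans (ℚ.+-comm (fromℕ n) 1ℚ) (sym (fromℕ-suc n)))

open Limits

module Combinations where
  open import Data.Vec.Relation.Unary.All using (All)
  open import Data.Rational.Base using (_+_; _*_; _-_; -_)
  open import Data.Nat.Divisibility using (_∣_; _∣?_; divides; ∣1⇒≡1; ∣-trans; m∣m*n; n∣m*n; *-monoˡ-∣; >⇒∤)

  pick : {P A : Set} → Dec P → A → A → A
  pick (yes _) u v = u
  pick (no  _) u v = v

  pick-yes : {P A : Set} (P? : Dec P) {u v : A} → P → pick P? u v ≡ u
  pick-yes (yes _) p = refl
  pick-yes (no ¬p) p = ⊥-elim (¬p p)

  pick-no : {P A : Set} (P? : Dec P) {u v : A} → ¬ P → pick P? u v ≡ v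
  pick-no (yes p) ¬p = ⊥-elim (¬p p)
  pick-no (no  _) ¬p = refl

  [_] : {P : Set} → Dec P → ℚ
  [ P? ] = pick P? 1ℚ 0ℚ

  pick-lerp : ∀ {P} (P? : Dec P) u v → [ P? ] * u + (v - [ P? ] * v) ≡ pick P? u v
  pick-lerp (yes _) u v = solve 2 (λ u v → con 1ℚ :* u :+ (v :- con 1ℚ :* v) := u) refl u v
  pick-lerp (no  _) u v = solve 2 (λ u v → con 0ℚ :* u :+ (v :- con 0ℚ :* v) := v) refl u v

  0≤[] : ∀ {P} (P? : Dec P) → 0ℚ ℚ.≤ [ P? ]
  0≤[] (yes _) = ℚ-Lemmas.0≤1
  0≤[] (no  _) = ℚ.≤-refl

  []-⇔ : ∀ {P Q} (P? : Dec P) (Q? : Dec Q) → (P → Q) → (Q → P) → [ P? ] ≡ [ Q? ]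
  []-⇔ (yes p) Q? f g = sym (pick-yes Q? (f p))
  []-⇔ (no ¬p) Q? f g = sym (pick-no Q? (¬p ∘ g))

  []-× : ∀ {P Q} (P? : Dec P) (Q? : Dec Q) → [ P? ×-dec Q? ] ≡ [ P? ] * [ Q? ]
  []-× (yes _) (yes _) = refl
  []-× (yes _) (no  _) = refl
  []-× (no  _) (yes _) = refl
  []-× (no  _) (no  _) = refl

  χ : ℕ → ℕ → ℚ
  χ d x = [ d ∣? x ]

  χ-* : ∀ d p x → Prime p → ¬ p ∣ d → χ (d ℕ.* p) x ≡ χ d x * χ p x
  χ-* d p x pp p∤d = trans
    ([]-⇔ (d ℕ.* p ∣? x) (d ∣? x ×-dec p ∣? x)
      (λ dp∣x → ∣-trans (m∣m*n p) dp∣x , ∣-trans (n∣m*n d) dp∣x)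
      (λ { (divides k refl , p∣x) → [ (λ p∣k → subst (_∣ k ℕ.* d) (ℕ.*-comm p d) (*-monoˡ-∣ d p∣k))
                                    , (λ p∣d → ⊥-elim (p∤d p∣d)) ]′ (euclidsLemma k d pp p∣x) }))
    ([]-× (d ∣? x) (p ∣? x))

  ∏ᵖ : ℕ → (ℕ → ℚ) → ℚ
  ∏ᵖ zero    f = 1ℚ
  ∏ᵖ (suc z) f = ∏ᵖ z f * pick (prime? (suc z)) (f (suc z)) 1ℚ

  χᵛ : ∀ {r} → Vec ℕ r → Vec ℕ r → ℚ
  χᵛ []       []       = 1ℚ
  χᵛ (d ∷ ds) (x ∷ xs) = χ d x * χᵛ ds xs

  -- f is unchanged, or replaced by g, according as p divides the head.
  branch : ∀ {r} → ℕ → (Vec ℕ r → ℚ) → (Vec ℕ r → ℚ) → Vec ℕ (suc r) → ℚ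
  branch p f g (x ∷ xs) = pick (p ∣? x) (f xs) (g xs)

  OneOr : ℕ → ∀ {r} → Vec ℕ r → Set
  OneOr p = All (λ d → d ≡ 1 ⊎ d ≡ p)

  Smooth : ℕ → ∀ {r} → Vec ℕ r → Set
  Smooth z = All (λ d → 0 < d × (∀ q → Prime q → z < q → ¬ q ∣ d))

  prime-∤-1 : ∀ {q} → Prime q → ¬ q ∣ 1
  prime-∤-1 pq q∣1 = ¬prime[1] (subst Prime (∣1⇒≡1 q∣1) pq)

  0<prime : ∀ {p} → Prime p → 0 < p
  0<prime {p} pp = ℕ.>-nonZero⁻¹ p {{prime⇒nonZero pp}}

  smooth-1 : ∀ {z} r → Smooth z (replicate r 1)
  smooth-1 zero    = []
  smooth-1 (suc r) = (s≤s z≤n , λ q pq _ → prime-∤-1 pq) ∷ smooth-1 r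

  smooth-suc : ∀ {z r} {e : Vec ℕ r} → Smooth z e → Smooth (suc z) e
  smooth-suc []                = []
  smooth-suc ((0<d , d∤) ∷ es) = (0<d , λ q pq z<q → d∤ q pq (ℕ.<⇒≤ z<q)) ∷ smooth-suc es

  infixl 7 _⊙_
  _⊙_ : ∀ {r} → Vec ℕ r → Vec ℕ r → Vec ℕ r
  _⊙_ = zipWith ℕ._*_

  ⊙-smooth : ∀ {z r} {e e′ : Vec ℕ r} → Prime (suc z) →
    Smooth z e → OneOr (suc z) e′ → Smooth (suc z) (e ⊙ e′)
  ⊙-smooth pp [] [] = []
  ⊙-smooth {z} pp ((0<d , d∤) ∷ es) (o ∷ os) =
    (ℕ.*-mono-≤ 0<d (pos o) , λ q pq z<q q∣ →
      [ d∤ q pq (ℕ.<⇒≤ z<q) , other o q pq z<q ]′ (euclidsLemma _ _ pq q∣)) ∷ ⊙-smooth pp es os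
    where
    pos : ∀ {d} → d ≡ 1 ⊎ d ≡ suc z → 0 < d
    pos (inj₁ refl) = s≤s z≤n
    pos (inj₂ refl) = s≤s z≤n
    other : ∀ {d} → d ≡ 1 ⊎ d ≡ suc z → ∀ q → Prime q → suc z < q → ¬ q ∣ d
    other (inj₁ refl) q pq z<q = prime-∤-1 pq
    other (inj₂ refl) q pq z<q = >⇒∤ z<q

  χᵛ-⊙ : ∀ {z r} {e e′ : Vec ℕ r} → Prime (suc z) → Smooth z e → OneOr (suc z) e′ →
    ∀ x → χᵛ (e ⊙ e′) x ≡ χᵛ e x * χᵛ e′ x
  χᵛ-⊙ pp [] [] [] = refl
  χᵛ-⊙ {z} pp (_∷_ {x = d} (0<d , d∤) es) (_∷_ {x = d′} o os) (x ∷ xs) = trans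
    (cong₂ _*_ (head o) (χᵛ-⊙ pp es os xs))
    (*-interchange (χ d x) (χ d′ x) _ _)
    where
    head : ∀ {d′} → d′ ≡ 1 ⊎ d′ ≡ suc z → χ (d ℕ.* d′) x ≡ χ d x * χ d′ x
    head (inj₁ refl) = trans (cong (λ t → χ t x) (ℕ.*-identityʳ d))
      (sym (trans (cong (χ d x *_) (pick-yes (1 ∣? x) (divides x (sym (ℕ.*-identityʳ x))))) (ℚ.*-identityʳ (χ d x))))
    head (inj₂ refl) = χ-* d (suc z) x pp (d∤ (suc z) pp ℕ.≤-refl)

  χᵛ-1 : ∀ {r} (x : Vec ℕ r) → χᵛ (replicate r 1) x ≡ 1ℚ
  χᵛ-1 []       = refl
  χᵛ-1 (x ∷ xs) = trans
    (cong₂ _*_ (pick-yes (1 ∣? x) (divides x (sym (ℕ.*-identityʳ x)))) (χᵛ-1 xs)) (ℚ.*-identityʳ 1ℚ)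

  record Linear {X : Set} (W : (X → ℚ) → ℚ) : Set where
    field
      ≗-cong : ∀ {f g} → (∀ x → f x ≡ g x) → W f ≡ W g
      +-homo : ∀ f g → W (λ x → f x + g x) ≡ W f + W g
      *-homo : ∀ c f → W (λ x → c * f x) ≡ c * W f

  module Multiplicative (h : ℕ → ℚ) (h-1 : h 1 ≡ 1ℚ) (h-* : ∀ m n → h (m ℕ.* n) ≡ h m * h n) where

    μ : ∀ {r} → Vec ℕ r → ℚ
    μ []       = 1ℚ
    μ (d ∷ ds) = h d * μ ds

    μ-1 : ∀ r → μ (replicate r 1) ≡ 1ℚ
    μ-1 zero    = refl
    μ-1 (suc r) = trans (cong₂ _*_ h-1 (μ-1 r)) (ℚ.*-identityʳ 1ℚ)

    μ-⊙ : ∀ {r} (e e′ : Vec ℕ r) → μ (e ⊙ e′) ≡ μ e * μ e′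
    μ-⊙ []      []        = refl
    μ-⊙ (d ∷ e) (d′ ∷ e′) = trans (cong₂ _*_ (h-* d d′) (μ-⊙ e e′))
      (*-interchange (h d) (h d′) (μ e) (μ e′))

    -- f is a linear combination of indicators χᵛ e with e ∈ B, and M is the
    -- same combination of the numbers μ e.
    data Span {r} (B : Vec ℕ r → Set) : (Vec ℕ r → ℚ) → ℚ → Set where
      basis : ∀ {e} → B e → Span B (χᵛ e) (μ e)
      add   : ∀ {f g M K} → Span B f M → Span B g K → Span B (λ x → f x + g x) (M + K)
      scale : ∀ c {f M} → Span B f M → Span B (λ x → c * f x) (c * M)
      ext   : ∀ {f g M K} → (∀ x → f x ≡ g x) → M ≡ K → Span B f M → Span B g K

    span-map : ∀ {r s} {B : Vec ℕ r → Set} {B′ : Vec ℕ s → Set} (F : (Vec ℕ r → ℚ) → Vec ℕ s → ℚ) (c : ℚ) →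
      (∀ x → Linear (λ f → F f x)) → (∀ {e} → B e → Span B′ (F (χᵛ e)) (c * μ e)) →
      ∀ {f M} → Span B f M → Span B′ (F f) (c * M)
    span-map F c lin b (basis e)   = b e
    span-map F c lin b (add {f} {g} {M} {K} s t) =
      ext (λ x → sym (Linear.+-homo (lin x) f g)) (sym (ℚ.*-distribˡ-+ c M K))
        (add (span-map F c lin b s) (span-map F c lin b t))
    span-map F c lin b (scale k {f} {M} s) =
      ext (λ x → sym (Linear.*-homo (lin x) k f))
        (solve 3 (λ k c m → k :* (c :* m) := c :* (k :* m)) refl k c M)
        (scale k (span-map F c lin b s))
    span-map F c lin b (ext eq refl s) =
      ext (λ x → Linear.≗-cong (lin x) eq) refl (span-map F c lin b s)

    span-* : ∀ {r} {B B′ B″ : Vec ℕ r → Set} →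
      (∀ {e e′} → B e → B′ e′ → B″ (e ⊙ e′) × (∀ x → χᵛ (e ⊙ e′) x ≡ χᵛ e x * χᵛ e′ x)) →
      ∀ {f g M K} → Span B f M → Span B′ g K → Span B″ (λ x → f x * g x) (M * K)
    span-* {B = B} {B″ = B″} prod {f} {g} {M} {K} s t = ext (λ x → ℚ.*-comm (g x) (f x)) (ℚ.*-comm K M)
      (span-map (λ f x → g x * f x) K (*-linear g) (λ {e} b →
        ext (λ x → ℚ.*-comm (χᵛ e x) (g x)) (ℚ.*-comm (μ e) K)
          (span-map (λ g x → χᵛ e x * g x) (μ e) (*-linear (χᵛ e)) (λ {e′} b′ →
            ext (proj₂ (prod b b′)) (μ-⊙ e e′) (basis (proj₁ (prod b b′)))) t)) s)
      where
      *-linear : ∀ {r} (g : Vec ℕ r → ℚ) x → Linear (λ f → g x * f x)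
      *-linear g x = record
        { ≗-cong = λ eq → cong (g x *_) (eq x)
        ; +-homo = λ f f′ → ℚ.*-distribˡ-+ (g x) (f x) (f′ x)
        ; *-homo = λ c f → solve 3 (λ g c f → g :* (c :* f) := c :* (g :* f)) refl (g x) c (f x)
        }

    span-1 : ∀ {r} {B : Vec ℕ r → Set} → B (replicate r 1) → Span B (λ _ → 1ℚ) 1ℚ
    span-1 {r} b = ext χᵛ-1 (μ-1 r) (basis b)

    oneOr-1 : ∀ {p} r → OneOr p (replicate r 1)
    oneOr-1 zero    = []
    oneOr-1 (suc r) = inj₁ refl ∷ oneOr-1 r

    span-const : ∀ {p r} c → Span {r} (OneOr p) (λ _ → c) c
    span-const {r = r} c = ext (λ _ → ℚ.*-identityʳ c) (ℚ.*-identityʳ c) (scale c (span-1 (oneOr-1 r)))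

    span-χ∷ : ∀ {p d r f M} → d ≡ 1 ⊎ d ≡ p → Span {r} (OneOr p) f M →
      Span (OneOr p) (λ x → χ d (Vec.head x) * f (Vec.tail x)) (h d * M)
    span-χ∷ {p} {d} o = span-map (λ f x → χ d (Vec.head x) * f (Vec.tail x)) (h d)
      (λ x → record
        { ≗-cong = λ eq → cong (χ d (Vec.head x) *_) (eq (Vec.tail x))
        ; +-homo = λ f g → ℚ.*-distribˡ-+ (χ d (Vec.head x)) (f (Vec.tail x)) (g (Vec.tail x))
        ; *-homo = λ c f → solve 3 (λ g c f → g :* (c :* f) := c :* (g :* f)) refl
                             (χ d (Vec.head x)) c (f (Vec.tail x))
        })
      (λ {e} b → ext (λ { (x ∷ xs) → refl }) refl (basis (o ∷ b)))

    span-branch : ∀ {p r f g M K} → Span {r} (OneOr p) f M → Span (OneOr p) g K →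
      Span (OneOr p) (branch p f g) (h p * M + (K - h p * K))
    span-branch {p} {f = f} {g} {M} {K} s t = ext
      (λ { (x ∷ xs) → trans
        (cong (λ u → χ p x * f xs + (u + - 1ℚ * (χ p x * g xs)))
          (trans (cong (_* g xs) (pick-yes (1 ∣? x) (divides x (sym (ℕ.*-identityʳ x))))) (ℚ.*-identityˡ (g xs))))
        (trans (solve 3 (λ a b c → a :+ (b :+ con (- 1ℚ) :* c) := a :+ (b :- c)) refl (χ p x * f xs) (g xs) (χ p x * g xs))
        (pick-lerp (p ∣? x) (f xs) (g xs))) })
      (trans (cong (λ u → h p * M + (u + - 1ℚ * (h p * K))) (trans (cong (_* K) h-1) (ℚ.*-identityˡ K)))
        (solve 3 (λ a b c → a :+ (b :+ con (- 1ℚ) :* c) := a :+ (b :- c)) refl (h p * M) K (h p * K)))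
      (add (span-χ∷ (inj₂ refl) s)
        (add (span-χ∷ (inj₁ refl) t) (scale (- 1ℚ) (span-χ∷ (inj₂ refl) t))))

    span-∏ᵖ : ∀ {r} {f : ℕ → Vec ℕ r → ℚ} {m : ℕ → ℚ} →
      (∀ p → Prime p → Span (OneOr p) (f p) (m p)) →
      ∀ z → Span (Smooth z) (λ x → ∏ᵖ z (λ p → f p x)) (∏ᵖ z m)
    span-∏ᵖ {r} local zero    = span-1 (smooth-1 r)
    span-∏ᵖ local (suc z) with prime? (suc z)
    ... | yes pp = span-* (λ s o → ⊙-smooth pp s o , χᵛ-⊙ pp s o) (span-∏ᵖ local z) (local (suc z) pp)
    ... | no  _  = ext (λ x → sym (ℚ.*-identityʳ _)) (sym (ℚ.*-identityʳ _)) (weaken (span-∏ᵖ local z))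
      where
      weaken : ∀ {r z f M} → Span {r} (Smooth z) f M → Span (Smooth (suc z)) f M
      weaken (basis b)      = basis (smooth-suc b)
      weaken (add s t)      = add (weaken s) (weaken t)
      weaken (scale c s)    = scale c (weaken s)
      weaken (ext eq eq′ s) = ext eq eq′ (weaken s)

    span-lim : ∀ {r} {B : Vec ℕ r → Set} {W : ℕ → (Vec ℕ r → ℚ) → ℚ} → (∀ n → Linear (W n)) →
      (∀ {e} → B e → Lim (λ n → W n (χᵛ e)) (μ e)) →
      ∀ {f M} → Span B f M → Lim (λ n → W n f) M
    span-lim lin b (basis e) = b e
    span-lim lin b (add {f} {g} s t) =
      lim-cong (λ n → sym (Linear.+-homo (lin n) f g)) refl (lim-+ (span-lim lin b s) (span-lim lin b t))
    span-lim lin b (scale c {f} s) =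
      lim-cong (λ n → sym (Linear.*-homo (lin n) c f)) refl (lim-scale c (span-lim lin b s))
    span-lim lin b (ext eq refl s) =
      lim-cong (λ n → Linear.≗-cong (lin n) eq) refl (span-lim lin b s)

open Combinations

module Averages where
  open import Data.Vec.Relation.Unary.All using (All)
  open ℚ-Lemmas
  open import Data.Rational.Base using (_+_; _*_; _-_; -_; ∣_∣)
  open import Data.Nat.Divisibility using (_∣_; _∣?_; divides; ∣m+n∣m⇒∣n; n∣m*n; >⇒∤)

  fromℕ-+ : ∀ m n → fromℕ (m ℕ.+ n) ≡ fromℕ m + fromℕ n
  fromℕ-+ zero    n = sym (ℚ.+-identityˡ (fromℕ n))
  fromℕ-+ (suc m) n = trans (fromℕ-suc (m ℕ.+ n)) (trans (cong (λ t → 1ℚ + t) (fromℕ-+ m n))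
    (trans (sym (ℚ.+-assoc 1ℚ (fromℕ m) (fromℕ n))) (cong (λ t → t + fromℕ n) (sym (fromℕ-suc m)))))

  fromℕ-* : ∀ m n → fromℕ (m ℕ.* n) ≡ fromℕ m * fromℕ n
  fromℕ-* zero    n = sym (ℚ.*-zeroˡ (fromℕ n))
  fromℕ-* (suc m) n = trans (fromℕ-+ n (m ℕ.* n)) (trans (cong (λ t → fromℕ n + t) (fromℕ-* m n))
    (trans (solve 2 (λ m n → n :+ m :* n := (con 1ℚ :+ m) :* n) refl (fromℕ m) (fromℕ n))
      (cong (_* fromℕ n) (sym (fromℕ-suc m)))))

  fromℕ-mono : ∀ {m n} → m ≤ n → fromℕ m ℚ.≤ fromℕ n
  fromℕ-mono {m} {n} m≤n = subst (fromℕ m ℚ.≤_)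
    (trans (sym (fromℕ-+ m (n ℕ.∸ m))) (cong fromℕ (ℕ.m+[n∸m]≡n m≤n))) (x≤x+y (fromℕ m) (fromℕ-nonNeg (n ℕ.∸ m)))

  w-anti : ∀ {m n} → m ≤ n → w n ℚ.≤ w m
  w-anti {m} {n} m≤n = ⁻¹-anti (fromℕ (suc m)) (fromℕ (suc n)) (0<fromℕ-suc m) (fromℕ-mono (s≤s m≤n))

  ⁻¹-* : ∀ x y → (x * y) ⁻¹ ≡ x ⁻¹ * y ⁻¹
  ⁻¹-* x y = by-cases (x ℚ.≟ 0ℚ) (y ℚ.≟ 0ℚ)
    where
    xy≢0 : x ≢ 0ℚ → y ≢ 0ℚ → x * y ≢ 0ℚ
    xy≢0 x≢0 y≢0 e = x≢0 (trans (sym (ℚ.*-identityʳ x)) (trans (cong (x *_) (sym (⁻¹-inverse y y≢0)))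
      (trans (sym (ℚ.*-assoc x y (y ⁻¹))) (trans (cong (_* y ⁻¹) e) (ℚ.*-zeroˡ (y ⁻¹))))))
    by-cases : Dec (x ≡ 0ℚ) → Dec (y ≡ 0ℚ) → (x * y) ⁻¹ ≡ x ⁻¹ * y ⁻¹
    by-cases (yes refl) _ = trans (cong _⁻¹ (ℚ.*-zeroˡ y)) (sym (ℚ.*-zeroˡ (y ⁻¹)))
    by-cases (no _) (yes refl) = trans (cong _⁻¹ (ℚ.*-zeroʳ x)) (sym (ℚ.*-zeroʳ (x ⁻¹)))
    by-cases (no x≢0) (no y≢0) = ⁻¹-unique (x * y) (x ⁻¹ * y ⁻¹) (xy≢0 x≢0 y≢0)
      (trans (*-interchange x y (x ⁻¹) (y ⁻¹)) (cong₂ _*_ (⁻¹-inverse x x≢0) (⁻¹-inverse y y≢0)))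

  -- n = t + c d with t < d, and the multiples of d up to n are d, 2d, …, cd.
  ∑-multiples : ∀ d′ n (g : ℕ → ℚ) → let d = suc d′ in
    ∃[ c ] ∃[ t ] n ≡ t ℕ.+ c ℕ.* d × t < d ×
      ∑ n (λ k → χ d (suc k) * g (suc k)) ≡ ∑ c (λ j → g (suc j ℕ.* d))
  ∑-multiples d′ zero    g = 0 , 0 , refl , s≤s z≤n , refl
  ∑-multiples d′ (suc n) g with ∑-multiples d′ n g
  ... | c , t , n≡ , t<d , eq with suc t ℕ.<? suc d′
  ... | yes 1+t<d = c , suc t , cong suc n≡ , 1+t<d ,
    trans (cong₂ _+_ eq (trans (cong (_* g (suc n)) (pick-no (suc d′ ∣? suc n) d∤))
      (ℚ.*-zeroˡ (g (suc n))))) (ℚ.+-identityʳ _)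
    where
    d∤ : ¬ suc d′ ∣ suc n
    d∤ d∣ = >⇒∤ 1+t<d (∣m+n∣m⇒∣n (subst (suc d′ ∣_) (trans (cong suc n≡) (ℕ.+-comm (suc t) (c ℕ.* suc d′))) d∣)
      (n∣m*n c))
  ... | no ¬1+t<d = suc c , 0 , 1+n≡ , s≤s z≤n ,
    cong₂ _+_ eq (trans (cong₂ (λ u k → u * g k)
      (pick-yes (suc d′ ∣? suc n) (divides (suc c) 1+n≡)) 1+n≡)
      (ℚ.*-identityˡ (g (suc c ℕ.* suc d′))))
    where
    1+n≡ : suc n ≡ suc c ℕ.* suc d′
    1+n≡ = trans (cong suc n≡) (cong (ℕ._+ c ℕ.* suc d′) (ℕ.≤-antisym t<d (ℕ.≮⇒≥ ¬1+t<d)))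

  avg : ℕ → ∀ {r} → (Vec ℕ r → ℚ) → ℚ
  avg n {zero}  f = f []
  avg n {suc r} f = fromℕ n ⁻¹ * ∑ n (λ k → avg n (λ xs → f (suc k ∷ xs)))

  InBox : ℕ → ∀ {r} → Vec ℕ r → Set
  InBox n = All (λ k → 1 ≤ k × k ≤ n)

  avg-linear : ∀ n r → Linear (avg n {r})
  avg-linear n zero = record
    { ≗-cong = λ eq → eq [] ; +-homo = λ f g → refl ; *-homo = λ c f → refl }
  avg-linear n (suc r) = record
    { ≗-cong = λ eq → cong (fromℕ n ⁻¹ *_) (∑-cong n (λ k _ → ≗-cong (λ xs → eq (suc k ∷ xs))))
    ; +-homo = λ f g → trans
        (cong (fromℕ n ⁻¹ *_) (trans (∑-cong n (λ k _ → +-homo (λ xs → f (suc k ∷ xs)) (λ xs → g (suc k ∷ xs))))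
          (∑-+ n (λ k → avg n (λ xs → f (suc k ∷ xs))) (λ k → avg n (λ xs → g (suc k ∷ xs))))))
        (ℚ.*-distribˡ-+ (fromℕ n ⁻¹) (∑ n (λ k → avg n (λ xs → f (suc k ∷ xs)))) (∑ n (λ k → avg n (λ xs → g (suc k ∷ xs)))))
    ; *-homo = λ c f → trans
        (cong (fromℕ n ⁻¹ *_) (trans (∑-cong n (λ k _ → *-homo c (λ xs → f (suc k ∷ xs))))
          (∑-*ˡ n c (λ k → avg n (λ xs → f (suc k ∷ xs))))))
        (*-leftSwap (fromℕ n ⁻¹) c (∑ n (λ k → avg n (λ xs → f (suc k ∷ xs)))))
    }
    where
    open Linear (avg-linear n r)

  0≤fromℕ⁻¹ : ∀ n → 0ℚ ℚ.≤ fromℕ n ⁻¹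
  0≤fromℕ⁻¹ zero    = ℚ.≤-refl
  0≤fromℕ⁻¹ (suc n) = 0≤w n

  avg-mono : ∀ n {r} {f g : Vec ℕ r → ℚ} → (∀ x → InBox n x → f x ℚ.≤ g x) → avg n f ℚ.≤ avg n g
  avg-mono n {zero}  h = h [] []
  avg-mono n {suc r} h = ℚ.*-monoˡ-≤-nonNeg (fromℕ n ⁻¹) {{ℚ.nonNegative (0≤fromℕ⁻¹ n)}}
    (∑-mono n (λ k k<n → avg-mono n (λ xs b → h (suc k ∷ xs) ((s≤s z≤n , k<n) ∷ b))))

  avg-* : ∀ n {r} (g : ℕ → ℚ) (f : Vec ℕ r → ℚ) →
    avg n (λ x → g (Vec.head x) * f (Vec.tail x)) ≡ (fromℕ n ⁻¹ * ∑ n (λ k → g (suc k))) * avg n f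
  avg-* n {r} g f = trans
    (cong (fromℕ n ⁻¹ *_) (trans (∑-cong n (λ k _ → Linear.*-homo (avg-linear n r) (g (suc k)) f))
      (∑-*ʳ n (avg n f) (λ k → g (suc k)))))
    (sym (ℚ.*-assoc (fromℕ n ⁻¹) (∑ n (λ k → g (suc k))) (avg n f)))

  freq : ℕ → ℕ → ℚ
  freq n d = fromℕ n ⁻¹ * ∑ n (λ k → χ d (suc k))

  abstract
    floor-error : ∀ {N W D V C T} → N * W ≡ 1ℚ → D * V ≡ 1ℚ → N ≡ T + C * D → W * C + W * (V * T) ≡ V
    floor-error {N} {W} {D} {V} {C} {T} NW≡1 DV≡1 N≡ = begin-equality
      W * C + W * (V * T)               ≡⟨ cong (λ u → u + W * (V * T)) (ℚ.*-identityˡ (W * C)) ⟨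
      1ℚ * (W * C) + W * (V * T)        ≡⟨ cong (λ u → u * (W * C) + W * (V * T)) DV≡1 ⟨
      (D * V) * (W * C) + W * (V * T)   ≡⟨ rearrange D V W C T ⟩
      V * ((T + C * D) * W)             ≡⟨ cong (λ u → V * (u * W)) N≡ ⟨
      V * (N * W)                       ≡⟨ cong (V *_) NW≡1 ⟩
      V * 1ℚ                            ≡⟨ ℚ.*-identityʳ V ⟩
      V                                 ∎
      where
      open ℚ.≤-Reasoning
      rearrange : ∀ D V W C T → (D * V) * (W * C) + W * (V * T) ≡ V * ((T + C * D) * W)
      rearrange = solve 5 (λ D V W C T → (D :* V) :* (W :* C) :+ W :* (V :* T) := V :* ((T :+ C :* D) :* W)) refl

    freq-error : ∀ m d′ → ∃[ u ] 0ℚ ℚ.≤ u × u ℚ.≤ 1ℚ × freq (suc m) (suc d′) + w m * u ≡ w d′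
    freq-error m d′ with ∑-multiples d′ (suc m) (λ _ → 1ℚ)
    ... | c , t , n≡ , t<d , eq = w d′ * fromℕ t , 0≤* (0≤w d′) (fromℕ-nonNeg t) , vt≤1 ,
      trans (cong (λ u → w m * u + w m * (w d′ * fromℕ t)) count)
        (floor-error {fromℕ (suc m)} {w m} {fromℕ (suc d′)} {w d′} {fromℕ c} {fromℕ t} (fw m) (fw d′)
          (trans (cong fromℕ n≡) (trans (fromℕ-+ t (c ℕ.* suc d′)) (cong (λ u → fromℕ t + u) (fromℕ-* c (suc d′))))))
      where
      vt≤1 : w d′ * fromℕ t ℚ.≤ 1ℚ
      vt≤1 = ℚ.≤-trans (ℚ.*-monoˡ-≤-nonNeg (w d′) {{ℚ.nonNegative (0≤w d′)}} (fromℕ-mono (ℕ.<⇒≤ t<d)))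
        (ℚ.≤-reflexive (trans (ℚ.*-comm (w d′) (fromℕ (suc d′))) (fw d′)))
      count : ∑ (suc m) (λ k → χ (suc d′) (suc k)) ≡ fromℕ c
      count = trans (∑-cong (suc m) (λ k _ → sym (ℚ.*-identityʳ (χ (suc d′) (suc k))))) (trans eq (∑-one c))

    freq≤ : ∀ n d′ → freq n (suc d′) ℚ.≤ w d′
    freq≤ zero    d′ = 0≤w d′
    freq≤ (suc m) d′ = ≤-sum {freq (suc m) (suc d′)} {w m} (0≤w m) (freq-error m d′)
      where
      ≤-sum : ∀ {a W v} → 0ℚ ℚ.≤ W → ∃[ u ] 0ℚ ℚ.≤ u × u ℚ.≤ 1ℚ × a + W * u ≡ v → a ℚ.≤ v
      ≤-sum {a} 0≤W (u , 0≤u , _ , eq) = subst (a ℚ.≤_) eq (x≤x+y a (0≤* 0≤W 0≤u))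

  0≤freq : ∀ n d → 0ℚ ℚ.≤ freq n d
  0≤freq n d = 0≤* (0≤fromℕ⁻¹ n) (∑-nonNeg n (λ k _ → 0≤[] (d ∣? suc k)))

  freq-lim : ∀ d′ → Lim (λ n → freq n (suc d′)) (w d′)
  freq-lim d′ .within ε 0<ε = suc (proj₁ small) ,
    λ { (suc m) (s≤s N≤m) → near {freq (suc m) (suc d′)} {w m} (0≤w m)
      (ℚ.≤-trans (w-anti N≤m) (ℚ.≤-trans (ℚ.≤-reflexive (sym (ℚ.*-identityˡ (w (proj₁ small))))) (proj₂ small)))
      (freq-error m d′) }
    where
    small : ∃[ N ] 1ℚ * w N ℚ.≤ ε
    small = archimedean 0≤1 0<ε
    near : ∀ {a W v} → 0ℚ ℚ.≤ W → W ℚ.≤ ε → ∃[ u ] 0ℚ ℚ.≤ u × u ℚ.≤ 1ℚ × a + W * u ≡ v → ∣ a - v ∣ ℚ.≤ ε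
    near {a} {W} 0≤W W≤ε (u , 0≤u , u≤1 , refl) = begin
      ∣ a - (a + W * u) ∣  ≡⟨ cong ∣_∣ (solve 2 (λ a b → a :- (a :+ b) := :- b) refl a (W * u)) ⟩
      ∣ - (W * u) ∣        ≡⟨ ℚ.∣-p∣≡∣p∣ (W * u) ⟩
      ∣ W * u ∣            ≡⟨ ℚ.0≤p⇒∣p∣≡p (0≤* 0≤W 0≤u) ⟩
      W * u                ≤⟨ *-mono 0≤W W≤ε 0≤u u≤1 ⟩
      ε * 1ℚ               ≡⟨ ℚ.*-identityʳ ε ⟩
      ε                    ∎
      where open ℚ.≤-Reasoning

  module Reciprocal = Multiplicative (λ d → fromℕ d ⁻¹) refl
    (λ m n → trans (cong _⁻¹ (fromℕ-* m n)) (⁻¹-* (fromℕ m) (fromℕ n)))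
  open Reciprocal

  avg-χᵛ-lim : ∀ {z r} {e : Vec ℕ r} → Smooth z e → Lim (λ n → avg n (χᵛ e)) (μ e)
  avg-χᵛ-lim [] = lim-const 1ℚ
  avg-χᵛ-lim (_∷_ {x = suc d′} {xs = ds} (s≤s z≤n , _) es) = lim-cong
    (λ n → sym (avg-* n (χ (suc d′)) (χᵛ ds))) refl
    (lim-* (freq-lim d′) (avg-χᵛ-lim es))

open Averages

module Pairs where
  open ℚ-Lemmas
  open import Data.Rational.Base using (_+_; _*_; _-_; -_)
  open import Data.Nat.Divisibility using (_∣_; _∣?_)

  Indicates : ℚ → Set → Set
  Indicates q P = (P × q ≡ 1ℚ) ⊎ (¬ P × q ≡ 0ℚ)

  indicates-map : ∀ {q P Q} → (P → Q) → (Q → P) → Indicates q P → Indicates q Q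
  indicates-map f g (inj₁ (p , q≡))  = inj₁ (f p , q≡)
  indicates-map f g (inj₂ (¬p , q≡)) = inj₂ (¬p ∘ g , q≡)

  0*≡0 : ∀ {a b} → a ≡ 0ℚ → a * b ≡ 0ℚ
  0*≡0 {b = b} refl = ℚ.*-zeroˡ b

  *0≡0 : ∀ {a b} → b ≡ 0ℚ → a * b ≡ 0ℚ
  *0≡0 {a} refl = ℚ.*-zeroʳ a

  indicates-∏ᵖ : ∀ {f : ℕ → ℚ} {P : ℕ → Set} → (∀ p → Prime p → Indicates (f p) (P p)) →
    ∀ z → Indicates (∏ᵖ z f) (∀ p → Prime p → p ≤ z → P p)
  indicates-∏ᵖ h zero = inj₁ ((λ p pp p≤0 → ⊥-elim (ℕ.<⇒≱ (0<prime pp) p≤0)) , refl)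
  indicates-∏ᵖ {f} {P} h (suc z) with prime? (suc z) | indicates-∏ᵖ h z
  ... | _      | inj₂ (¬all , eq) = inj₂
    ((λ all → ¬all (λ p pp p≤z → all p pp (ℕ.m≤n⇒m≤1+n p≤z))) , 0*≡0 eq)
  ... | no ¬pp | inj₁ (all , eq)  = inj₁
    ( (λ p pp p≤1+z → [ all p pp ∘ ℕ.≤-pred , (λ { refl → ⊥-elim (¬pp pp) }) ]′ (ℕ.m≤n⇒m<n∨m≡n p≤1+z))
    , trans (ℚ.*-identityʳ _) eq)
  ... | yes pp | inj₁ (all , eq) with h (suc z) pp
  ... | inj₁ (p , eq′) = inj₁
    ( (λ q pq q≤1+z → [ all q pq ∘ ℕ.≤-pred , (λ { refl → p }) ]′ (ℕ.m≤n⇒m<n∨m≡n q≤1+z))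
    , cong₂ _*_ eq eq′)
  ... | inj₂ (¬p , eq′) = inj₂
    ((λ all → ¬p (all (suc z) pp ℕ.≤-refl)) , *0≡0 {∏ᵖ z f} eq′)

  hits pairs : ∀ {r} → ℕ → Vec ℕ r → ℚ
  hits d []       = 0ℚ
  hits d (x ∷ xs) = χ d x * 1ℚ + 1ℚ * hits d xs
  pairs d []       = 0ℚ
  pairs d (x ∷ xs) = χ d x * hits d xs + 1ℚ * pairs d xs

  Pair : ∀ {r} → ℕ → Vec ℕ r → Set
  Pair d x = ∃[ i ] ∃[ j ] i ≢ j × (d ∣ lookup x i) × (d ∣ lookup x j)

  1≤+ʳ : ∀ {a b} → 0ℚ ℚ.≤ a → 1ℚ ℚ.≤ b → 1ℚ ℚ.≤ a + b
  1≤+ʳ 0≤a 1≤b = ℚ.+-mono-≤ 0≤a 1≤b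

  1≤+ˡ : ∀ {a b} → 1ℚ ℚ.≤ a → 0ℚ ℚ.≤ b → 1ℚ ℚ.≤ a + b
  1≤+ˡ 1≤a 0≤b = ℚ.+-mono-≤ 1≤a 0≤b

  1*≡ : ∀ {a} → a ℚ.≤ 1ℚ * a
  1*≡ = ℚ.≤-reflexive (sym (ℚ.*-identityˡ _))

  0≤hits : ∀ {r} d (x : Vec ℕ r) → 0ℚ ℚ.≤ hits d x
  0≤hits d []       = ℚ.≤-refl
  0≤hits d (x ∷ xs) = 0≤+ (0≤* (0≤[] (d ∣? x)) 0≤1) (0≤* 0≤1 (0≤hits d xs))

  0≤pairs : ∀ {r} d (x : Vec ℕ r) → 0ℚ ℚ.≤ pairs d x
  0≤pairs d []       = ℚ.≤-refl
  0≤pairs d (x ∷ xs) = 0≤+ (0≤* (0≤[] (d ∣? x)) (0≤hits d xs)) (0≤* 0≤1 (0≤pairs d xs))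

  1≤hits : ∀ {r} d (x : Vec ℕ r) i → d ∣ lookup x i → 1ℚ ℚ.≤ hits d x
  1≤hits d (x ∷ xs) zero    d∣ = 1≤+ˡ {χ d x * 1ℚ} {1ℚ * hits d xs}
    (ℚ.≤-reflexive (sym (cong (_* 1ℚ) (pick-yes (d ∣? x) d∣)))) (0≤* 0≤1 (0≤hits d xs))
  1≤hits d (x ∷ xs) (suc i) d∣ = 1≤+ʳ {χ d x * 1ℚ} {1ℚ * hits d xs}
    (0≤* (0≤[] (d ∣? x)) 0≤1) (ℚ.≤-trans (1≤hits d xs i d∣) 1*≡)

  1≤pairs : ∀ {r} d (x : Vec ℕ r) → Pair d x → 1ℚ ℚ.≤ pairs d x
  1≤pairs d (x ∷ xs) (zero , zero , i≢j , _) = ⊥-elim (i≢j refl)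
  1≤pairs d (x ∷ xs) (zero , suc j , _ , d∣ , d∣′) = 1≤+ˡ {χ d x * hits d xs} {1ℚ * pairs d xs}
    (ℚ.≤-trans (1≤hits d xs j d∣′) (ℚ.≤-trans 1*≡ (ℚ.≤-reflexive (sym (cong (_* hits d xs) (pick-yes (d ∣? x) d∣))))))
    (0≤* 0≤1 (0≤pairs d xs))
  1≤pairs d (x ∷ xs) (suc i , zero , _ , d∣ , d∣′) = 1≤pairs d (x ∷ xs) (zero , suc i , (λ ()) , d∣′ , d∣)
  1≤pairs d (x ∷ xs) (suc i , suc j , i≢j , d∣ , d∣′) = 1≤+ʳ {χ d x * hits d xs} {1ℚ * pairs d xs}
    (0≤* (0≤[] (d ∣? x)) (0≤hits d xs))
    (ℚ.≤-trans (1≤pairs d xs (i , j , (λ { refl → i≢j refl }) , d∣ , d∣′)) 1*≡)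

  linear-0 : ∀ {X : Set} {W : (X → ℚ) → ℚ} → Linear W → W (λ _ → 0ℚ) ≡ 0ℚ
  linear-0 {W = W} lin = trans (Linear.*-homo lin 0ℚ (λ _ → 0ℚ)) (ℚ.*-zeroˡ (W (λ _ → 0ℚ)))

  linear-∑ : ∀ {X : Set} {W : (X → ℚ) → ℚ} → Linear W → ∀ m (F : ℕ → X → ℚ) →
    W (λ x → ∑ m (λ j → F j x)) ≡ ∑ m (λ j → W (F j))
  linear-∑ lin zero    F = linear-0 lin
  linear-∑ {W = W} lin (suc m) F = trans (Linear.+-homo lin (λ x → ∑ m (λ j → F j x)) (F m))
    (cong (λ t → t + W (F m)) (linear-∑ lin m F))

  avg-nonNeg : ∀ n {r} {f : Vec ℕ r → ℚ} → (∀ x → 0ℚ ℚ.≤ f x) → 0ℚ ℚ.≤ avg n f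
  avg-nonNeg n {r} h = ℚ.≤-trans (ℚ.≤-reflexive (sym (linear-0 (avg-linear n r)))) (avg-mono n (λ x _ → h x))

  freq-1≤ : ∀ n → fromℕ n ⁻¹ * ∑ n (λ _ → 1ℚ) ℚ.≤ 1ℚ
  freq-1≤ zero    = ℚ.<⇒≤ 0<1
  freq-1≤ (suc n) = ℚ.≤-reflexive (trans (cong (w n *_) (∑-one (suc n))) (trans (ℚ.*-comm (w n) (fromℕ (suc n))) (fw n)))

  0≤freq-1 : ∀ n → 0ℚ ℚ.≤ fromℕ n ⁻¹ * ∑ n (λ _ → 1ℚ)
  0≤freq-1 n = 0≤* (0≤fromℕ⁻¹ n) (∑-nonNeg n (λ _ _ → 0≤1))

  avg-1≤ : ∀ n r → avg n {r} (λ _ → 1ℚ) ℚ.≤ 1ℚ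
  avg-1≤ n zero    = ℚ.≤-refl
  avg-1≤ n (suc r) = begin
    avg n {suc r} (λ _ → 1ℚ)                                   ≡⟨ avg-* n {r} (λ _ → 1ℚ) (λ _ → 1ℚ) ⟩
    (fromℕ n ⁻¹ * ∑ n (λ _ → 1ℚ)) * avg n {r} (λ _ → 1ℚ)
      ≤⟨ *-mono (0≤freq-1 n) (freq-1≤ n) (avg-nonNeg n {r} (λ _ → 0≤1)) (avg-1≤ n r) ⟩
    1ℚ * 1ℚ                                                    ∎
    where open ℚ.≤-Reasoning

  avg-step : ∀ n d′ {r} (f g : Vec ℕ r → ℚ) {A B} → (∀ x → 0ℚ ℚ.≤ f x) → (∀ x → 0ℚ ℚ.≤ g x) →
    avg n f ℚ.≤ A → avg n g ℚ.≤ B →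
    avg n (λ x → χ (suc d′) (Vec.head x) * f (Vec.tail x) + 1ℚ * g (Vec.tail x)) ℚ.≤ w d′ * A + 1ℚ * B
  avg-step n d′ {r} f g {A} {B} 0≤f 0≤g f≤A g≤B = begin
    avg n (λ x → χ (suc d′) (Vec.head x) * f (Vec.tail x) + 1ℚ * g (Vec.tail x))
      ≡⟨ Linear.+-homo (avg-linear n (suc r)) (λ x → χ (suc d′) (Vec.head x) * f (Vec.tail x)) (λ x → 1ℚ * g (Vec.tail x)) ⟩
    avg n (λ x → χ (suc d′) (Vec.head x) * f (Vec.tail x)) + avg n {suc r} (λ x → 1ℚ * g (Vec.tail x))
      ≡⟨ cong₂ _+_ (avg-* n (χ (suc d′)) f) (avg-* n (λ _ → 1ℚ) g) ⟩
    freq n (suc d′) * avg n f + (fromℕ n ⁻¹ * ∑ n (λ _ → 1ℚ)) * avg n g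
      ≤⟨ ℚ.+-mono-≤ (*-mono (0≤freq n (suc d′)) (freq≤ n d′) (avg-nonNeg n 0≤f) f≤A)
                    (*-mono (0≤freq-1 n) (freq-1≤ n) (avg-nonNeg n 0≤g) g≤B) ⟩
    w d′ * A + 1ℚ * B ∎
    where open ℚ.≤-Reasoning

  avg-hits : ∀ n d′ r → avg n {r} (hits (suc d′)) ℚ.≤ fromℕ r * w d′
  avg-hits n d′ zero    = ℚ.≤-reflexive (sym (ℚ.*-zeroˡ (w d′)))
  avg-hits n d′ (suc r) = begin
    avg n {suc r} (hits (suc d′))
      ≤⟨ avg-step n d′ {r} (λ _ → 1ℚ) (hits (suc d′)) {1ℚ} {fromℕ r * w d′} (λ _ → 0≤1) (0≤hits (suc d′)) (avg-1≤ n r) (avg-hits n d′ r) ⟩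
    w d′ * 1ℚ + 1ℚ * (fromℕ r * w d′)
      ≡⟨ solve 2 (λ x r → x :* con 1ℚ :+ con 1ℚ :* (r :* x) := (con 1ℚ :+ r) :* x) refl (w d′) (fromℕ r) ⟩
    (1ℚ + fromℕ r) * w d′
      ≡⟨ cong (_* w d′) (sym (fromℕ-suc r)) ⟩
    fromℕ (suc r) * w d′ ∎
    where open ℚ.≤-Reasoning

  avg-pairs : ∀ n d′ r → avg n {r} (pairs (suc d′)) ℚ.≤ (fromℕ r * fromℕ r) * (w d′ * w d′)
  avg-pairs n d′ zero    = ℚ.≤-reflexive (sym (ℚ.*-zeroˡ (w d′ * w d′)))
  avg-pairs n d′ (suc r) = begin
    avg n {suc r} (pairs (suc d′))
      ≤⟨ avg-step n d′ {r} (hits (suc d′)) (pairs (suc d′)) {fromℕ r * w d′} {(fromℕ r * fromℕ r) * (w d′ * w d′)}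
           (0≤hits (suc d′)) (0≤pairs (suc d′)) (avg-hits n d′ r) (avg-pairs n d′ r) ⟩
    w d′ * (fromℕ r * w d′) + 1ℚ * ((fromℕ r * fromℕ r) * (w d′ * w d′))
      ≤⟨ x≤x+y _ (0≤* (0≤+ 0≤1 (fromℕ-nonNeg r)) (0≤* (0≤w d′) (0≤w d′))) ⟩
    w d′ * (fromℕ r * w d′) + 1ℚ * ((fromℕ r * fromℕ r) * (w d′ * w d′)) + (1ℚ + fromℕ r) * (w d′ * w d′)
      ≡⟨ solve 2 (λ x r → x :* (r :* x) :+ con 1ℚ :* ((r :* r) :* (x :* x)) :+ (con 1ℚ :+ r) :* (x :* x)
           := ((con 1ℚ :+ r) :* (con 1ℚ :+ r)) :* (x :* x)) refl (w d′) (fromℕ r) ⟩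
    ((1ℚ + fromℕ r) * (1ℚ + fromℕ r)) * (w d′ * w d′)
      ≡⟨ cong (λ t → (t * t) * (w d′ * w d′)) (sym (fromℕ-suc r)) ⟩
    (fromℕ (suc r) * fromℕ (suc r)) * (w d′ * w d′) ∎
    where open ℚ.≤-Reasoning

  ∑-w² : ∀ z m → ∑ m (λ j → w (z ℕ.+ j) * w (z ℕ.+ j)) ℚ.≤ w z + w z
  ∑-w² z m = ℚ.≤-trans (telescope m)
    (ℚ.+-mono-≤ (drop (w z) (0≤w (z ℕ.+ m))) (drop (w z) (0≤w (z ℕ.+ m))))
    where
    open ℚ.≤-Reasoning
    drop : ∀ a {b} → 0ℚ ℚ.≤ b → a - b ℚ.≤ a
    drop a {b} 0≤b = x≤y+z⇒x-y≤z {a} {b} {a} (ℚ.≤-trans (x≤x+y a 0≤b) (ℚ.≤-reflexive (ℚ.+-comm a b)))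
    collect : ∀ a b c → ((a - b) + (a - b)) + ((b - c) + (b - c)) ≡ (a - c) + (a - c)
    collect = solve 3 (λ a b c → ((a :- b) :+ (a :- b)) :+ ((b :- c) :+ (b :- c)) := (a :- c) :+ (a :- c)) refl
    telescope : ∀ m → ∑ m (λ j → w (z ℕ.+ j) * w (z ℕ.+ j)) ℚ.≤ (w z - w (z ℕ.+ m)) + (w z - w (z ℕ.+ m))
    telescope zero    = ℚ.≤-reflexive (sym (trans (cong (λ k → (w z - w k) + (w z - w k)) (ℕ.+-identityʳ z))
      (solve 1 (λ a → (a :- a) :+ (a :- a) := con 0ℚ) refl (w z))))
    telescope (suc m) = begin
      ∑ m (λ j → w (z ℕ.+ j) * w (z ℕ.+ j)) + w (z ℕ.+ m) * w (z ℕ.+ m)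
        ≤⟨ ℚ.+-mono-≤ (telescope m) (w²≤ (z ℕ.+ m)) ⟩
      ((w z - w (z ℕ.+ m)) + (w z - w (z ℕ.+ m))) + ((w (z ℕ.+ m) - w (suc (z ℕ.+ m))) + (w (z ℕ.+ m) - w (suc (z ℕ.+ m))))
        ≡⟨ collect (w z) (w (z ℕ.+ m)) (w (suc (z ℕ.+ m))) ⟩
      (w z - w (suc (z ℕ.+ m))) + (w z - w (suc (z ℕ.+ m)))
        ≡⟨ cong (λ k → (w z - w k) + (w z - w k)) (sym (ℕ.+-suc z m)) ⟩
      (w z - w (z ℕ.+ suc m)) + (w z - w (z ℕ.+ suc m)) ∎

  bigPairs : ∀ {r} → ℕ → ℕ → Vec ℕ r → ℚ
  bigPairs z m x = ∑ m (λ j → pairs (suc (z ℕ.+ j)) x)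

  avg-bigPairs : ∀ n r z m → avg n {r} (bigPairs z m) ℚ.≤ (fromℕ r * fromℕ r) * (w z + w z)
  avg-bigPairs n r z m = begin
    avg n {r} (bigPairs z m)
      ≡⟨ linear-∑ (avg-linear n r) m (λ j → pairs (suc (z ℕ.+ j))) ⟩
    ∑ m (λ j → avg n {r} (pairs (suc (z ℕ.+ j))))
      ≤⟨ ∑-mono m (λ j _ → avg-pairs n (z ℕ.+ j) r) ⟩
    ∑ m (λ j → (fromℕ r * fromℕ r) * (w (z ℕ.+ j) * w (z ℕ.+ j)))
      ≡⟨ ∑-*ˡ m (fromℕ r * fromℕ r) (λ j → w (z ℕ.+ j) * w (z ℕ.+ j)) ⟩
    (fromℕ r * fromℕ r) * ∑ m (λ j → w (z ℕ.+ j) * w (z ℕ.+ j))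
      ≤⟨ ℚ.*-monoˡ-≤-nonNeg (fromℕ r * fromℕ r) {{ℚ.nonNegative (0≤* (fromℕ-nonNeg r) (fromℕ-nonNeg r))}} (∑-w² z m) ⟩
    (fromℕ r * fromℕ r) * (w z + w z) ∎
    where open ℚ.≤-Reasoning

  ∑-covers : ∀ m {f : ℕ → ℚ} {P : ℕ → Set} → (∀ j → 0ℚ ℚ.≤ f j) → (∀ j → P j → 1ℚ ℚ.≤ f j) →
    ∀ j → j < m → P j → 1ℚ ℚ.≤ ∑ m f
  ∑-covers (suc m) {f} 0≤f 1≤f j (s≤s j≤m) p with ℕ.m≤n⇒m<n∨m≡n j≤m
  ... | inj₁ j<m  = 1≤+ˡ {∑ m f} (∑-covers m 0≤f 1≤f j j<m p) (0≤f m)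
  ... | inj₂ refl = 1≤+ʳ {∑ m f} (∑-nonNeg m (λ k _ → 0≤f k)) (1≤f m p)

open Pairs

module FundamentalSieve where
  open ℚ-Lemmas
  open Reciprocal
  open import Data.Rational.Base using (_+_; _*_; _-_; -_; ∣_∣)
  open import Data.Nat.Divisibility using (>⇒∤)

  ∣x∣≤-between : ∀ {a b c} → a ℚ.≤ b → b ℚ.≤ a + c → ∣ a - b ∣ ℚ.≤ c
  ∣x∣≤-between {a} {b} {c} a≤b b≤a+c = ∣x∣≤
    (ℚ.≤-trans (x≤y+z⇒x-y≤z {a} {b} {0ℚ} (subst (a ℚ.≤_) (sym (ℚ.+-identityʳ b)) a≤b)) 0≤c)
    (subst (ℚ._≤ c) (solve 2 (λ a b → b :- a := :- (a :- b)) refl a b) b-a≤c)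
    where
    b-a≤c : b - a ℚ.≤ c
    b-a≤c = x≤y+z⇒x-y≤z {b} {a} {c} b≤a+c
    0≤c : 0ℚ ℚ.≤ c
    0≤c = ℚ.≤-trans (x-y≥0 a≤b) b-a≤c

  no-pair : ∀ {n r d} {x : Vec ℕ r} → InBox n x → n < d → ¬ Pair d x
  no-pair b n<d (i , _ , _ , d∣ , _) with All.lookup⁺ b i
  ... | 1≤xᵢ , xᵢ≤n = >⇒∤ {{ℕ.>-nonZero 1≤xᵢ}} (ℕ.≤-<-trans xᵢ≤n n<d) d∣

  []≤indicated : ∀ {q P Q} → Indicates q P → (Q? : Dec Q) → (Q → P) → [ Q? ] ℚ.≤ q
  []≤indicated (inj₁ (_ , refl))  (yes _) f = ℚ.≤-refl
  []≤indicated (inj₁ (_ , refl))  (no  _) f = 0≤1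
  []≤indicated (inj₂ (¬p , _))    (yes q) f = ⊥-elim (¬p (f q))
  []≤indicated (inj₂ (_ , refl))  (no  _) f = ℚ.≤-refl

  indicated≤[]+ : ∀ {q P Q c} → Indicates q P → (Q? : Dec Q) → 0ℚ ℚ.≤ c → (P → ¬ Q → 1ℚ ℚ.≤ c) → q ℚ.≤ [ Q? ] + c
  indicated≤[]+ (inj₁ (_ , refl)) (yes _) 0≤c f = x≤x+y 1ℚ 0≤c
  indicated≤[]+ {c = c} (inj₁ (p , refl)) (no ¬q) 0≤c f = ℚ.≤-trans (f p ¬q) (ℚ.≤-reflexive (sym (ℚ.+-identityˡ c)))
  indicated≤[]+ (inj₂ (_ , refl)) Q?      0≤c f = 0≤+ (0≤[] Q?) 0≤c

  -- S is the set of the x satisfying the local condition P p at every prime p.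
  -- Beyond Z the local condition fails only if p divides two entries.
  module Sieve {r} {S : Vec ℕ r → Set} (S? : Decidable S) (P : ℕ → Vec ℕ r → Set)
    (f : ℕ → Vec ℕ r → ℚ) (m : ℕ → ℚ) (Z : ℕ)
    (f-indicates : ∀ p → Prime p → ∀ x → Indicates (f p x) (P p x))
    (f-span : ∀ p → Prime p → Span (OneOr p) (f p) (m p))
    (S⇒P : ∀ x → S x → ∀ p → Prime p → P p x)
    (P⇒S : ∀ n x → InBox n x → (∀ p → Prime p → P p x) → S x)
    (no-pair⇒P : ∀ p x → Prime p → Z < p → ¬ Pair p x → P p x)
    where

    sifted : ℕ → Vec ℕ r → ℚ
    sifted z x = ∏ᵖ z (λ p → f p x)

    sifted-lim : ∀ z → Lim (λ n → avg n (sifted z)) (∏ᵖ z m)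
    sifted-lim z = span-lim (λ n → avg-linear n r) avg-χᵛ-lim (span-∏ᵖ f-span z)

    0≤bigPairs : ∀ z n (x : Vec ℕ r) → 0ℚ ℚ.≤ bigPairs z n x
    0≤bigPairs z n x = ∑-nonNeg n (λ j _ → 0≤pairs (suc (z ℕ.+ j)) x)

    S≤sifted : ∀ z x → [ S? x ] ℚ.≤ sifted z x
    S≤sifted z x = []≤indicated (indicates-∏ᵖ (λ p pp → f-indicates p pp x) z) (S? x) (λ s p pp _ → S⇒P x s p pp)

    sifted≤S+bigPairs : ∀ z n x → Z ≤ z → InBox n x → sifted z x ℚ.≤ [ S? x ] + bigPairs z n x
    sifted≤S+bigPairs z n x Z≤z b = indicated≤[]+ (indicates-∏ᵖ (λ p pp → f-indicates p pp x) z) (S? x)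
      (0≤bigPairs z n x)
      (λ all ¬s → decidable-stable (1ℚ ℚ.≤? bigPairs z n x) (λ ¬1≤ → ¬s (P⇒S n x b (P-all all ¬1≤))))
      where
      P-all : (∀ p → Prime p → p ≤ z → P p x) → ¬ 1ℚ ℚ.≤ bigPairs z n x → ∀ p → Prime p → P p x
      P-all all ¬1≤ p pp = [ all p pp , large ]′ (ℕ.≤-<-connex p z)
        where
        large : z < p → P p x
        large z<p = no-pair⇒P p x pp (ℕ.≤-<-trans Z≤z z<p)
          ([ (λ j<n pr → ¬1≤ (∑-covers n {λ j → pairs (suc (z ℕ.+ j)) x} {λ j → Pair (suc (z ℕ.+ j)) x}
                (λ j → 0≤pairs (suc (z ℕ.+ j)) x) (λ j → 1≤pairs (suc (z ℕ.+ j)) x)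
                j j<n (subst (λ d → Pair d x) (sym p≡) pr)))
           , (λ n≤j → no-pair b (subst (n <_) p≡ (s≤s (ℕ.≤-trans n≤j (ℕ.m≤n+m j z)))))
           ]′ (ℕ.<-≤-connex j n))
          where
          j : ℕ
          j = p ℕ.∸ suc z
          p≡ : suc (z ℕ.+ j) ≡ p
          p≡ = ℕ.m+[n∸m]≡n z<p

    R : ℚ
    R = fromℕ r * fromℕ r + fromℕ r * fromℕ r

    0≤R : 0ℚ ℚ.≤ R
    0≤R = 0≤+ (0≤* (fromℕ-nonNeg r) (fromℕ-nonNeg r)) (0≤* (fromℕ-nonNeg r) (fromℕ-nonNeg r))

    sieve-error : ∀ z n → Z ≤ z → ∣ avg n {r} (λ x → [ S? x ]) - avg n (sifted z) ∣ ℚ.≤ R * w z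
    sieve-error z n Z≤z = ∣x∣≤-between (avg-mono n (λ x _ → S≤sifted z x)) (begin
      avg n (sifted z)
        ≤⟨ avg-mono n (λ x b → sifted≤S+bigPairs z n x Z≤z b) ⟩
      avg n {r} (λ x → [ S? x ] + bigPairs z n x)
        ≡⟨ Linear.+-homo (avg-linear n r) (λ x → [ S? x ]) (bigPairs z n) ⟩
      avg n {r} (λ x → [ S? x ]) + avg n {r} (bigPairs z n)
        ≤⟨ ℚ.+-monoʳ-≤ (avg n {r} (λ x → [ S? x ])) (avg-bigPairs n r z n) ⟩
      avg n {r} (λ x → [ S? x ]) + (fromℕ r * fromℕ r) * (w z + w z)
        ≡⟨ cong (λ t → avg n {r} (λ x → [ S? x ]) + t)
             (solve 2 (λ r w → r :* (w :+ w) := (r :+ r) :* w) refl (fromℕ r * fromℕ r) (w z)) ⟩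
      avg n {r} (λ x → [ S? x ]) + R * w z ∎)
      where open ℚ.≤-Reasoning

    density : ∀ (ℓ : ℕ → ℚ) →
      (∀ ε → 0ℚ ℚ.< ε → ∃[ K ] ∀ z → K ≤ z → ∃[ N ] ∀ k → N ≤ k → ∣ ∏ᵖ z m - ℓ k ∣ ℚ.≤ ε) →
      ∀ ε → 0ℚ ℚ.< ε → ∃[ K ] ∀ n → K ≤ n → ∃[ N ] ∀ k → N ≤ k → ∣ avg n (λ x → [ S? x ]) - ℓ k ∣ ℚ.≤ ε
    density ℓ close ε 0<ε = proj₁ near-m , λ n K≤n → proj₁ near-ℓ , λ k N≤k → begin
      ∣ avg n (λ x → [ S? x ]) - ℓ k ∣
        ≤⟨ triangle (avg n (λ x → [ S? x ])) (avg n (sifted z)) (ℓ k) ⟩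
      ∣ avg n (λ x → [ S? x ]) - avg n (sifted z) ∣ + ∣ avg n (sifted z) - ℓ k ∣
        ≤⟨ ℚ.+-mono-≤ (ℚ.≤-trans (sieve-error z n Z≤z) Rw≤) (triangle (avg n (sifted z)) (∏ᵖ z m) (ℓ k)) ⟩
      half ε + (∣ avg n (sifted z) - ∏ᵖ z m ∣ + ∣ ∏ᵖ z m - ℓ k ∣)
        ≤⟨ ℚ.+-monoʳ-≤ (half ε) (ℚ.+-mono-≤ (proj₂ near-m n K≤n) (proj₂ near-ℓ k N≤k)) ⟩
      half ε + (half (half ε) + half (half ε))
        ≡⟨ cong (λ t → half ε + t) (half+half (half ε)) ⟩
      half ε + half ε
        ≡⟨ half+half ε ⟩
      ε ∎
      where
      open ℚ.≤-Reasoning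
      0<ε/4 : 0ℚ ℚ.< half (half ε)
      0<ε/4 = half-pos (half-pos 0<ε)
      small : ∃[ N ] R * w N ℚ.≤ half ε
      small = archimedean 0≤R (half-pos 0<ε)
      cl : ∃[ K ] ∀ z → K ≤ z → ∃[ N ] ∀ k → N ≤ k → ∣ ∏ᵖ z m - ℓ k ∣ ℚ.≤ half (half ε)
      cl = close (half (half ε)) 0<ε/4
      z : ℕ
      z = Z ℕ.+ (proj₁ small ℕ.+ proj₁ cl)
      Z≤z : Z ≤ z
      Z≤z = ℕ.m≤m+n Z _
      Rw≤ : R * w z ℚ.≤ half ε
      Rw≤ = ℚ.≤-trans (ℚ.*-monoˡ-≤-nonNeg R {{ℚ.nonNegative 0≤R}}
        (w-anti (ℕ.≤-trans (ℕ.m≤m+n (proj₁ small) (proj₁ cl)) (ℕ.m≤n+m _ Z)))) (proj₂ small)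
      near-ℓ : ∃[ N ] ∀ k → N ≤ k → ∣ ∏ᵖ z m - ℓ k ∣ ℚ.≤ half (half ε)
      near-ℓ = proj₂ cl z (ℕ.≤-trans (ℕ.m≤n+m (proj₁ cl) (proj₁ small)) (ℕ.m≤n+m _ Z))
      near-m : ∃[ K ] ∀ n → K ≤ n → ∣ avg n (sifted z) - ∏ᵖ z m ∣ ℚ.≤ half (half ε)
      near-m = sifted-lim z .within (half (half ε)) 0<ε/4

open FundamentalSieve

module PrimeDivisors where
  open import Data.Nat.Divisibility using (_∣_; _∣0; ∣-trans; m∣m*n)
  open import Data.List.Relation.Unary.All using (All; []; _∷_)

  prime-divisor : ∀ {n} → n ≢ 0 → n ≢ 1 → ∃[ p ] Prime p × (p ∣ n)
  prime-divisor {n} n≢0 n≢1 = first (factors F) (isFactorisation F) (factorsPrime F)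
    where
    open PrimeFactorisation
    F : PrimeFactorisation n
    F = factorise n {{ℕ.≢-nonZero n≢0}}
    first : ∀ ps → n ≡ product ps → All Prime ps → ∃[ p ] Prime p × (p ∣ n)
    first []       n≡1 _        = ⊥-elim (n≢1 n≡1)
    first (p ∷ ps) n≡  (pp ∷ _) = p , pp , subst (p ∣_) (sym n≡) (m∣m*n (product ps))

  no-prime-divisor⇒≡1 : ∀ {n} → n ≢ 0 → (∀ p → Prime p → ¬ p ∣ n) → n ≡ 1
  no-prime-divisor⇒≡1 {n} n≢0 h = decidable-stable (n ℕ.≟ 1)
    (λ n≢1 → let (p , pp , p∣n) = prime-divisor n≢0 n≢1 in h p pp p∣n)

  gcd≡1 : ∀ {m n} → 0 < m → (∀ p → Prime p → ¬ ((p ∣ m) × (p ∣ n))) → gcd m n ≡ 1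
  gcd≡1 {m} {n} 0<m h = no-prime-divisor⇒≡1 (λ g≡0 → ℕ.<⇒≢ 0<m (sym (gcd[m,n]≡0⇒m≡0 g≡0)))
    (λ p pp p∣g → h p pp (∣-trans p∣g (gcd[m,n]∣m m n) , ∣-trans p∣g (gcd[m,n]∣n m n)))

  gcd≡1⇒ : ∀ {m n p} → gcd m n ≡ 1 → Prime p → p ∣ m → p ∣ n → ⊥
  gcd≡1⇒ {p = p} g≡1 pp p∣m p∣n = prime-∤-1 pp (subst (p ∣_) g≡1 (gcd-greatest p∣m p∣n))

  gcd-entries∣ : ∀ {r} (x : Vec ℕ r) i → gcd-entries x ∣ lookup x i
  gcd-entries∣ (x ∷ xs) zero    = gcd[m,n]∣m x (gcd-entries xs)
  gcd-entries∣ (x ∷ xs) (suc i) = ∣-trans (gcd[m,n]∣n x (gcd-entries xs)) (gcd-entries∣ xs i)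

  gcd-entries-greatest : ∀ {r d} (x : Vec ℕ r) → (∀ i → d ∣ lookup x i) → d ∣ gcd-entries x
  gcd-entries-greatest {d = d} [] h = d ∣0
  gcd-entries-greatest (x ∷ xs) h = gcd-greatest (h zero) (gcd-entries-greatest xs (h ∘ suc))

open PrimeDivisors

module LocalFactors where
  open ℚ-Lemmas
  open Reciprocal
  open import Data.Rational.Base using (_+_; _*_; _-_; -_)
  open import Data.Nat.Divisibility using (_∣_; _∣?_; ∣-trans; m∣m*n; n∣m*n)

  none allDiv : ∀ {r} → ℕ → Vec ℕ r → ℚ
  none   {zero}  p = λ _ → 1ℚ
  none   {suc r} p = branch p (λ _ → 0ℚ) (none p)
  allDiv {zero}  p = λ _ → 1ℚ
  allDiv {suc r} p = branch p (allDiv p) (λ _ → 0ℚ)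

  avoid atMost1 : ∀ {r} → ℕ → Vec ℕ r → Vec ℕ r → ℚ
  avoid   p []       = λ _ → 1ℚ
  avoid   p (a ∷ as) = branch p (pick (p ∣? a) (λ _ → 0ℚ) (avoid p as)) (avoid p as)
  atMost1 p []       = λ _ → 1ℚ
  atMost1 p (a ∷ as) = branch p (pick (p ∣? a) (λ _ → 0ℚ) (none p)) (atMost1 p as)

  notAll : ∀ {r} → ℕ → Vec ℕ r → Vec ℕ r → ℚ
  notAll p a = pick (p ∣? ∏-entries a) (avoid p a) (λ x → 1ℚ + - 1ℚ * allDiv p x)

  Avoid : ∀ {r} → ℕ → Vec ℕ r → Vec ℕ r → Set
  Avoid p a x = ∀ i → ¬ ((p ∣ lookup a i) × (p ∣ lookup x i))

  indicates-pick : ∀ {D P Q R u v} (D? : Dec D) → Indicates u P → Indicates v Q →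
    (D → (P → R) × (R → P)) → (¬ D → (Q → R) × (R → Q)) → Indicates (pick D? u v) R
  indicates-pick (yes d) u-ind v-ind h k = indicates-map (proj₁ (h d)) (proj₂ (h d)) u-ind
  indicates-pick (no ¬d) u-ind v-ind h k = indicates-map (proj₁ (k ¬d)) (proj₂ (k ¬d)) v-ind

  0-indicates-⊥ : Indicates 0ℚ ⊥
  0-indicates-⊥ = inj₂ ((λ ()) , refl)

  none-indicates : ∀ {r} p (x : Vec ℕ r) → Indicates (none p x) (∀ i → ¬ p ∣ lookup x i)
  none-indicates p []       = inj₁ ((λ ()) , refl)
  none-indicates p (x ∷ xs) = indicates-pick (p ∣? x) 0-indicates-⊥ (none-indicates p xs)
    (λ p∣x → (λ ()) , λ h → h zero p∣x)
    (λ p∤x → (λ h → λ { zero → p∤x ; (suc i) → h i }) , λ h → h ∘ suc)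

  allDiv-indicates : ∀ {r} p (x : Vec ℕ r) → Indicates (allDiv p x) (∀ i → p ∣ lookup x i)
  allDiv-indicates p []       = inj₁ ((λ ()) , refl)
  allDiv-indicates p (x ∷ xs) = indicates-pick (p ∣? x) (allDiv-indicates p xs) 0-indicates-⊥
    (λ p∣x → (λ h → λ { zero → p∣x ; (suc i) → h i }) , λ h → h ∘ suc)
    (λ p∤x → (λ ()) , λ h → p∤x (h zero))

  avoid-∷ : ∀ {p a x r} {as xs : Vec ℕ r} → ¬ ((p ∣ a) × (p ∣ x)) → Avoid p as xs → Avoid p (a ∷ as) (x ∷ xs)
  avoid-∷ h hs zero    = h
  avoid-∷ h hs (suc i) = hs i

  avoid-indicates : ∀ {r} p (a x : Vec ℕ r) → Indicates (avoid p a x) (Avoid p a x)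
  avoid-indicates p []       []       = inj₁ ((λ ()) , refl)
  avoid-indicates p (a ∷ as) (x ∷ xs) with p ∣? a
  ... | yes p∣a = indicates-pick (p ∣? x) 0-indicates-⊥ (avoid-indicates p as xs)
    (λ p∣x → (λ ()) , λ h → h zero (p∣a , p∣x))
    (λ p∤x → avoid-∷ (p∤x ∘ proj₂) , λ h → h ∘ suc)
  ... | no p∤a = indicates-pick (p ∣? x) (avoid-indicates p as xs) (avoid-indicates p as xs)
    (λ p∣x → avoid-∷ (p∤a ∘ proj₁) , λ h → h ∘ suc)
    (λ p∤x → avoid-∷ (p∤a ∘ proj₁) , λ h → h ∘ suc)

  Pair-∷ : ∀ {d x r} {xs : Vec ℕ r} → Pair d xs → Pair d (x ∷ xs)
  Pair-∷ (i , j , i≢j , d∣ , d∣′) = suc i , suc j , (λ e → i≢j (Fin.suc-injective e)) , d∣ , d∣′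

  Pair-tail : ∀ {d x r} {xs : Vec ℕ r} → ¬ d ∣ x → Pair d (x ∷ xs) → Pair d xs
  Pair-tail d∤x (zero  , _     , _ , d∣ , _)        = ⊥-elim (d∤x d∣)
  Pair-tail d∤x (suc i , zero  , _ , _ , d∣)        = ⊥-elim (d∤x d∣)
  Pair-tail d∤x (suc i , suc j , i≢j , d∣ , d∣′) = i , j , (λ e → i≢j (cong suc e)) , d∣ , d∣′

  atMost1-indicates : ∀ {r} p (a x : Vec ℕ r) → Indicates (atMost1 p a x) (Avoid p a x × ¬ Pair p x)
  atMost1-indicates p []       []       = inj₁ (((λ ()) , λ ()) , refl)
  atMost1-indicates p (a ∷ as) (x ∷ xs) with p ∣? a
  ... | yes p∣a = indicates-pick (p ∣? x) 0-indicates-⊥ (atMost1-indicates p as xs)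
    (λ p∣x → (λ ()) , λ h → proj₁ h zero (p∣a , p∣x))
    (λ p∤x → (λ (av , ¬pr) → avoid-∷ (p∤x ∘ proj₂) av , ¬pr ∘ Pair-tail p∤x) ,
             (λ (av , ¬pr) → av ∘ suc , ¬pr ∘ Pair-∷))
  ... | no p∤a = indicates-pick (p ∣? x) (none-indicates p xs) (atMost1-indicates p as xs)
    (λ p∣x → (λ h → avoid-∷ (p∤a ∘ proj₁) (λ i → h i ∘ proj₂) , lone h) ,
             (λ (av , ¬pr) i p∣xᵢ → ¬pr (zero , suc i , (λ ()) , p∣x , p∣xᵢ)))
    (λ p∤x → (λ (av , ¬pr) → avoid-∷ (p∤x ∘ proj₂) av , ¬pr ∘ Pair-tail p∤x) ,
             (λ (av , ¬pr) → av ∘ suc , ¬pr ∘ Pair-∷))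
    where
    lone : (∀ i → ¬ p ∣ lookup xs i) → ¬ Pair p (x ∷ xs)
    lone h (zero  , zero  , i≢j , _)          = i≢j refl
    lone h (zero  , suc j , _ , _ , p∣xⱼ)     = h j p∣xⱼ
    lone h (suc i , _     , _ , p∣xᵢ , _)     = h i p∣xᵢ

  lookup∣∏ : ∀ {r} (a : Vec ℕ r) i → lookup a i ∣ ∏-entries a
  lookup∣∏ (a ∷ as) zero    = m∣m*n (∏-entries as)
  lookup∣∏ (a ∷ as) (suc i) = ∣-trans (lookup∣∏ as i) (n∣m*n a)

  prime∣∏ : ∀ {r p} (a : Vec ℕ r) → Prime p → p ∣ ∏-entries a → ∃[ i ] p ∣ lookup a i
  prime∣∏ []       pp p∣1 = ⊥-elim (prime-∤-1 pp p∣1)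
  prime∣∏ (a ∷ as) pp p∣  with euclidsLemma a (∏-entries as) pp p∣
  ... | inj₁ p∣a  = zero , p∣a
  ... | inj₂ p∣as with prime∣∏ as pp p∣as
  ...   | i , p∣aᵢ = suc i , p∣aᵢ

  notAll-indicates : ∀ {r} p → Prime p → (a x : Vec ℕ r) →
    Indicates (notAll p a x) (Avoid p a x × ¬ (∀ i → p ∣ lookup x i))
  notAll-indicates p pp a x with p ∣? ∏-entries a
  ... | yes p∣A = indicates-map
    (λ av → av , λ all → let (i , p∣aᵢ) = prime∣∏ a pp p∣A in av i (p∣aᵢ , all i)) proj₁ (avoid-indicates p a x)
  ... | no  p∤A = complement (allDiv-indicates p x)
    where
    av : Avoid p a x
    av i (p∣aᵢ , _) = p∤A (∣-trans p∣aᵢ (lookup∣∏ a i))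
    complement : ∀ {q P} → Indicates q P → Indicates (1ℚ + - 1ℚ * q) (Avoid p a x × ¬ P)
    complement (inj₁ (p , refl))  = inj₂ ((λ h → proj₂ h p) , refl)
    complement (inj₂ (¬p , refl)) = inj₁ ((av , ¬p) , refl)

  span-none : ∀ p r → Span (OneOr p) (none {r} p) ((1ℚ - fromℕ p ⁻¹) ^ r)
  span-none p zero    = span-const 1ℚ
  span-none p (suc r) = ext (λ _ → refl)
    (solve 2 (λ v t → v :* con 0ℚ :+ (t :- v :* t) := (con 1ℚ :- v) :* t) refl (fromℕ p ⁻¹) ((1ℚ - fromℕ p ⁻¹) ^ r))
    (span-branch (span-const 0ℚ) (span-none p r))

  span-allDiv : ∀ p r → Span (OneOr p) (allDiv {r} p) ((fromℕ p ⁻¹) ^ r)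
  span-allDiv p zero    = span-const 1ℚ
  span-allDiv p (suc r) = ext (λ _ → refl)
    (solve 2 (λ v t → v :* t :+ (con 0ℚ :- v :* con 0ℚ) := v :* t) refl (fromℕ p ⁻¹) ((fromℕ p ⁻¹) ^ r))
    (span-branch (span-allDiv p r) (span-const 0ℚ))

  module AtPrime {p : ℕ} (pp : Prime p) where

    v y : ℚ
    v = fromℕ p ⁻¹
    y = 1ℚ - v

    Free : ∀ {r} → Vec ℕ r → Set
    Free a = ∀ i → ¬ p ∣ lookup a i

    branch-no : ∀ {a r f g h M} → ¬ p ∣ a → Span {suc r} (OneOr p) (branch p g h) M →
      Span (OneOr p) (branch p (pick (p ∣? a) f g) h) M
    branch-no {a} {h = h} p∤a = ext (λ x → cong (λ F → branch p F h x) (sym (pick-no (p ∣? a) p∤a))) refl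

    coprime-free : ∀ {a r} {as : Vec ℕ r} → PairwiseCoprime (a ∷ as) → p ∣ a → Free as
    coprime-free co p∣a i p∣aᵢ = prime-∤-1 pp (subst (p ∣_) (co zero (suc i) (λ ())) (gcd-greatest p∣a p∣aᵢ))

    coprime-tail : ∀ {a r} {as : Vec ℕ r} → PairwiseCoprime (a ∷ as) → PairwiseCoprime as
    coprime-tail co i j i≢j = co (suc i) (suc j) (λ e → i≢j (Fin.suc-injective e))

    span-avoid-free : ∀ {r} (a : Vec ℕ r) → Free a → Span (OneOr p) (avoid p a) 1ℚ
    span-avoid-free []       _  = span-const 1ℚ
    span-avoid-free (a ∷ as) fr = branch-no (fr zero)
      (ext (λ _ → refl) (solve 1 (λ v → v :* con 1ℚ :+ (con 1ℚ :- v :* con 1ℚ) := con 1ℚ) refl v)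
        (span-branch (span-avoid-free as (fr ∘ suc)) (span-avoid-free as (fr ∘ suc))))

    span-avoid : ∀ {r} (a : Vec ℕ r) → PairwiseCoprime a → p ∣ ∏-entries a → Span (OneOr p) (avoid p a) y
    span-avoid []       _  p∣1 = ⊥-elim (prime-∤-1 pp p∣1)
    span-avoid (a ∷ as) co p∣  = by-cases (p ∣? a)
      where
      by-cases : (D? : Dec (p ∣ a)) → Span (OneOr p) (branch p (pick D? (λ _ → 0ℚ) (avoid p as)) (avoid p as)) y
      by-cases (yes p∣a) = ext (λ _ → refl)
        (solve 1 (λ v → v :* con 0ℚ :+ (con 1ℚ :- v :* con 1ℚ) := con 1ℚ :- v) refl v)
        (span-branch (span-const 0ℚ) (span-avoid-free as (coprime-free co p∣a)))
      by-cases (no p∤a) = ext (λ _ → refl)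
        (solve 2 (λ v y → v :* y :+ (y :- v :* y) := y) refl v y)
        (span-branch rest rest)
        where
        rest : Span (OneOr p) (avoid p as) y
        rest = span-avoid as (coprime-tail co)
          ([ (λ p∣a → ⊥-elim (p∤a p∣a)) , id ]′ (euclidsLemma a (∏-entries as) pp p∣))

    span-atMost1-free : ∀ {r} (a : Vec ℕ r) → Free a → Span (OneOr p) (atMost1 p a) (eulerFactor r p)
    span-atMost1-free []           _  = ext (λ _ → refl)
      (solve 1 (λ v → con 1ℚ := con 1ℚ :+ con 0ℚ :* v :* con 1ℚ) refl v) (span-const 1ℚ)
    span-atMost1-free {suc r} (a ∷ as) fr = branch-no (fr zero)
      (ext (λ _ → refl) (mean as) (span-branch (span-none p r) (span-atMost1-free as (fr ∘ suc))))
      where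
      mean : ∀ {r} → Vec ℕ r → v * y ^ r + (eulerFactor r p - v * eulerFactor r p) ≡ eulerFactor (suc r) p
      mean [] = solve 1 (λ v → v :* con 1ℚ :+ ((con 1ℚ :+ con 0ℚ :* v :* con 1ℚ) :- v :* (con 1ℚ :+ con 0ℚ :* v :* con 1ℚ))
        := (con 1ℚ :- v) :* con 1ℚ :+ con 1ℚ :* v :* con 1ℚ) refl v
      mean {suc r} (_ ∷ _) = trans
        (solve 3 (λ v t f → v :* ((con 1ℚ :- v) :* t) :+
            (((con 1ℚ :- v) :* t :+ f :* v :* t) :- v :* ((con 1ℚ :- v) :* t :+ f :* v :* t))
          := (con 1ℚ :- v) :* ((con 1ℚ :- v) :* t) :+ (con 1ℚ :+ f) :* v :* ((con 1ℚ :- v) :* t)) refl v (y ^ r) (fromℕ (suc r)))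
        (cong (λ f → y * (y * y ^ r) + f * v * (y * y ^ r)) (sym (fromℕ-suc (suc r))))

    span-atMost1 : ∀ {r} (a : Vec ℕ (suc r)) → PairwiseCoprime a → p ∣ ∏-entries a →
      Span (OneOr p) (atMost1 p a) (y ^ suc r + fromℕ r * v * y ^ r)
    span-atMost1 {r} (a ∷ as) co p∣ = by-cases (p ∣? a)
      where
      mean : ∀ {r} → Vec ℕ r → v * 0ℚ + (eulerFactor r p - v * eulerFactor r p) ≡ y ^ suc r + fromℕ r * v * y ^ r
      mean [] = solve 1 (λ v →
          v :* con 0ℚ :+ ((con 1ℚ :+ con 0ℚ :* v :* con 1ℚ) :- v :* (con 1ℚ :+ con 0ℚ :* v :* con 1ℚ))
          := (con 1ℚ :- v) :* con 1ℚ :+ con 0ℚ :* v :* con 1ℚ)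
        refl v
      mean {suc r} (_ ∷ _) = solve 3 (λ v t f →
          v :* con 0ℚ :+ (((con 1ℚ :- v) :* t :+ f :* v :* t) :- v :* ((con 1ℚ :- v) :* t :+ f :* v :* t))
          := (con 1ℚ :- v) :* ((con 1ℚ :- v) :* t) :+ f :* v :* ((con 1ℚ :- v) :* t))
        refl v (y ^ r) (fromℕ (suc r))
      step : ∀ {r} (as : Vec ℕ r) → PairwiseCoprime as → p ∣ ∏-entries as →
        Span (OneOr p) (branch p (none p) (atMost1 p as)) (y ^ suc r + fromℕ r * v * y ^ r)
      step []                 _  p∣1 = ⊥-elim (prime-∤-1 pp p∣1)
      step {suc r} as@(_ ∷ _) co p∣  = ext (λ _ → refl)
        (trans
          (solve 3 (λ v t f →
              v :* ((con 1ℚ :- v) :* t) :+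
              (((con 1ℚ :- v) :* t :+ f :* v :* t) :- v :* ((con 1ℚ :- v) :* t :+ f :* v :* t))
              := (con 1ℚ :- v) :* ((con 1ℚ :- v) :* t) :+ (con 1ℚ :+ f) :* v :* ((con 1ℚ :- v) :* t))
            refl v (y ^ r) (fromℕ r))
          (cong (λ f → y * (y * y ^ r) + f * v * (y * y ^ r)) (sym (fromℕ-suc r))))
        (span-branch (span-none p (suc r)) (span-atMost1 as co p∣))
      by-cases : (D? : Dec (p ∣ a)) →
        Span (OneOr p) (branch p (pick D? (λ _ → 0ℚ) (none p)) (atMost1 p as)) (y ^ suc r + fromℕ r * v * y ^ r)
      by-cases (yes p∣a) = ext (λ _ → refl) (mean as)
        (span-branch (span-const 0ℚ) (span-atMost1-free as (coprime-free co p∣a)))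
      by-cases (no p∤a) = step as (coprime-tail co)
        ([ (λ p∣a → ⊥-elim (p∤a p∣a)) , id ]′ (euclidsLemma a (∏-entries as) pp p∣))

open LocalFactors

module LocalDensities where
  open ℚ-Lemmas
  open Series-Lemmas
  open Reciprocal
  open import Data.Rational.Base using (_+_; _*_; _-_; -_)
  open import Data.Nat.Divisibility using (_∣_; _∣?_; ∣-trans; >⇒∤)

  prodOver-filter-∷ʳ : ∀ {Q : ℕ → Set} (Q? : Decidable Q) ks k f →
    prodOver (List.filter Q? (ks List.∷ʳ k)) f ≡ prodOver (List.filter Q? ks) f * pick (Q? k) (f k) 1ℚ
  prodOver-filter-∷ʳ Q? ks k f = trans
    (cong (λ l → prodOver l f) (List.filter-++ Q? ks (k ∷ [])))
    (last (List.filter Q? ks))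
    where
    last : ∀ l → prodOver (l List.++ List.filter Q? (k ∷ [])) f ≡ prodOver l f * pick (Q? k) (f k) 1ℚ
    last l with Q? k
    ... | yes _ = prodOver-∷ʳ l k f
    ... | no  _ = trans (cong (λ l → prodOver l f) (List.++-identityʳ l)) (sym (ℚ.*-identityʳ (prodOver l f)))

  prodOver-filter-upTo : ∀ {Q : ℕ → Set} (Q? : Decidable Q) (f g : ℕ → ℚ) →
    (∀ k → pick (Q? k) (f k) 1ℚ ≡ pick (prime? k) (g k) 1ℚ) →
    ∀ z → prodOver (List.filter Q? (List.upTo (suc z))) f ≡ ∏ᵖ z g
  prodOver-filter-upTo Q? f g eq zero    = trans (prodOver-filter-∷ʳ Q? [] 0 f)
    (trans (ℚ.*-identityˡ (pick (Q? 0) (f 0) 1ℚ)) (trans (eq 0) (pick-no (prime? 0) {g 0} {1ℚ} ¬prime[0])))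
  prodOver-filter-upTo Q? f g eq (suc z) = trans
    (cong (λ l → prodOver (List.filter Q? l) f) (sym (List.upTo-∷ʳ (suc z))))
    (trans (prodOver-filter-∷ʳ Q? (List.upTo (suc z)) (suc z) f)
      (cong₂ _*_ (prodOver-filter-upTo Q? f g eq z) (eq (suc z))))

  prodOver-primesUpTo : ∀ z f → prodOver (primesUpTo z) f ≡ ∏ᵖ z f
  prodOver-primesUpTo z f = prodOver-filter-upTo prime? f f (λ _ → refl) z

  ∏ᵖ-cong : ∀ z {f g} → (∀ p → Prime p → f p ≡ g p) → ∏ᵖ z f ≡ ∏ᵖ z g
  ∏ᵖ-cong zero    eq = refl
  ∏ᵖ-cong (suc z) {f} {g} eq = cong₂ _*_ (∏ᵖ-cong z eq) (factor (prime? (suc z)))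
    where
    factor : (P? : Dec (Prime (suc z))) → pick P? (f (suc z)) 1ℚ ≡ pick P? (g (suc z)) 1ℚ
    factor (yes pp) = eq (suc z) pp
    factor (no _)   = refl

  ∏ᵖ-* : ∀ z f g → ∏ᵖ z (λ p → f p * g p) ≡ ∏ᵖ z f * ∏ᵖ z g
  ∏ᵖ-* zero    f g = refl
  ∏ᵖ-* (suc z) f g = trans (cong₂ _*_ (∏ᵖ-* z f g) (factor (prime? (suc z))))
    (*-interchange (∏ᵖ z f) (∏ᵖ z g) (pick (prime? (suc z)) (f (suc z)) 1ℚ) (pick (prime? (suc z)) (g (suc z)) 1ℚ))
    where
    factor : (P? : Dec (Prime (suc z))) →
      pick P? (f (suc z) * g (suc z)) 1ℚ ≡ pick P? (f (suc z)) 1ℚ * pick P? (g (suc z)) 1ℚ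
    factor (yes _) = refl
    factor (no  _) = refl

  ∏ᵖ-pos : ∀ z {f} → (∀ p → Prime p → 0ℚ ℚ.< f p) → 0ℚ ℚ.< ∏ᵖ z f
  ∏ᵖ-pos zero    h = 0<1
  ∏ᵖ-pos (suc z) {f} h = 0<* (∏ᵖ-pos z h) (factor (prime? (suc z)))
    where
    factor : (P? : Dec (Prime (suc z))) → 0ℚ ℚ.< pick P? (f (suc z)) 1ℚ
    factor (yes pp) = h (suc z) pp
    factor (no _)   = 0<1

  ∏ᵖ-≥ : ∀ {A z} f → A ≤ z → (∀ p → A < p → f p ≡ 1ℚ) → ∏ᵖ z f ≡ ∏ᵖ A f
  ∏ᵖ-≥ {A} {z} f A≤z h = subst (λ k → ∏ᵖ k f ≡ ∏ᵖ A f) (ℕ.m∸n+n≡m A≤z) (go (z ℕ.∸ A))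
    where
    factor : ∀ k → (P? : Dec (Prime (suc (k ℕ.+ A)))) → pick P? (f (suc (k ℕ.+ A))) 1ℚ ≡ 1ℚ
    factor k (yes _) = h (suc (k ℕ.+ A)) (s≤s (ℕ.m≤n+m A k))
    factor k (no _)  = refl
    go : ∀ k → ∏ᵖ (k ℕ.+ A) f ≡ ∏ᵖ A f
    go zero    = refl
    go (suc k) = trans (cong₂ _*_ (go k) (factor k (prime? (suc (k ℕ.+ A))))) (ℚ.*-identityʳ (∏ᵖ A f))

  ∏ᵖ-divisors : ∀ {A z} f → 0 < A → A ≤ z → ∏ᵖ z (λ p → pick (p ∣? A) (f p) 1ℚ) ≡ prodOver (primeDivisors A) f
  ∏ᵖ-divisors {A} f 0<A A≤z = trans
    (∏ᵖ-≥ (λ p → pick (p ∣? A) (f p) 1ℚ) A≤z (λ p A<p → pick-no (p ∣? A) (>⇒∤ {{ℕ.>-nonZero 0<A}} A<p)))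
    (sym (prodOver-filter-upTo (λ p → prime? p ×-dec p ∣? A) f (λ p → pick (p ∣? A) (f p) 1ℚ)
      (λ k → pick-× (prime? k) (k ∣? A)) A))
    where
    pick-× : ∀ {P Q : Set} {u v : ℚ} (P? : Dec P) (Q? : Dec Q) → pick (P? ×-dec Q?) u v ≡ pick P? (pick Q? u v) v
    pick-× (yes _) (yes _) = refl
    pick-× (yes _) (no  _) = refl
    pick-× (no  _) (yes _) = refl
    pick-× (no  _) (no  _) = refl

  ⁻¹-^ : ∀ x r → (x ^ r) ⁻¹ ≡ (x ⁻¹) ^ r
  ⁻¹-^ x zero    = refl
  ⁻¹-^ x (suc r) = trans (⁻¹-* x (x ^ r)) (cong (x ⁻¹ *_) (⁻¹-^ x r))

  w^<1 : ∀ n r → 0 < n → 0 < r → w n ^ r ℚ.< 1ℚ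
  w^<1 n (suc r) 0<n _ = ℚ.≤-<-trans
    (ℚ.≤-trans (ℚ.*-monoˡ-≤-nonNeg (w n) {{ℚ.nonNegative (0≤w n)}} (w^≤1 n r)) (ℚ.≤-reflexive (ℚ.*-identityʳ (w n))))
    (ℚ.≤-<-trans (w-anti 0<n) (ℚ.*<* (ℤ.+<+ (s≤s (s≤s z≤n)))))

  jordanFactor : ℕ → ℕ → ℚ
  jordanFactor r p = 1ℚ - (fromℕ p ^ r) ⁻¹

  jordanFactor-pos : ∀ r p → Prime p → 0 < r → 0ℚ ℚ.< jordanFactor r p
  jordanFactor-pos r zero          pp _   = ⊥-elim (¬prime[0] pp)
  jordanFactor-pos r (suc zero)    pp _   = ⊥-elim (¬prime[1] pp)
  jordanFactor-pos r (suc (suc n)) pp 0<r = subst (λ t → 0ℚ ℚ.< 1ℚ - t) (sym (^-⁻¹ (suc n) r))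
    (subst (ℚ._< 1ℚ - w (suc n) ^ r) (ℚ.+-inverseʳ (w (suc n) ^ r))
      (ℚ.+-monoˡ-< (- (w (suc n) ^ r)) (w^<1 (suc n) r (s≤s z≤n) 0<r)))

  module Densities {r′} (a : Vec ℕ (suc (suc r′))) (a>0 : ∀ i → 0 < lookup a i) (co : PairwiseCoprime a) where

    r A : ℕ
    r = suc (suc r′)
    A = ∏-entries a

    0<∏ : ∀ {r} (a : Vec ℕ r) → (∀ i → 0 < lookup a i) → 0 < ∏-entries a
    0<∏ []       h = s≤s z≤n
    0<∏ (a ∷ as) h = ℕ.*-mono-≤ (h zero) (0<∏ as (h ∘ suc))

    0<A : 0 < A
    0<A = 0<∏ a a>0

    fA≢0 : fromℕ A ≢ 0ℚ
    fA≢0 = pos⇒≢0 (ℚ.<-≤-trans 0<1 (fromℕ-mono 0<A))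

    meanPC meanC : ℕ → ℚ
    meanPC p = let v = fromℕ p ⁻¹; y = 1ℚ - v in
      pick (p ∣? A) (y ^ suc (suc r′) + fromℕ (suc r′) * v * y ^ suc r′) (eulerFactor r p)
    meanC p = pick (p ∣? A) (1ℚ - fromℕ p ⁻¹) (1ℚ + - 1ℚ * (fromℕ p ⁻¹) ^ r)

    span-PC : ∀ p → Prime p → Span (OneOr p) (atMost1 p a) (meanPC p)
    span-PC p pp = by-cases (p ∣? A)
      where
      by-cases : (D? : Dec (p ∣ A)) → Span (OneOr p) (atMost1 p a) (pick D? _ _)
      by-cases (yes p∣A) = AtPrime.span-atMost1 pp a co p∣A
      by-cases (no  p∤A) = AtPrime.span-atMost1-free pp a (λ i p∣aᵢ → p∤A (∣-trans p∣aᵢ (lookup∣∏ a i)))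

    span-C : ∀ p → Prime p → Span (OneOr p) (notAll p a) (meanC p)
    span-C p pp = by-cases (p ∣? A)
      where
      by-cases : (D? : Dec (p ∣ A)) →
        Span (OneOr p) (pick D? (avoid p a) (λ x → 1ℚ + - 1ℚ * allDiv p x)) (pick D? _ _)
      by-cases (yes p∣A) = AtPrime.span-avoid pp a co p∣A
      by-cases (no  _)   = add (span-const 1ℚ) (scale (- 1ℚ) (span-allDiv p r))

    psiFactor : ℕ → ℕ → ℚ
    psiFactor s p = 1ℚ + fromℕ s ÷₀ fromℕ p

    ratio : ∀ {M E P Q} → P ≢ 0ℚ → M * P ≡ E * Q → M ≡ E * (Q * P ⁻¹)
    ratio {M} {E} {P} {Q} P≢0 eq = begin-equality
      M                 ≡⟨ ℚ.*-identityʳ M ⟨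
      M * 1ℚ            ≡⟨ cong (M *_) (⁻¹-inverse P P≢0) ⟨
      M * (P * P ⁻¹)    ≡⟨ ℚ.*-assoc M P (P ⁻¹) ⟨
      M * P * P ⁻¹      ≡⟨ cong (_* P ⁻¹) eq ⟩
      E * Q * P ⁻¹      ≡⟨ ℚ.*-assoc E Q (P ⁻¹) ⟩
      E * (Q * P ⁻¹)    ∎
      where open ℚ.≤-Reasoning

    ∏ᵖ-ratio : ∀ {M E P Q : ℕ → ℚ} → (∀ p → Prime p → 0ℚ ℚ.< P p) →
      (∀ p → M p * pick (p ∣? A) (P p) 1ℚ ≡ E p * pick (p ∣? A) (Q p) 1ℚ) →
      ∀ z → A ≤ z → ∏ᵖ z M ≡ ∏ᵖ z E * (prodOver (primeDivisors A) Q * prodOver (primeDivisors A) P ⁻¹)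
    ∏ᵖ-ratio {M} {E} {P} {Q} 0<P eq z A≤z = ratio {∏ᵖ z M} {∏ᵖ z E} {prodOver (primeDivisors A) P} {prodOver (primeDivisors A) Q} (pos⇒≢0 0<∏P) (begin-equality
      ∏ᵖ z M * prodOver (primeDivisors A) P           ≡⟨ cong (∏ᵖ z M *_) (∏ᵖ-divisors P 0<A A≤z) ⟨
      ∏ᵖ z M * ∏ᵖ z (λ p → pick (p ∣? A) (P p) 1ℚ)    ≡⟨ ∏ᵖ-* z M (λ p → pick (p ∣? A) (P p) 1ℚ) ⟨
      ∏ᵖ z (λ p → M p * pick (p ∣? A) (P p) 1ℚ)       ≡⟨ ∏ᵖ-cong z (λ p _ → eq p) ⟩
      ∏ᵖ z (λ p → E p * pick (p ∣? A) (Q p) 1ℚ)       ≡⟨ ∏ᵖ-* z E (λ p → pick (p ∣? A) (Q p) 1ℚ) ⟩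
      ∏ᵖ z E * ∏ᵖ z (λ p → pick (p ∣? A) (Q p) 1ℚ)    ≡⟨ cong (∏ᵖ z E *_) (∏ᵖ-divisors Q 0<A A≤z) ⟩
      ∏ᵖ z E * prodOver (primeDivisors A) Q           ∎)
      where
      open ℚ.≤-Reasoning
      0<pick : ∀ p → Prime p → (D? : Dec (p ∣ A)) → 0ℚ ℚ.< pick D? (P p) 1ℚ
      0<pick p pp (yes _) = 0<P p pp
      0<pick p pp (no _)  = 0<1
      0<∏P : 0ℚ ℚ.< prodOver (primeDivisors A) P
      0<∏P = subst (0ℚ ℚ.<_) (∏ᵖ-divisors P 0<A ℕ.≤-refl) (∏ᵖ-pos A (λ p pp → 0<pick p pp (p ∣? A)))

    ∏-meanPC : ∀ z → A ≤ z → ∏ᵖ z meanPC ≡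
      T-seq r z * (Ψ (+ r′) A ÷₀ Ψ (+ suc r′) A)
    ∏-meanPC z A≤z = trans
      (∏ᵖ-ratio {meanPC} {eulerFactor r} {psiFactor (suc r′)} {psiFactor r′} psi-pos
        (λ p → local (fromℕ p ⁻¹) (p ∣? A)) z A≤z)
      (cong₂ _*_ (sym (prodOver-primesUpTo z (eulerFactor r))) (sym (reduce fA≢0)))
      where
      psi-pos : ∀ p → Prime p → 0ℚ ℚ.< psiFactor (suc r′) p
      psi-pos p _ = ℚ.+-mono-<-≤ 0<1 (0≤* (fromℕ-nonNeg (suc r′)) (0≤fromℕ⁻¹ p))
      local : ∀ v {D : Set} (D? : Dec D) → let y = 1ℚ - v in
        pick D? (y ^ r + fromℕ (suc r′) * v * y ^ suc r′) (y ^ r + fromℕ r * v * y ^ suc r′) * pick D? (1ℚ + fromℕ (suc r′) * v) 1ℚ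
        ≡ (y ^ r + fromℕ r * v * y ^ suc r′) * pick D? (1ℚ + fromℕ r′ * v) 1ℚ
      local v (no _)  = refl
      local v (yes _) = identity (fromℕ r′) (fromℕ-suc r′) (fromℕ-suc (suc r′))
        where
        identity : ∀ f {g h} → g ≡ 1ℚ + f → h ≡ 1ℚ + g → let y = 1ℚ - v in
          (y ^ r + g * v * y ^ suc r′) * (1ℚ + g * v) ≡ (y ^ r + h * v * y ^ suc r′) * (1ℚ + f * v)
        identity f refl refl = solve 3 (λ v f t → let y = con 1ℚ :- v in
            (y :* (y :* t) :+ (con 1ℚ :+ f) :* v :* (y :* t)) :* (con 1ℚ :+ (con 1ℚ :+ f) :* v)
            := (y :* (y :* t) :+ (con 1ℚ :+ (con 1ℚ :+ f)) :* v :* (y :* t)) :* (con 1ℚ :+ f :* v))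
          refl v f ((1ℚ - v) ^ r′)
      reduce : ∀ {x P Q} → x ≢ 0ℚ → (x * Q) ÷₀ (x * P) ≡ Q * P ⁻¹
      reduce {x} {P} {Q} x≢0 = trans (cong (x * Q *_) (⁻¹-* x P))
        (trans (solve 4 (λ x i Q p → (x :* Q) :* (i :* p) := (x :* i) :* (Q :* p)) refl x (x ⁻¹) Q (P ⁻¹))
          (trans (cong (_* (Q * P ⁻¹)) (⁻¹-inverse x x≢0)) (ℚ.*-identityˡ (Q * P ⁻¹))))

    ∏-meanC : ∀ z → A ≤ z → ∏ᵖ z meanC ≡
      ∏ᵖ z (jordanFactor r) * (φ A ÷₀ jordan r A * fromℕ A ^ suc r′)
    ∏-meanC z A≤z = trans
      (∏ᵖ-ratio {meanC} {jordanFactor r} {jordanFactor r} {jordanFactor 1} (λ p pp → jordanFactor-pos r p pp (s≤s z≤n))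
        (λ p → local p (p ∣? A)) z A≤z)
      (cong (∏ᵖ z (jordanFactor r) *_) (sym (reduce fA≢0)))
      where
      local : ∀ p {D : Set} (D? : Dec D) →
        pick D? (1ℚ - fromℕ p ⁻¹) (1ℚ + - 1ℚ * (fromℕ p ⁻¹) ^ r) * pick D? (jordanFactor r p) 1ℚ
        ≡ jordanFactor r p * pick D? (jordanFactor 1 p) 1ℚ
      local p (yes _) = trans (ℚ.*-comm (1ℚ - fromℕ p ⁻¹) (jordanFactor r p))
        (cong (λ t → jordanFactor r p * (1ℚ - t ⁻¹)) (sym (ℚ.*-identityʳ (fromℕ p))))
      local p (no _)  = cong (_* 1ℚ) (trans
        (solve 1 (λ t → con 1ℚ :+ con (- 1ℚ) :* t := con 1ℚ :- t) refl ((fromℕ p ⁻¹) ^ r))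
        (cong (λ t → 1ℚ - t) (sym (⁻¹-^ (fromℕ p) r))))
      reduce : ∀ {x P Q} → x ≢ 0ℚ → (x ^ 1 * Q) ÷₀ (x ^ r * P) * x ^ suc r′ ≡ Q * P ⁻¹
      reduce {x} {P} {Q} x≢0 = trans
        (cong (λ t → x ^ 1 * Q * t * x ^ suc r′) (trans (⁻¹-* (x ^ r) P) (cong (_* P ⁻¹) (⁻¹-* x (x ^ suc r′)))))
        (trans (solve 6 (λ x i Q p y j → (x :* con 1ℚ :* Q) :* ((i :* j) :* p) :* y := (x :* i) :* (y :* j) :* (Q :* p)) refl
            x (x ⁻¹) Q (P ⁻¹) (x ^ suc r′) ((x ^ suc r′) ⁻¹))
          (trans (cong₂ (λ s t → s * t * (Q * P ⁻¹)) (⁻¹-inverse x x≢0) (x^≢0 (suc r′)))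
            (ℚ.*-identityˡ (Q * P ⁻¹))))
        where
        x^≢0 : ∀ n → x ^ n * (x ^ n) ⁻¹ ≡ 1ℚ
        x^≢0 zero    = refl
        x^≢0 (suc n) = trans (cong (x * x ^ n *_) (⁻¹-* x (x ^ n)))
          (trans (*-interchange x (x ^ n) (x ⁻¹) ((x ^ n) ⁻¹))
            (cong₂ _*_ (⁻¹-inverse x x≢0) (x^≢0 n)))

open LocalDensities

module ZetaProduct where
  open ℚ-Lemmas
  open Series-Lemmas
  open import Data.Rational.Base using (_+_; _*_; _-_; -_; ∣_∣)
  open import Data.Nat.Divisibility using (_∣_; _∣?_; ∣⇒≤)

  ^-distrib-* : ∀ x y s → (x * y) ^ s ≡ x ^ s * y ^ s
  ^-distrib-* x y zero    = refl
  ^-distrib-* x y (suc s) = trans (cong (x * y *_) (^-distrib-* x y s))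
    (*-interchange x y (x ^ s) (y ^ s))

  module EulerProduct (s : ℕ) (2≤s : 2 ≤ s) where

    h : ℕ → ℚ
    h d = (fromℕ d ^ s) ⁻¹

    h-1 : h 1 ≡ 1ℚ
    h-1 = trans (^-⁻¹ 0 s) (1^ s)
      where
      1^ : ∀ s → w 0 ^ s ≡ 1ℚ
      1^ zero    = refl
      1^ (suc s) = trans (ℚ.*-identityˡ (w 0 ^ s)) (1^ s)

    h-* : ∀ m n → h (m ℕ.* n) ≡ h m * h n
    h-* m n = trans (cong (λ t → (t ^ s) ⁻¹) (fromℕ-* m n))
      (trans (cong _⁻¹ (^-distrib-* (fromℕ m) (fromℕ n) s)) (⁻¹-* (fromℕ m ^ s) (fromℕ n ^ s)))

    0≤h : ∀ n → 0ℚ ℚ.≤ h (suc n)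
    0≤h n = term-nonNeg s n

    h≤1 : ∀ n → h (suc n) ℚ.≤ 1ℚ
    h≤1 n = subst (ℚ._≤ 1ℚ) (sym (^-⁻¹ n s)) (w^≤1 n s)

    ζₙ : ℕ → ℚ
    ζₙ n = ∑ n (λ k → h (suc k))

    ζ-seq≡ζₙ : ∀ n → ζ-seq s n ≡ ζₙ n
    ζ-seq≡ζₙ zero    = refl
    ζ-seq≡ζₙ (suc n) = trans (cong (λ ks → sumOver ks (λ k → h (suc k))) (sym (List.upTo-∷ʳ n)))
      (trans (sumOver-∷ʳ (upTo n) n (λ k → h (suc k))) (cong (λ t → t + h (suc n)) (ζ-seq≡ζₙ n)))

    ζₙ-cauchy : ∀ ε → 0ℚ ℚ.< ε → ∃[ N ] ∀ m n → N ≤ m → N ≤ n → ∣ ζₙ m - ζₙ n ∣ ℚ.≤ ε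
    ζₙ-cauchy ε 0<ε = proj₁ c , λ m n N≤m N≤n →
      subst₂ (λ x y → ∣ x - y ∣ ℚ.≤ ε) (ζ-seq≡ζₙ m) (ζ-seq≡ζₙ n) (proj₂ c m n N≤m N≤n)
      where
      c : ∃[ N ] ∀ m n → N ≤ m → N ≤ n → ∣ ζ-seq s m - ζ-seq s n ∣ ℚ.≤ ε
      c = ζ-cauchy s 2≤s ε 0<ε

    1≤ζₙ : ∀ n → 1ℚ ℚ.≤ ζₙ (suc n)
    1≤ζₙ zero    = ℚ.≤-reflexive (sym (trans (ℚ.+-identityˡ (h 1)) h-1))
    1≤ζₙ (suc n) = 1≤+ˡ (1≤ζₙ n) (0≤h (suc n))

    0<ζₙ : ∀ n → 0ℚ ℚ.< ζₙ (suc n)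
    0<ζₙ n = ℚ.<-≤-trans 0<1 (1≤ζₙ n)

    0≤ζₙ⁻¹ : ∀ n → 0ℚ ℚ.≤ ζₙ (suc n) ⁻¹
    0≤ζₙ⁻¹ n = ℚ.<⇒≤ (⁻¹-pos (0<ζₙ n))

    ζₙ⁻¹≤1 : ∀ n → ζₙ (suc n) ⁻¹ ℚ.≤ 1ℚ
    ζₙ⁻¹≤1 n = ⁻¹-anti 1ℚ (ζₙ (suc n)) 0<1 (1≤ζₙ n)

    open Multiplicative h h-1 h-*

    ∑h W : ℕ → (Vec ℕ 1 → ℚ) → ℚ
    ∑h n f = ∑ n (λ k → h (suc k) * f (suc k ∷ []))
    W n f = ζₙ n ⁻¹ * ∑h n f

    W-linear : ∀ n → Linear (W n)
    W-linear n = record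
      { ≗-cong = λ eq → cong (ζₙ n ⁻¹ *_) (∑-cong n (λ k _ → cong (h (suc k) *_) (eq (suc k ∷ []))))
      ; +-homo = λ f g → trans (cong (ζₙ n ⁻¹ *_) (trans
          (∑-cong n (λ k _ → ℚ.*-distribˡ-+ (h (suc k)) (f (suc k ∷ [])) (g (suc k ∷ []))))
          (∑-+ n (λ k → h (suc k) * f (suc k ∷ [])) (λ k → h (suc k) * g (suc k ∷ [])))))
          (ℚ.*-distribˡ-+ (ζₙ n ⁻¹) (∑h n f) (∑h n g))
      ; *-homo = λ c f → trans (cong (ζₙ n ⁻¹ *_) (trans
          (∑-cong n (λ k _ → *-leftSwap (h (suc k)) c (f (suc k ∷ []))))
          (∑-*ˡ n c (λ k → h (suc k) * f (suc k ∷ [])))))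
          (*-leftSwap (ζₙ n ⁻¹) c (∑h n f))
      }

    scaled-diff : ∀ {i z z′ d e} → 0ℚ ℚ.≤ i → i ℚ.≤ 1ℚ → 0ℚ ℚ.≤ d → d ℚ.≤ 1ℚ → i * z ≡ 1ℚ →
      ∣ z′ - z ∣ ℚ.≤ e → ∣ i * (z′ * d) - d * 1ℚ ∣ ℚ.≤ e
    scaled-diff {i} {z} {z′} {d} {e} 0≤i i≤1 0≤d d≤1 iz≡1 h = begin
      ∣ i * (z′ * d) - d * 1ℚ ∣       ≡⟨ cong (λ t → ∣ i * (z′ * d) - d * t ∣) iz≡1 ⟨
      ∣ i * (z′ * d) - d * (i * z) ∣  ≡⟨ cong ∣_∣ (solve 4 (λ i z z′ d → i :* (z′ :* d) :- d :* (i :* z) := (i :* d) :* (z′ :- z)) refl i z z′ d) ⟩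
      ∣ (i * d) * (z′ - z) ∣          ≡⟨ ℚ.∣p*q∣≡∣p∣*∣q∣ (i * d) (z′ - z) ⟩
      ∣ i * d ∣ * ∣ z′ - z ∣          ≡⟨ cong (_* ∣ z′ - z ∣) (ℚ.0≤p⇒∣p∣≡p (0≤* 0≤i 0≤d)) ⟩
      (i * d) * ∣ z′ - z ∣            ≤⟨ *-mono (0≤* 0≤i 0≤d) (*-mono 0≤i i≤1 0≤d d≤1) (ℚ.0≤∣p∣ (z′ - z)) h ⟩
      (1ℚ * 1ℚ) * e                   ≡⟨ ℚ.*-identityˡ e ⟩
      e                               ∎
      where open ℚ.≤-Reasoning

    W-χᵛ-lim : ∀ {z e} → Smooth z e → Lim (λ n → W n (χᵛ e)) (μ e)
    W-χᵛ-lim {e = suc d′ ∷ []} ((s≤s z≤n , _) ∷ []) .within ε 0<ε = suc N ℕ.* d , bound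
      where
      d N : ℕ
      d = suc d′
      N = proj₁ (ζₙ-cauchy ε 0<ε)
      big : ∀ {n c t} → suc N ℕ.* d ≤ n → n ≡ t ℕ.+ c ℕ.* d → t < d → N ≤ c
      big {n} {c} {t} le n≡ t<d = ℕ.≤-pred (ℕ.<⇒≤ (ℕ.*-cancelʳ-< d (suc N) (suc c)
        (ℕ.≤-<-trans le (subst (_< suc c ℕ.* d) (sym n≡) (ℕ.+-monoˡ-< (c ℕ.* d) t<d)))))
      near : ∀ m → suc N ℕ.* d ≤ suc m →
        ∃[ c ] ∃[ t ] suc m ≡ t ℕ.+ c ℕ.* d × t < d ×
          ∑ (suc m) (λ k → χ d (suc k) * h (suc k)) ≡ ∑ c (λ j → h (suc j ℕ.* d)) →
        ∣ W (suc m) (χᵛ (d ∷ [])) - h d * 1ℚ ∣ ℚ.≤ ε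
      near m le (c , t , n≡ , t<d , eq) = subst (λ u → ∣ ζₙ (suc m) ⁻¹ * u - h d * 1ℚ ∣ ℚ.≤ ε)
        (sym (trans (∑-cong (suc m) (λ k _ → commute (h (suc k)) (χ d (suc k))))
          (trans eq (trans (∑-cong c (λ j _ → h-* (suc j) d)) (∑-*ʳ c (h d) (λ j → h (suc j)))))))
        (scaled-diff {ζₙ (suc m) ⁻¹} {ζₙ (suc m)} {ζₙ c} {h d} (0≤ζₙ⁻¹ m) (ζₙ⁻¹≤1 m) (0≤h d′) (h≤1 d′)
          (trans (ℚ.*-comm (ζₙ (suc m) ⁻¹) (ζₙ (suc m))) (⁻¹-inverse (ζₙ (suc m)) (pos⇒≢0 (0<ζₙ m))))
          (proj₂ (ζₙ-cauchy ε 0<ε) c (suc m) (big le n≡ t<d)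
            (ℕ.≤-trans (ℕ.≤-trans (ℕ.n≤1+n N) (ℕ.m≤m*n (suc N) d)) le)))
        where
        commute : ∀ a b → a * (b * 1ℚ) ≡ b * a
        commute = solve 2 (λ a b → a :* (b :* con 1ℚ) := b :* a) refl
      bound : ∀ n → suc N ℕ.* d ≤ n → ∣ W n (χᵛ (d ∷ [])) - h d * 1ℚ ∣ ℚ.≤ ε
      bound (suc m) le = near m le (∑-multiples d′ (suc m) h)

    coprime : ℕ → Vec ℕ 1 → ℚ
    coprime p = branch p (λ _ → 0ℚ) (λ _ → 1ℚ)

    sifted : ℕ → Vec ℕ 1 → ℚ
    sifted z x = ∏ᵖ z (λ p → coprime p x)

    sifted-lim : ∀ z → Lim (λ n → W n (sifted z)) (∏ᵖ z (jordanFactor s))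
    sifted-lim z = span-lim W-linear W-χᵛ-lim (ext (λ _ → refl) (∏ᵖ-cong z (λ p _ → mean (h p)))
      (span-∏ᵖ (λ p _ → span-branch (span-const 0ℚ) (span-const 1ℚ)) z))
      where
      mean : ∀ v → v * 0ℚ + (1ℚ - v * 1ℚ) ≡ 1ℚ - v
      mean = solve 1 (λ v → v :* con 0ℚ :+ (con 1ℚ :- v :* con 1ℚ) := con 1ℚ :- v) refl

    sifted-indicates : ∀ z k → Indicates (sifted z (k ∷ [])) (∀ p → Prime p → p ≤ z → ¬ p ∣ k)
    sifted-indicates z k = indicates-∏ᵖ (λ p _ → indicates-pick (p ∣? k) 0-indicates-⊥ (inj₁ (tt , refl))
      (λ p∣k → (λ ()) , (λ p∤k → p∤k p∣k)) (λ p∤k → (λ _ → p∤k) , λ _ → tt)) z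

    indicated-bounds : ∀ {q P} → Indicates q P → 0ℚ ℚ.≤ q × q ℚ.≤ 1ℚ
    indicated-bounds (inj₁ (_ , refl)) = 0≤1 , ℚ.≤-refl
    indicated-bounds (inj₂ (_ , refl)) = ℚ.≤-refl , 0≤1

    holds⇒≡1 : ∀ {q P} → Indicates q P → P → q ≡ 1ℚ
    holds⇒≡1 (inj₁ (_ , q≡)) p = q≡
    holds⇒≡1 (inj₂ (¬p , _)) p = ⊥-elim (¬p p)

    fails⇒≡0 : ∀ {q P} → Indicates q P → ¬ P → q ≡ 0ℚ
    fails⇒≡0 (inj₁ (p , _))  ¬p = ⊥-elim (¬p p)
    fails⇒≡0 (inj₂ (_ , q≡)) ¬p = q≡

    term-bounds : ∀ z k → 0ℚ ℚ.≤ h (suc k) * sifted z (suc k ∷ []) × h (suc k) * sifted z (suc k ∷ []) ℚ.≤ h (suc k)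
    term-bounds z k = bounds (0≤h k) (indicated-bounds (sifted-indicates z (suc k)))
      where
      bounds : ∀ {a b} → 0ℚ ℚ.≤ a → 0ℚ ℚ.≤ b × b ℚ.≤ 1ℚ → 0ℚ ℚ.≤ a * b × a * b ℚ.≤ a
      bounds {a} {b} 0≤a (0≤b , b≤1) = 0≤* 0≤a 0≤b ,
        ℚ.≤-trans (ℚ.*-monoˡ-≤-nonNeg a {{ℚ.nonNegative 0≤a}} b≤1) (ℚ.≤-reflexive (ℚ.*-identityʳ a))

    ∑h-1 : ∀ z → ∑h 1 (sifted z) ≡ 1ℚ
    ∑h-1 z = trans (ℚ.+-identityˡ (h 1 * sifted z (1 ∷ [])))
      (cong₂ _*_ h-1 (holds⇒≡1 (sifted-indicates z 1) (λ p pp _ → prime-∤-1 pp)))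

    1≤∑h : ∀ z n → 1ℚ ℚ.≤ ∑h (suc n) (sifted z)
    1≤∑h z zero    = ℚ.≤-reflexive (sym (∑h-1 z))
    1≤∑h z (suc n) = 1≤+ˡ {∑h (suc n) (sifted z)} (1≤∑h z n) (proj₁ (term-bounds z (suc n)))

    -- All of 2, …, z is sifted out.
    ∑h≤1 : ∀ z n → n ≤ z → ∑h n (sifted z) ℚ.≤ 1ℚ
    ∑h≤1 z zero          _   = 0≤1
    ∑h≤1 z (suc zero)    _   = ℚ.≤-reflexive (∑h-1 z)
    ∑h≤1 z (suc (suc n)) n≤z = subst (ℚ._≤ 1ℚ)
      (sym (vanish {∑h (suc n) (sifted z)} {h (suc (suc n))}
        (fails⇒≡0 (sifted-indicates z (suc (suc n))) (has-divisor (prime-divisor {suc (suc n)} (λ ()) (λ ()))))))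
      (∑h≤1 z (suc n) (ℕ.<⇒≤ n≤z))
      where
      vanish : ∀ {a b c} → c ≡ 0ℚ → a + b * c ≡ a
      vanish {a} {b} refl = trans (cong (λ t → a + t) (ℚ.*-zeroʳ b)) (ℚ.+-identityʳ a)
      has-divisor : ∃[ p ] Prime p × (p ∣ suc (suc n)) → ¬ (∀ p → Prime p → p ≤ z → ¬ p ∣ suc (suc n))
      has-divisor (p , pp , p∣) none = none p pp (ℕ.≤-trans (∣⇒≤ p∣) n≤z) p∣

    ∑h-upper : ∀ z n → z ≤ n → ∑h n (sifted z) ℚ.≤ 1ℚ + (ζₙ n - ζₙ z)
    ∑h-upper z n z≤ₙ = subst (λ k → ∑h k (sifted z) ℚ.≤ 1ℚ + (ζₙ k - ζₙ z)) (ℕ.m∸n+n≡m z≤ₙ) (go (n ℕ.∸ z))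
      where
      open ℚ.≤-Reasoning
      regroup : ∀ a b c → (1ℚ + (a - b)) + c ≡ 1ℚ + ((a + c) - b)
      regroup = solve 3 (λ a b c → (con 1ℚ :+ (a :- b)) :+ c := con 1ℚ :+ ((a :+ c) :- b)) refl
      go : ∀ k → ∑h (k ℕ.+ z) (sifted z) ℚ.≤ 1ℚ + (ζₙ (k ℕ.+ z) - ζₙ z)
      go zero    = ℚ.≤-trans (∑h≤1 z z ℕ.≤-refl)
        (ℚ.≤-reflexive (sym (trans (cong (λ t → 1ℚ + t) (ℚ.+-inverseʳ (ζₙ z))) (ℚ.+-identityʳ 1ℚ))))
      go (suc k) = begin
        ∑h (k ℕ.+ z) (sifted z) + h (suc (k ℕ.+ z)) * sifted z (suc (k ℕ.+ z) ∷ [])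
          ≤⟨ ℚ.+-mono-≤ (go k) (proj₂ (term-bounds z (k ℕ.+ z))) ⟩
        (1ℚ + (ζₙ (k ℕ.+ z) - ζₙ z)) + h (suc (k ℕ.+ z))
          ≡⟨ regroup (ζₙ (k ℕ.+ z)) (ζₙ z) (h (suc (k ℕ.+ z))) ⟩
        1ℚ + (ζₙ (suc (k ℕ.+ z)) - ζₙ z) ∎

    near-1 : ∀ {i t e} → 0ℚ ℚ.≤ i → i ℚ.≤ 1ℚ → 1ℚ ℚ.≤ t → t ℚ.≤ 1ℚ + e → ∣ i * t - i ∣ ℚ.≤ e
    near-1 {i} {t} {e} 0≤i i≤1 1≤t t≤ = begin
      ∣ i * t - i ∣   ≡⟨ cong ∣_∣ (solve 2 (λ i t → i :* t :- i := i :* (t :- con 1ℚ)) refl i t) ⟩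
      ∣ i * (t - 1ℚ) ∣ ≡⟨ ℚ.0≤p⇒∣p∣≡p (0≤* 0≤i (x-y≥0 1≤t)) ⟩
      i * (t - 1ℚ)    ≤⟨ *-mono 0≤i i≤1 (x-y≥0 1≤t) (x≤y+z⇒x-y≤z {t} {1ℚ} {e} t≤) ⟩
      1ℚ * e          ≡⟨ ℚ.*-identityˡ e ⟩
      e               ∎
      where open ℚ.≤-Reasoning

    euler-product : ∀ ε → 0ℚ ℚ.< ε → ∃[ K ] ∀ z → K ≤ z → ∃[ N ] ∀ n → N ≤ n →
      ∣ ∏ᵖ z (jordanFactor s) - ζ-seq s n ⁻¹ ∣ ℚ.≤ ε
    euler-product ε 0<ε = proj₁ c , λ z K≤z → suc (z ℕ.+ proj₁ (sl z)) , λ n N≤n →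
      subst (λ t → ∣ ∏ᵖ z (jordanFactor s) - t ⁻¹ ∣ ℚ.≤ ε) (sym (ζ-seq≡ζₙ n)) (bound z K≤z n N≤n)
      where
      c : ∃[ K ] ∀ m n → K ≤ m → K ≤ n → ∣ ζₙ m - ζₙ n ∣ ℚ.≤ half ε
      c = ζₙ-cauchy (half ε) (half-pos 0<ε)
      sl : ∀ z → ∃[ N ] ∀ n → N ≤ n → ∣ W n (sifted z) - ∏ᵖ z (jordanFactor s) ∣ ℚ.≤ half ε
      sl z = sifted-lim z .within (half ε) (half-pos 0<ε)
      bound : ∀ z → proj₁ c ≤ z → ∀ n → suc (z ℕ.+ proj₁ (sl z)) ≤ n → ∣ ∏ᵖ z (jordanFactor s) - ζₙ n ⁻¹ ∣ ℚ.≤ ε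
      bound z K≤z (suc m) (s≤s N≤m) = begin
        ∣ ∏ᵖ z (jordanFactor s) - ζₙ (suc m) ⁻¹ ∣
          ≤⟨ triangle (∏ᵖ z (jordanFactor s)) (W (suc m) (sifted z)) (ζₙ (suc m) ⁻¹) ⟩
        ∣ ∏ᵖ z (jordanFactor s) - W (suc m) (sifted z) ∣ + ∣ W (suc m) (sifted z) - ζₙ (suc m) ⁻¹ ∣
          ≡⟨ cong (λ t → t + ∣ W (suc m) (sifted z) - ζₙ (suc m) ⁻¹ ∣) (∣x-y∣-sym (∏ᵖ z (jordanFactor s)) (W (suc m) (sifted z))) ⟩
        ∣ W (suc m) (sifted z) - ∏ᵖ z (jordanFactor s) ∣ + ∣ W (suc m) (sifted z) - ζₙ (suc m) ⁻¹ ∣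
          ≤⟨ ℚ.+-mono-≤
               (proj₂ (sl z) (suc m) (ℕ.m≤n⇒m≤1+n (ℕ.≤-trans (ℕ.m≤n+m (proj₁ (sl z)) z) N≤m)))
               (near-1 {ζₙ (suc m) ⁻¹} {∑h (suc m) (sifted z)} (0≤ζₙ⁻¹ m) (ζₙ⁻¹≤1 m) (1≤∑h z m)
                 (ℚ.≤-trans (∑h-upper z (suc m) z≤n′) (ℚ.+-monoʳ-≤ 1ℚ
                   (ℚ.≤-trans (x≤∣x∣ (ζₙ (suc m) - ζₙ z)) (proj₂ c (suc m) z (ℕ.≤-trans K≤z z≤n′) K≤z))))) ⟩
        half ε + half ε
          ≡⟨ half+half ε ⟩
        ε ∎
        where
        open ℚ.≤-Reasoning
        z≤n′ : z ≤ suc m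
        z≤n′ = ℕ.m≤n⇒m≤1+n (ℕ.≤-trans (ℕ.m≤m+n z (proj₁ (sl z))) N≤m)
        x≤∣x∣ : ∀ x → x ℚ.≤ ∣ x ∣
        x≤∣x∣ x = [ (λ 0≤x → ℚ.≤-reflexive (sym (ℚ.0≤p⇒∣p∣≡p 0≤x))) , (λ x≤0 → ℚ.≤-trans x≤0 (ℚ.0≤∣p∣ x)) ]′ (ℚ.≤-total 0ℚ x)

open ZetaProduct

module Probabilities where
  open ProbabilitySpace
  open RandomVariable
  open Event-Lemmas
  open ℚ-Lemmas
  open import Data.Rational.Base using (_+_; _*_; _-_; -_; ∣_∣)

  HasValue : ℝ → ℚ → Set
  HasValue x q = Lim (seq x) q

  ≃ι⇒HasValue : ∀ {x q} → x ≃ ι q → HasValue x q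
  ≃ι⇒HasValue h = lim h

  HasValue-≃ : ∀ {x y q} → x ≃ y → HasValue y q → HasValue x q
  HasValue-≃ {x} {y} {q} x≃y hy = lim-cong (λ n → shift (seq x n) (seq y n)) (ℚ.+-identityʳ q)
    (lim-+ hy (lim (λ ε 0<ε → proj₁ (x≃y ε 0<ε) , λ n N≤n →
      subst (λ t → ∣ t ∣ ℚ.≤ ε) (sym (ℚ.+-identityʳ (seq x n - seq y n))) (proj₂ (x≃y ε 0<ε) n N≤n))))
    where
    shift : ∀ a b → b + (a - b) ≡ a
    shift = solve 2 (λ a b → b :+ (a :- b) := a) refl

  prodᴿ-value : ∀ {r q} (x : Fin r → ℝ) → (∀ j → HasValue (x j) q) → HasValue (prodᴿ x) (q ^ r)
  prodᴿ-value {zero}  x h = lim-const 1ℚ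
  prodᴿ-value {suc r} x h = lim-* (h zero) (prodᴿ-value (x ∘ suc) (h ∘ suc))

  module _ (𝒮 : ProbabilitySpace) where

    value-cong : ∀ {A B} (eA : IsEvent 𝒮 A) (eB : IsEvent 𝒮 B) {q} → A ≐ B →
      HasValue (ℙ 𝒮 A eA) q → HasValue (ℙ 𝒮 B eB) q
    value-cong eA eB {q} (f , g) = HasValue-≃ {ℙ 𝒮 _ eB} {ℙ 𝒮 _ eA} (ℙ-cong 𝒮 eB eA (g , f))

    value-∅ : ∀ {A} (eA : IsEvent 𝒮 A) → A ⊆ ∅ → HasValue (ℙ 𝒮 A eA) 0ℚ
    value-∅ {A} eA A⊆∅ .within ε 0<ε = proj₁ add , λ n N≤n →
      subst (ℚ._≤ ε) (cong-∣∣ (seq (ℙ 𝒮 A eA) n)) (proj₂ add n N≤n)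
      where
      x+x : HasValue (ℙ 𝒮 A eA -ᴿ (ℙ 𝒮 A eA +ᴿ ℙ 𝒮 A eA)) 0ℚ
      x+x = lim (λ ε 0<ε → let h = ℙ-∪ 𝒮 eA eA (λ (a , _) → A⊆∅ a)
                               k = ℙ-cong 𝒮 eA (∪-event 𝒮 eA eA) (inj₁ , λ { (inj₁ a) → a ; (inj₂ a) → a })
                               hk = half-pos 0<ε
                           in proj₁ (h (half ε) hk) ℕ.⊔ proj₁ (k (half ε) hk) , λ n N≤n →
        ℚ.≤-trans (ℚ.≤-reflexive (cong ∣_∣ (ℚ.+-identityʳ _)))
        (ℚ.≤-trans (triangle (seq (ℙ 𝒮 A eA) n) (seq (ℙ 𝒮 (A ∪ A) (∪-event 𝒮 eA eA)) n) (seq (ℙ 𝒮 A eA) n + seq (ℙ 𝒮 A eA) n))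
        (ℚ.≤-trans (ℚ.+-mono-≤
          (proj₂ (k (half ε) hk) n (ℕ.m⊔n≤o⇒n≤o (proj₁ (h (half ε) hk)) _ N≤n))
          (proj₂ (h (half ε) hk) n (ℕ.m⊔n≤o⇒m≤o _ (proj₁ (k (half ε) hk)) N≤n)))
        (ℚ.≤-reflexive (half+half ε)))))
      add : ∃[ N ] ∀ n → N ≤ n → ∣ (seq (ℙ 𝒮 A eA) n - (seq (ℙ 𝒮 A eA) n + seq (ℙ 𝒮 A eA) n)) - 0ℚ ∣ ℚ.≤ ε
      add = x+x .within ε 0<ε
      cong-∣∣ : ∀ a → ∣ (a - (a + a)) - 0ℚ ∣ ≡ ∣ a - 0ℚ ∣
      cong-∣∣ a = trans (cong ∣_∣ (solve 1 (λ a → (a :- (a :+ a)) :- con 0ℚ := :- (a :- con 0ℚ)) refl a))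
        (ℚ.∣-p∣≡∣p∣ (a - 0ℚ))

    value-⋃ : ∀ (A : ℕ → Pred (Ω 𝒮) 0ℓ) (eA : ∀ i → IsEvent 𝒮 (A i)) → (∀ i j → i ≢ j → A i ∩ A j ⊆ ∅) →
      ∀ n {q : ℕ → ℚ} → (∀ i → i < n → HasValue (ℙ 𝒮 (A i) (eA i)) (q i)) →
      (e : IsEvent 𝒮 (λ ω → ∃[ i ] i < n × A i ω)) → HasValue (ℙ 𝒮 (λ ω → ∃[ i ] i < n × A i ω) e) (∑ n q)
    value-⋃ A eA disjoint zero    h e = value-∅ e (λ ())
    value-⋃ A eA disjoint (suc n) {q} h e = value-cong (∪-event 𝒮 e′ (eA n)) e (to , from)
      (HasValue-≃ {x = ℙ 𝒮 _ (∪-event 𝒮 e′ (eA n))} {y = ℙ 𝒮 _ e′ +ᴿ ℙ 𝒮 _ (eA n)} (ℙ-∪ 𝒮 e′ (eA n) (λ ((i , i<n , a) , a′) → disjoint i n (ℕ.<⇒≢ i<n) (a , a′)))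
        (lim-+ (value-⋃ A eA disjoint n (λ i i<n → h i (ℕ.m<n⇒m<1+n i<n)) e′) (h n ℕ.≤-refl)))
      where
      e′ : IsEvent 𝒮 (λ ω → ∃[ i ] i < n × A i ω)
      e′ = finite-⋃-event 𝒮 A eA n
      to : ((λ ω → ∃[ i ] i < n × A i ω) ∪ A n) ⊆ (λ ω → ∃[ i ] i < suc n × A i ω)
      to (inj₁ (i , i<n , a)) = i , ℕ.m<n⇒m<1+n i<n , a
      to (inj₂ a)             = n , ℕ.n<1+n n , a
      from : (λ ω → ∃[ i ] i < suc n × A i ω) ⊆ ((λ ω → ∃[ i ] i < n × A i ω) ∪ A n)
      from (i , s≤s i≤n , a) with ℕ.m≤n⇒m<n∨m≡n i≤n
      ... | inj₁ i<n  = inj₁ (i , i<n , a)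
      ... | inj₂ refl = inj₂ a

    -- The event B carries the entries of the tuple that have already been fixed.
    value-avg : ∀ {n r} (X : Fin r → RandomVariable 𝒮 n) {B} (eB : IsEvent 𝒮 B) {β} →
      (∀ x → InBox n x → (e : IsEvent 𝒮 (λ ω → B ω × tuple X ω ≡ x)) → HasValue (ℙ 𝒮 _ e) (β * (fromℕ n ⁻¹) ^ r)) →
      ∀ {S} (S? : Decidable S) (e : IsEvent 𝒮 (λ ω → B ω × S (tuple X ω))) →
      HasValue (ℙ 𝒮 _ e) (β * avg n (λ x → [ S? x ]))
    value-avg {r = zero} X {B} eB {β} h {S} S? e = by-cases (S? [])
      where
      by-cases : (D? : Dec (S [])) → HasValue (ℙ 𝒮 _ e) (β * [ D? ])
      by-cases (yes s) = value-cong e′ e ((λ (b , _) → b , s) , λ (b , _) → b , refl) (h [] [] e′)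
        where
        e′ : IsEvent 𝒮 (λ ω → B ω × tuple X ω ≡ [])
        e′ = ≐-event 𝒮 ((λ b → b , refl) , proj₁) eB
      by-cases (no ¬s) = lim-cong (λ _ → refl) (sym (ℚ.*-zeroʳ β)) (value-∅ e (λ (_ , s) → ¬s s))
    value-avg {n} {suc r} X {B} eB {β} h {S} S? e = lim-cong (λ _ → refl) total
      (value-cong e⋃ e (to , from)
        (value-⋃ A eA (λ i j i≢j (((_ , p) , _) , ((_ , q) , _)) → i≢j (ℕ.suc-injective (trans (sym p) q))) n
          (λ k k<n → value-avg (X ∘ suc) (eBₖ k) {β * fromℕ n ⁻¹} (head-fixed k k<n) (λ x → S? (suc k ∷ x)) (eA k)) e⋃))
      where
      Bₖ A : ℕ → Pred (Ω 𝒮) 0ℓ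
      Bₖ k ω = B ω × value (X zero) ω ≡ suc k
      A k ω = Bₖ k ω × S (suc k ∷ tuple (X ∘ suc) ω)
      eBₖ : ∀ k → IsEvent 𝒮 (Bₖ k)
      eBₖ k = ∩-event 𝒮 eB (measurable (X zero) (suc k))
      eA : ∀ k → IsEvent 𝒮 (A k)
      eA k = ∩-event 𝒮 (eBₖ k) (∈-event (X ∘ suc) (λ x → S? (suc k ∷ x)))
      e⋃ : IsEvent 𝒮 (λ ω → ∃[ k ] k < n × A k ω)
      e⋃ = finite-⋃-event 𝒮 A eA n
      to : (λ ω → ∃[ k ] k < n × A k ω) ⊆ (λ ω → B ω × S (tuple X ω))
      to {ω} (k , _ , (b , p) , s) = b , subst (λ v → S (v ∷ tuple (X ∘ suc) ω)) (sym p) s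
      from : (λ ω → B ω × S (tuple X ω)) ⊆ (λ ω → ∃[ k ] k < n × A k ω)
      from {ω} (b , s) = go (value (X zero) ω) refl (1≤value (X zero) ω) (value≤n (X zero) ω)
        where
        go : ∀ v → value (X zero) ω ≡ v → 1 ≤ v → v ≤ n → ∃[ k ] k < n × A k ω
        go (suc k) p _ k<n = k , k<n , (b , p) , subst (λ v → S (v ∷ tuple (X ∘ suc) ω)) p s
      head-fixed : ∀ k → k < n → ∀ x → InBox n x → (e : IsEvent 𝒮 (λ ω → Bₖ k ω × tuple (X ∘ suc) ω ≡ x)) →
        HasValue (ℙ 𝒮 _ e) (β * fromℕ n ⁻¹ * (fromℕ n ⁻¹) ^ r)
      head-fixed k k<n x box e = lim-cong (λ _ → refl) (sym (ℚ.*-assoc β (fromℕ n ⁻¹) ((fromℕ n ⁻¹) ^ r)))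
        (value-cong e′ e
          ((λ (b , t) → (b , Vec.∷-injectiveˡ t) , Vec.∷-injectiveʳ t) , λ ((b , p) , t) → b , cong₂ _∷_ p t)
          (h (suc k ∷ x) ((s≤s z≤n , k<n) ∷ box) e′))
        where
        e′ : IsEvent 𝒮 (λ ω → B ω × tuple X ω ≡ suc k ∷ x)
        e′ = ∩-event 𝒮 eB (∈-event X (_≟ᵛ (suc k ∷ x)))
      total : ∑ n (λ k → β * fromℕ n ⁻¹ * avg n (λ x → [ S? (suc k ∷ x) ])) ≡ β * avg n (λ x → [ S? x ])
      total = trans (∑-*ˡ n (β * fromℕ n ⁻¹) (λ k → avg n (λ x → [ S? (suc k ∷ x) ])))
        (ℚ.*-assoc β (fromℕ n ⁻¹) (∑ n (λ k → avg n (λ x → [ S? (suc k ∷ x) ]))))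

    Prob-value : ∀ {n r} (X : Fin r → RandomVariable 𝒮 n) → (∀ j → Uniform (X j)) → Independent X →
      ∀ {S} (S? : Decidable S) → HasValue (Prob X S?) (avg n (λ x → [ S? x ]))
    Prob-value {n} {r} X uniform independent S? = lim-cong (λ _ → refl) (ℚ.*-identityˡ (avg n (λ x → [ S? x ])))
      (value-cong e (∈-event X S?) (proj₂ , (tt ,_))
        (value-avg X (U-event 𝒮) {1ℚ} (λ x box e′ → lim-cong (λ _ → refl) (sym (ℚ.*-identityˡ ((fromℕ n ⁻¹) ^ r)))
          (value-cong (∈-event X (_≟ᵛ x)) e′ ((tt ,_) , proj₂)
            (HasValue-≃ {Prob X (_≟ᵛ x)} {prodᴿ (marginal x)} (independent x) (prodᴿ-value (marginal x) (λ j →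
              ≃ι⇒HasValue {marginal x j} (uniform j (lookup x j) (proj₁ (All.lookup⁺ box j)) (proj₂ (All.lookup⁺ box j)))))))) S? e))
      where
      marginal : Vec ℕ r → Fin r → ℝ
      marginal x j = ℙ 𝒮 (λ ω → value (X j) ω ≡ lookup x j) (measurable (X j) (lookup x j))
      e : IsEvent 𝒮 (λ ω → U ω × _)
      e = ∩-event 𝒮 (U-event 𝒮) (∈-event X S?)

  tendsto : ∀ (s : ℕ → ℝ) (L : ℝ) (q : ℕ → ℚ) → (∀ m → HasValue (s m) (q (2 ℕ.+ m))) →
    (∀ ε → 0ℚ ℚ.< ε → ∃[ K ] ∀ n → K ≤ n → ∃[ N ] ∀ k → N ≤ k → ∣ q n - seq L k ∣ ℚ.≤ ε) → Tendsto s L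
  tendsto s L q value close ε 0<ε = proj₁ c , λ m K≤m ε′ 0<ε′ →
    let v = value m .within ε′ 0<ε′
        d = proj₂ c (2 ℕ.+ m) (ℕ.≤-trans K≤m (ℕ.m≤n+m m 2))
    in proj₁ v ℕ.⊔ proj₁ d , λ k N≤k → ℚ.≤-trans
      (triangle (seq (s m) k) (q (2 ℕ.+ m)) (seq L k))
      (ℚ.≤-trans (ℚ.+-mono-≤ (proj₂ v k (ℕ.m⊔n≤o⇒m≤o (proj₁ v) (proj₁ d) N≤k))
                             (proj₂ d k (ℕ.m⊔n≤o⇒n≤o (proj₁ v) (proj₁ d) N≤k)))
        (ℚ.≤-reflexive (ℚ.+-comm ε′ ε)))
    where
    c : ∃[ K ] ∀ n → K ≤ n → ∃[ N ] ∀ k → N ≤ k → ∣ q n - seq L k ∣ ℚ.≤ ε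
    c = close ε 0<ε

open Probabilities

module Assembly where
  open ℚ-Lemmas
  open Cauchy-Lemmas
  open Series-Lemmas
  open import Data.Rational.Base using (_+_; _*_; _-_; -_)
  open import Data.Nat.Divisibility using (_∣_; ∣⇒≤; ∣-trans; 0∣⇒≡0)

  module Main {r′} (a : Vec ℕ (suc (suc r′))) (a>0 : ∀ i → 0 < lookup a i) (co : PairwiseCoprime a) where

    open Densities a a>0 co

    avoid-large : ∀ {p} x → Prime p → A < p → Avoid p a x
    avoid-large x pp A<p i (p∣aᵢ , _) = ℕ.<⇒≱ A<p (∣⇒≤ {{ℕ.>-nonZero 0<A}} (∣-trans p∣aᵢ (lookup∣∏ a i)))

    LocalPC LocalC : ℕ → Vec ℕ (suc (suc r′)) → Set
    LocalPC p x = Avoid p a x × ¬ Pair p x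
    LocalC  p x = Avoid p a x × ¬ (∀ i → p ∣ lookup x i)

    PC⇒LocalPC : ∀ x → PC a x → ∀ p → Prime p → LocalPC p x
    PC⇒LocalPC x (_ , coprime , avoid) p pp =
      (λ i (p∣aᵢ , p∣xᵢ) → gcd≡1⇒ (avoid i) pp p∣aᵢ p∣xᵢ) ,
      (λ (i , j , i≢j , p∣xᵢ , p∣xⱼ) → gcd≡1⇒ (coprime i j i≢j) pp p∣xᵢ p∣xⱼ)

    LocalPC⇒PC : ∀ n x → InBox n x → (∀ p → Prime p → LocalPC p x) → PC a x
    LocalPC⇒PC n x box local =
      (λ i → proj₁ (All.lookup⁺ box i)) ,
      (λ i j i≢j → gcd≡1 (proj₁ (All.lookup⁺ box i))
        (λ p pp (p∣xᵢ , p∣xⱼ) → proj₂ (local p pp) (i , j , i≢j , p∣xᵢ , p∣xⱼ))) ,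
      (λ i → gcd≡1 (a>0 i) (λ p pp → proj₁ (local p pp) i))

    C⇒LocalC : ∀ x → C a x → ∀ p → Prime p → LocalC p x
    C⇒LocalC x (_ , coprime , avoid) p pp =
      (λ i (p∣aᵢ , p∣xᵢ) → gcd≡1⇒ (avoid i) pp p∣aᵢ p∣xᵢ) ,
      (λ all → prime-∤-1 pp (subst (p ∣_) coprime (gcd-entries-greatest x all)))

    LocalC⇒C : ∀ n x → InBox n x → (∀ p → Prime p → LocalC p x) → C a x
    LocalC⇒C n x box local =
      (λ i → proj₁ (All.lookup⁺ box i)) ,
      no-prime-divisor⇒≡1
        (λ g≡0 → ℕ.<⇒≢ (proj₁ (All.lookup⁺ box zero))
          (sym (0∣⇒≡0 (subst (_∣ lookup x zero) g≡0 (gcd-entries∣ x zero)))))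
        (λ p pp p∣g → proj₂ (local p pp) (λ i → ∣-trans p∣g (gcd-entries∣ x i))) ,
      (λ i → gcd≡1 (a>0 i) (λ p pp → proj₁ (local p pp) i))

    module PC-Sieve = Sieve (PC? a) LocalPC (λ p → atMost1 p a) meanPC A
      (λ p _ x → atMost1-indicates p a x) span-PC PC⇒LocalPC LocalPC⇒PC
      (λ p x pp A<p ¬pair → avoid-large x pp A<p , ¬pair)

    module C-Sieve = Sieve (C? a) LocalC (λ p → notAll p a) meanC A
      (λ p pp x → notAll-indicates p pp a x) span-C C⇒LocalC LocalC⇒C
      (λ p x pp A<p ¬pair → avoid-large x pp A<p , λ all → ¬pair (zero , suc zero , (λ ()) , all zero , all (suc zero)))

    cPC cC : ℚ
    cPC = Ψ (+ r′) A ÷₀ Ψ (+ suc r′) A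
    cC  = φ A ÷₀ jordan r A * fromℕ A ^ suc r′

    limitPC : ℝ
    limitPC = T r *ᴿ ι cPC

    limitC : 2 ≤ r → ℝ
    limitC 2≤r = recip (ζ r 2≤r) (ζ-positive r 2≤r) *ᴿ ι cC

    ∏-meanPC-lim : ∀ ε → 0ℚ ℚ.< ε →
      ∃[ K ] ∀ z → K ≤ z → ∃[ N ] ∀ k → N ≤ k → ℚ.∣ ∏ᵖ z meanPC - seq limitPC k ∣ ℚ.≤ ε
    ∏-meanPC-lim ε 0<ε = proj₁ c ℕ.⊔ A , λ z K≤z → proj₁ c , λ k N≤k →
      subst (λ t → ℚ.∣ t - seq limitPC k ∣ ℚ.≤ ε) (sym (∏-meanPC z (ℕ.m⊔n≤o⇒n≤o (proj₁ c) A K≤z)))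
        (proj₂ c z k (ℕ.m⊔n≤o⇒m≤o (proj₁ c) A K≤z) N≤k)
      where
      c : ∃[ N ] ∀ m n → N ≤ m → N ≤ n → ℚ.∣ seq limitPC m - seq limitPC n ∣ ℚ.≤ ε
      c = cauchy limitPC ε 0<ε

    ∏-meanC-lim : ∀ 2≤r ε → 0ℚ ℚ.< ε →
      ∃[ K ] ∀ z → K ≤ z → ∃[ N ] ∀ k → N ≤ k → ℚ.∣ ∏ᵖ z meanC - seq (limitC 2≤r) k ∣ ℚ.≤ ε
    ∏-meanC-lim 2≤r ε 0<ε = proj₁ c ℕ.⊔ A , λ z K≤z →
      proj₁ (proj₂ c z (ℕ.m⊔n≤o⇒m≤o (proj₁ c) A K≤z)) , λ k N≤k →
      subst (λ t → ℚ.∣ t - seq (limitC 2≤r) k ∣ ℚ.≤ ε) (sym (∏-meanC z (ℕ.m⊔n≤o⇒n≤o (proj₁ c) A K≤z)))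
        (scaled {∏ᵖ z (jordanFactor r)} {ζ-seq r k ⁻¹} cC (proj₂ (proj₂ c z (ℕ.m⊔n≤o⇒m≤o (proj₁ c) A K≤z)) k N≤k))
      where
      δ : ℚ
      δ = ε * (ℚ.∣ cC ∣ + 1ℚ) ⁻¹
      c : ∃[ K ] ∀ z → K ≤ z → ∃[ N ] ∀ k → N ≤ k → ℚ.∣ ∏ᵖ z (jordanFactor r) - ζ-seq r k ⁻¹ ∣ ℚ.≤ δ
      c = EulerProduct.euler-product r 2≤r δ (0<* 0<ε (⁻¹-pos (0<∣x∣+1 cC)))
      scaled : ∀ {x y} c → ℚ.∣ x - y ∣ ℚ.≤ ε * (ℚ.∣ c ∣ + 1ℚ) ⁻¹ → ℚ.∣ x * c - y * c ∣ ℚ.≤ ε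
      scaled {x} {y} c h = begin
        ℚ.∣ x * c - y * c ∣          ≡⟨ cong ℚ.∣_∣ (solve 3 (λ x y c → x :* c :- y :* c := c :* (x :- y)) refl x y c) ⟩
        ℚ.∣ c * (x - y) ∣            ≡⟨ ℚ.∣p*q∣≡∣p∣*∣q∣ c (x - y) ⟩
        ℚ.∣ c ∣ * ℚ.∣ x - y ∣        ≤⟨ *-mono (ℚ.0≤∣p∣ c) (x≤x+y ℚ.∣ c ∣ 0≤1) (ℚ.0≤∣p∣ (x - y)) h ⟩
        (ℚ.∣ c ∣ + 1ℚ) * (ε * (ℚ.∣ c ∣ + 1ℚ) ⁻¹)  ≡⟨ cancel (0<∣x∣+1 c) ε ⟩
        ε                            ∎
        where open ℚ.≤-Reasoning

open Assembly

open import Data.Nat.Base using (_+_)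

theorem3p1 :
    (r : ℕ) (2≤r : 2 ≤ r) (a : Vec ℕ r) →
    (∀ i → 0 < lookup a i) → PairwiseCoprime a →
    (𝒮 : ℕ → ProbabilitySpace) →
    -- X m is the random vector X⁽ⁿ⁾ with n = 2 + m
    (X : ∀ m → Fin r → RandomVariable (𝒮 m) (2 + m)) →
    (∀ m j → Uniform (X m j)) →
    (∀ m → Independent (X m)) →
    Tendsto (λ m → Prob (X m) (PC? a))
      (T r *ᴿ ι (Ψ (+ r ℤ.- + 2) (∏-entries a) ÷₀ Ψ (+ r ℤ.- + 1) (∏-entries a)))
    ×
    Tendsto (λ m → Prob (X m) (C? a))
      (recip (ζ r 2≤r) (ζ-positive r 2≤r)
        *ᴿ ι (φ (∏-entries a) ÷₀ jordan r (∏-entries a) ℚ.* fromℕ (∏-entries a) ^ (r ∸ 1)))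
theorem3p1 (suc (suc r′)) 2≤r a a>0 co 𝒮 X uniform independent =
  tendsto (λ m → Prob (X m) (PC? a)) limitPC (λ n → avg n (λ x → [ PC? a x ]))
    (λ m → Prob-value (𝒮 m) (X m) (uniform m) (independent m) (PC? a))
    (PC-Sieve.density (seq limitPC) ∏-meanPC-lim) ,
  tendsto (λ m → Prob (X m) (C? a)) (limitC 2≤r) (λ n → avg n (λ x → [ C? a x ]))
    (λ m → Prob-value (𝒮 m) (X m) (uniform m) (independent m) (C? a))
    (C-Sieve.density (seq (limitC 2≤r)) (∏-meanC-lim 2≤r))
  where open Main a a>0 co
theorem3p1 (suc zero) (s≤s ())
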